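{- Let $m\ge 0$ and $n=m+3$. For every $(\boldsymbol x,\boldsymbol y)$-weighted triangulation $\Delta$ of the labeled convex $n$-gon $P_n$ there is a unique normalized positive Laurent decorated frieze $\mathcal F_\Delta=(W_{i,j})$ of width $m$ such that $W_{i,j}=\operatorname{wt}([v_i,v_j])$ whenever $1\le i<j\le n$ and $[v_i,v_j]$ is a boundary edge of $P_n$ or a diagonal of $\Delta$. The map $$\Delta\longmapsto \mathcal F_\Delta$$ is a bijection from the set of $(\boldsymbol x,\boldsymbol y)$-weighted triangulations of $P_n$ onto the set of normalized positive Laurent decorated friezes of width $m$. Moreover, the quiddity entries $a_i=W_{i,i+2}$ of $\mathcal F_\Delta$ are given by $a_i=Q_\Delta(v_{i+1})$ for all $i$, where for a vertex $v$ $$Q_\Delta(v)=\frac{\displaystyle\sum_{T\in\Delta,\ v\in T}\operatorname{wt}(\operatorname{opp}_v(T))\prod_{e\in E_v\setminus E_v(T)}\operatorname{wt}(e)}{\displaystyle\prod_{d\in D_v}\operatorname{wt}(d)} .$$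
   Context: Fix an integer $m\ge 0$ and put $n=m+3$. Let $\boldsymbol x=(x_1,\dots,x_m)$, $\boldsymbol y=(y_1,\dots,y_n)$ be algebraically independent variables, extend $y_{i+n}=y_i$ for $i\in\mathbb Z$, and put $\mathscr R_m=\mathbb Z[x_1^{\pm1},\dots,x_m^{\pm1},y_1^{\pm1},\dots,y_n^{\pm1}]$. A closed decorated frieze of width $m$ is a family $\mathcal F=(W_{i,j})$ of elements of $\mathscr R_m$, indexed by $i,j\in\mathbb Z$ with $0\le j-i\le n$, such that: (D1) $W_{i,i}=0$ and $W_{i,i+n}=0$ for all $i$; (D2) $W_{i,i+1}=y_i$ and $W_{i,i+n-1}=y_{i-1}$ for all $i$; (D3) every interior entry, i.e. every $W_{i,j}$ with $2\le j-i\le n-2$, is nonzero; (D4) for all $i,j$ with $1\le j-i\le n-1$, $W_{i,j}W_{i+1,j+1}-W_{i+1,j}W_{i,j+1}=y_iy_j$. No periodicity of the entries is assumed. It is a positive Laurent decorated frieze if every nonzero entry is a Laurent polynomial with nonnegative integer coefficients in the variables $x_1,\dots,x_m,y_1,\dots,y_n$. It is normalized (with respect to $\boldsymbol x$) if (N1) every interior entry that is a Laurent monomial (a product of integer powers of the variables) is one of $x_1,\dots,x_m$, and (N2) every $x_k$ occurs as an interior entry. $P_n$ is a convex $n$-gon with cyclically labeled vertices $v_1,\dots,v_n$ ($v_{i+n}=v_i$). An $(\boldsymbol x,\boldsymbol y)$-weighted triangulation $\Delta$ of $P_n$ is a triangulation of $P_n$ by pairwise non-crossing diagonals together with weights $\operatorname{wt}$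 on its edges: the boundary edge $[v_i,v_{i+1}]$ has weight $y_i$, and the $m=n-3$ internal diagonals are labeled bijectively by $x_1,\dots,x_m$. For a vertex $v$: $E_v$ is the set of all triangulation edges (boundary edges and diagonals) incident to $v$; $D_v\subset E_v$ is the set of internal diagonals incident to $v$; for a triangle $T$ of $\Delta$ containing $v$, $E_v(T)$ is the set of the two sides of $T$ incident to $v$ and $\operatorname{opp}_v(T)$ is the side of $T$ opposite $v$. Empty products equal $1$. -}

module Defs where

open import Data.Bool.Base using (if_then_else_)
open import Data.Nat.Base as ℕ using (ℕ; suc; _∸_)
import Data.Nat.DivMod as ℕ
open import Data.Integer.Base as ℤ using (ℤ; +_; 0ℤ; 1ℤ; -1ℤ)
open import Data.Integer.DivMod using (_%ℕ_; n%ℕd<d)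
import Data.Integer.Properties as ℤ
open import Data.Fin.Base as Fin using (Fin; toℕ; fromℕ<; _↑ˡ_; _↑ʳ_)
import Data.Fin.Properties as Fin
open import Data.List.Base as List
  using (List; []; _∷_; _++_; map; filter; foldr; allFin; cartesianProductWith)
open import Data.Vec.Base as Vec using (Vec; zipWith; replicate; _[_]≔_)
import Data.Vec.Properties as Vec
open import Data.Product using (_×_; _,_; ∃; ∃₂; proj₁; proj₂)
import Data.Product.Properties as Product
open import Data.Sum.Base using (_⊎_; inj₁; inj₂)
import Data.Sum.Properties as Sum
open import Function.Definitions using (Injective)
open import Relation.Binary.Definitions using (DecidableEquality)
open import Relation.Binary.PropositionalEquality using (_≡_; _≗_)
open import Relation.Nullary using (¬_; Dec; does; ¬?; _×-dec_; _⊎-dec_)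

-- Laurent polynomials over ℤ in N variables: the group ring ℤ[ℤᴺ].  An element
-- is a finite formal sum of terms c·z^α; terms may repeat and coefficients may
-- vanish, so equality is equality of all collected coefficients.

Exponent : ℕ → Set
Exponent N = Vec ℤ N

Laurent : ℕ → Set
Laurent N = List (ℤ × Exponent N)

module _ {N : ℕ} where

  coeff : Laurent N → Exponent N → ℤ
  coeff []            α = 0ℤ
  coeff ((c , β) ∷ p) α =
    (if does (Vec.≡-dec ℤ._≟_ β α) then c else 0ℤ) ℤ.+ coeff p α

  infix 4 _≈_
  record _≈_ (p q : Laurent N) : Set where
    constructor mk≈
    field
      coeff≡ : coeff p ≗ coeff q

  monomial : Exponent N → Laurent N
  monomial α = (1ℤ , α) ∷ []

  0ᴸ 1ᴸ : Laurent N
  0ᴸ = []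
  1ᴸ = monomial (replicate N 0ℤ)

  infixl 6 _+ᴸ_ _-ᴸ_
  infixl 7 _*ᴸ_

  _+ᴸ_ _-ᴸ_ _*ᴸ_ : Laurent N → Laurent N → Laurent N
  p +ᴸ q = p ++ q
  p -ᴸ q = p ++ map (λ { (d , β) → ℤ.- d , β }) q
  p *ᴸ q = cartesianProductWith
             (λ { (c , α) (d , β) → c ℤ.* d , zipWith ℤ._+_ α β }) p q

  sumᴸ productᴸ : List (Laurent N) → Laurent N
  sumᴸ     = foldr _+ᴸ_ 0ᴸ
  productᴸ = foldr _*ᴸ_ 1ᴸ

  var var⁻¹ : Fin N → Laurent N
  var   k = monomial (replicate N 0ℤ [ k ]≔ 1ℤ)
  var⁻¹ k = monomial (replicate N 0ℤ [ k ]≔ -1ℤ)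

  IsMonomial : Laurent N → Set
  IsMonomial p = ∃ λ α → p ≈ monomial α

  NonNegative : Laurent N → Set
  NonNegative p = ∀ α → 0ℤ ℤ.≤ coeff p α

module Frieze (m : ℕ) where

  n : ℕ
  n = 3 ℕ.+ m

  R : Set
  R = Laurent (m ℕ.+ n)

  -- Subscripts modulo n are residues in Fin n; the residue 0 stands for the
  -- subscript n, so that the cyclic order of v₁, …, vₙ is respected.
  Vertex : Set
  Vertex = Fin n

  vertex : ℤ → Vertex
  vertex i = fromℕ< (n%ℕd<d i n)

  next : Vertex → Vertex
  next v = suc (toℕ v) ℕ.mod n

  x x⁻¹ : Fin m → R
  x   k = var   (k ↑ˡ n)
  x⁻¹ k = var⁻¹ (k ↑ˡ n)

  yᵥ : Vertex → R
  yᵥ v = var (m ↑ʳ v)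

  y : ℤ → R
  y i = yᵥ (vertex i)

  Gap : ℕ → ℕ → ℤ → ℤ → Set
  Gap lo hi i j = + lo ℤ.≤ j ℤ.- i × j ℤ.- i ℤ.≤ + hi

  Interior : ℤ → ℤ → Set
  Interior = Gap 2 (n ∸ 2)

  -- W is total for convenience, but only its values with 0 ≤ j - i ≤ n belong
  -- to the frieze: no condition below mentions other values, and _≈F_ ignores
  -- them.
  record IsDecoratedFrieze (W : ℤ → ℤ → R) : Set where
    field
      D1ˡ : ∀ i → W i i ≈ 0ᴸ
      D1ʳ : ∀ i → W i (i ℤ.+ + n) ≈ 0ᴸ
      D2ˡ : ∀ i → W i (i ℤ.+ + 1) ≈ y i
      D2ʳ : ∀ i → W i (i ℤ.+ + (n ∸ 1)) ≈ y (i ℤ.- + 1)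
      D3  : ∀ i j → Interior i j → ¬ (W i j ≈ 0ᴸ)
      D4  : ∀ i j → Gap 1 (n ∸ 1) i j →
            W i j *ᴸ W (i ℤ.+ + 1) (j ℤ.+ + 1) -ᴸ W (i ℤ.+ + 1) j *ᴸ W i (j ℤ.+ + 1)
              ≈ y i *ᴸ y j

  IsPositiveLaurent : (ℤ → ℤ → R) → Set
  IsPositiveLaurent W =
    ∀ i j → Gap 0 n i j → ¬ (W i j ≈ 0ᴸ) → NonNegative (W i j)

  record IsNormalized (W : ℤ → ℤ → R) : Set where
    field
      N1 : ∀ i j → Interior i j → IsMonomial (W i j) → ∃ λ k → W i j ≈ x k
      N2 : ∀ k → ∃₂ λ i j → Interior i j × W i j ≈ x k

  record NormalizedPositiveFrieze : Set where
    field
      W                 : ℤ → ℤ → R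
      isDecoratedFrieze : IsDecoratedFrieze W
      isPositiveLaurent : IsPositiveLaurent W
      isNormalized      : IsNormalized W

  open NormalizedPositiveFrieze public using (W)

  infix 4 _≈F_
  _≈F_ : NormalizedPositiveFrieze → NormalizedPositiveFrieze → Set
  F ≈F G = ∀ i j → Gap 0 n i j → W F i j ≈ W G i j

  Chord : Set
  Chord = Vertex × Vertex

  -- A diagonal is listed with its smaller endpoint first, so that equality of
  -- diagonals is propositional equality of pairs.
  IsDiagonal : Chord → Set
  IsDiagonal (u , v) = u Fin.< v × ¬ (v ≡ next u) × ¬ (u ≡ next v)

  Crosses : Chord → Chord → Set
  Crosses (a , b) (c , d) =
    (a Fin.< c × c Fin.< b × b Fin.< d) ⊎ (c Fin.< a × a Fin.< d × d Fin.< b)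

  -- A maximal set of pairwise non-crossing diagonals, labelled bijectively by
  -- x₁, …, xₘ: `diagonal k` is the diagonal of weight x k.
  record WeightedTriangulation : Set where
    field
      diagonal    : Fin m → Chord
      isDiagonal  : ∀ k → IsDiagonal (diagonal k)
      distinct    : Injective _≡_ _≡_ diagonal
      nonCrossing : ∀ k l → ¬ Crosses (diagonal k) (diagonal l)
      maximal     : ∀ c → IsDiagonal c → (∀ k → ¬ Crosses c (diagonal k)) →
                    ∃ λ k → diagonal k ≡ c

  open WeightedTriangulation public using (diagonal)

  infix 4 _≈T_
  _≈T_ : WeightedTriangulation → WeightedTriangulation → Set
  Δ ≈T Δ′ = diagonal Δ ≗ diagonal Δ′

  -- inj₁ k is the diagonal labelled x k; inj₂ v is the boundary edge
  -- [v , next v].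
  Edge : Set
  Edge = Fin m ⊎ Fin n

  _≟ᴱ_ : DecidableEquality Edge
  _≟ᴱ_ = Sum.≡-dec Fin._≟_ Fin._≟_

  edges : List Edge
  edges = map inj₁ (allFin m) ++ map inj₂ (allFin n)

  wt : Edge → R
  wt (inj₁ k) = x k
  wt (inj₂ v) = yᵥ v

  module _ (Δ : WeightedTriangulation) where

    endpoints : Edge → Chord
    endpoints (inj₁ k) = diagonal Δ k
    endpoints (inj₂ v) = v , next v

    Incident : Vertex → Edge → Set
    Incident v e = v ≡ proj₁ (endpoints e) ⊎ v ≡ proj₂ (endpoints e)

    incident? : ∀ v e → Dec (Incident v e)
    incident? v e =
      (v Fin.≟ proj₁ (endpoints e)) ⊎-dec (v Fin.≟ proj₂ (endpoints e))

    Joins : Edge → Vertex → Vertex → Set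
    Joins e u v = endpoints e ≡ (u , v) ⊎ endpoints e ≡ (v , u)

    joins? : ∀ e u v → Dec (Joins e u v)
    joins? e u v = (endpoints e ≟ (u , v)) ⊎-dec (endpoints e ≟ (v , u))
      where _≟_ = Product.≡-dec Fin._≟_ Fin._≟_

    record Triple : Set where
      constructor triple
      field
        p q r       : Vertex
        qr-side pr-side pq-side : Edge

    open Triple

    -- Since the diagonals do not cross, three vertices pairwise joined by edges
    -- of Δ bound a face.  The ordering lists every triangle exactly once.
    IsTriangle : Triple → Set
    IsTriangle (triple p q r qr pr pq) =
      (p Fin.< q × q Fin.< r) × (Joins qr q r × Joins pr p r × Joins pq p q)

    isTriangle? : ∀ T → Dec (IsTriangle T)
    isTriangle? (triple p q r qr pr pq) =
      ((p Fin.<? q) ×-dec (q Fin.<? r)) ×-dec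
      (joins? qr q r ×-dec joins? pr p r ×-dec joins? pq p q)

    triples : List Triple
    triples =
      List.concatMap (λ p → List.concatMap (λ q → List.concatMap (λ r →
      List.concatMap (λ qr → List.concatMap (λ pr →
        map (triple p q r qr pr) edges)
      edges) edges) (allFin n)) (allFin n)) (allFin n)

    triangles : List Triple
    triangles = filter isTriangle? triples

    Contains : Vertex → Triple → Set
    Contains v T = v ≡ p T ⊎ v ≡ q T ⊎ v ≡ r T

    contains? : ∀ v T → Dec (Contains v T)
    contains? v T =
      (v Fin.≟ p T) ⊎-dec ((v Fin.≟ q T) ⊎-dec (v Fin.≟ r T))

    opp : Vertex → Triple → Edge
    opp v T =
      if does (v Fin.≟ p T) then qr-side T else
      if does (v Fin.≟ q T) then pr-side T else pq-side T

    IsSide : Edge → Triple → Set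
    IsSide e T = e ≡ qr-side T ⊎ e ≡ pr-side T ⊎ e ≡ pq-side T

    isSide? : ∀ e T → Dec (IsSide e T)
    isSide? e T =
      (e ≟ᴱ qr-side T) ⊎-dec ((e ≟ᴱ pr-side T) ⊎-dec (e ≟ᴱ pq-side T))

    -- E_v, D_v, and E_v ∖ E_v(T): as E_v(T) is the set of sides of T lying in
    -- E_v, the last consists of the elements of E_v that are not sides of T.
    edgesAt : Vertex → List Edge
    edgesAt v = filter (incident? v) edges

    diagonalsAt : Vertex → List (Fin m)
    diagonalsAt v = filter (λ k → incident? v (inj₁ k)) (allFin m)

    edgesAtOutside : Vertex → Triple → List Edge
    edgesAtOutside v T = filter (λ e → ¬? (isSide? e T)) (edgesAt v)

    -- Every d ∈ D_v is some inj₁ k of weight x k, so dividing by ∏ wt(d) is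
    -- multiplying by the units x⁻¹ k.
    Q : Vertex → R
    Q v =
      sumᴸ (map (λ T → wt (opp v T) *ᴸ productᴸ (map wt (edgesAtOutside v T)))
                (filter (contains? v) triangles))
      *ᴸ productᴸ (map x⁻¹ (diagonalsAt v))

  Extends : WeightedTriangulation → NormalizedPositiveFrieze → Set
  Extends Δ F =
    ∀ i j → + 1 ℤ.≤ i → i ℤ.< j → j ℤ.≤ + n →
    ∀ e → Joins Δ e (vertex i) (vertex j) → W F i j ≈ wt e

{-# OPTIONS --safe #-}

-- Below the side [v₀, vₙ₋₁] and below every diagonal of a triangulation hangs one triangle, so the
-- triangulation is a binary tree.  Descending the tree one places vectors of the plane at the
-- vertices so that the determinant of the two ends of each edge is the weight of the edge; only
-- edge weights, which are units, are divided by.  The determinants of all pairs of vertices form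
-- the frieze, and its diamond rule is an instance of Plücker's relation, that is, of Ptolemy's.
-- Ptolemy's relation for quadrilaterals having an edge of the triangulation as a diagonal
-- determines all entries from the edge weights, and shows that they are positive.
--
-- Conversely, non-vanishing of the entries of a frieze turns the diamond rule into a three-term
-- recurrence common to all rows.  Hence every entry is, up to a factor y, a 2 × 2 minor of two
-- adjacent rows, which yields the glide symmetry and Ptolemy's relation for all quadrilaterals.
--
-- Two crossing chords are never both monomials: their product is a sum of two positive elements,
-- so its coefficients add up to at least 2.  Therefore monomial entries of a triangulation's
-- frieze sit on its diagonals, and the m chords carrying x₁, …, xₘ in a normalized frieze do not
-- cross; as n − 3 non-crossing diagonals they form a triangulation.
--
-- For the quiddity, Ptolemy's relation divided by the weights of three chords at a common vertex
-- telescopes over the fan of triangles at that vertex.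
module Submission where

open import Defs
open import Level using (0ℓ)
open import Algebra.Bundles using (CommutativeMonoid; CommutativeRing)
open import Data.Bool.Base using (true; false; if_then_else_)
open import Data.Nat.Base as ℕ using (ℕ; zero; suc; _∸_; z≤n; s≤s)
import Data.Nat.Properties as ℕ
import Data.Nat.DivMod as ℕ
open import Data.Integer.Base as ℤ using (ℤ; +_; _+_; 0ℤ; 1ℤ; -1ℤ)
import Data.Integer.Properties as ℤ
import Data.Integer.DivMod as ℤ
import Data.Integer.Solver as ℤSolver
open import Data.Fin.Base as Fin using (Fin; zero; suc; toℕ; fromℕ<; _↑ˡ_; _↑ʳ_)
import Data.Fin.Properties as Fin
open import Data.List.Base as List
  using (List; []; _∷_; _++_; map; filter; length; allFin; cartesianProductWith)
import Data.List.Properties as List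
open import Data.Vec.Base as Vec using (Vec; []; _∷_; zipWith; replicate; _[_]≔_)
import Data.Vec.Properties as Vec
open import Data.Product using (Σ-syntax; ∃; ∃!; _×_; _,_; proj₁; proj₂)
open import Data.Sum.Base using (_⊎_; inj₁; inj₂; [_,_]′)
open import Data.Empty using (⊥; ⊥-elim)
open import Function.Base using (_∘_; case_of_)
open import Function.Structures using (IsBijection)
open import Relation.Binary.Definitions using (DecidableEquality; WeaklyDecidable; Tri; tri<; tri≈; tri>)
open import Relation.Binary.PropositionalEquality
  using (_≡_; _≢_; _≗_; refl; sym; trans; cong; cong₂; subst; subst₂; module ≡-Reasoning)
open import Relation.Nullary using (¬_; Dec; yes; no; does; ¬?; contradiction; _×-dec_)
import Algebra.Solver.Ring
open import Algebra.Solver.Ring.AlmostCommutativeRing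
  using (_-Raw-AlmostCommutative⟶_; fromCommutativeRing; Induced-equivalence)
import Algebra.Properties.Group
import Algebra.Properties.AbelianGroup
import Algebra.Properties.Ring
import Relation.Binary.Reasoning.Setoid
open import Data.Maybe.Base using (just; nothing)
open import Data.List.Membership.Propositional using (_∈_; find; lose)
open import Data.List.Membership.Propositional.Properties
  using (∈-map⁺; ∈-map⁻; ∈-++⁺ˡ; ∈-++⁺ʳ; ∈-++⁻; ∈-concatMap⁺; ∈-concatMap⁻; ∈-filter⁺; ∈-filter⁻; ∈-allFin)
open import Data.List.Membership.Propositional.Properties.WithK using (unique∧set⇒bag)
open import Data.List.Relation.Binary.BagAndSetEquality using (∼bag⇒↭)
open import Data.List.Relation.Binary.Permutation.Propositional as Perm using (_↭_)
open import Data.List.Relation.Unary.All as All using (All; []; _∷_)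
import Data.List.Relation.Unary.All.Properties as All
open import Data.List.Relation.Unary.Any using (here; there)
open import Data.List.Relation.Unary.Unique.Propositional using (Unique)
open import Data.List.Relation.Unary.AllPairs using ([]; _∷_)
import Data.List.Relation.Unary.Unique.Propositional.Properties as Unique
open import Function.Bundles using (mk⇔)
open import Data.Sum.Properties using (inj₂-injective)
import Data.Product.Properties as Product

-- Cutting the polygon open at the side [v₀, vₙ₋₁] turns every side and diagonal into an interval of
-- 0, ..., n - 1. Crossing and nesting become inequalities, and the side at the cut is the longest
-- interval, hence the root of the tree. The price is that the subscript n denotes vertex 0, so that
-- entries reaching past the cut have to be brought back. As no periodicity is assumed, the glide
-- symmetry must be proved before a frieze can be read as a function of chords.
--
-- The ring is not a field. Entries of an arbitrary frieze need not be units; they can only be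
-- cancelled, and this rests on the absence of zero divisors. The inverses of edge weights, on the
-- other hand, are monomials, which is why solving Ptolemy's relation for an unknown chord keeps it
-- positive.

module _ {N : ℕ} where

  -- The ring of Laurent polynomials

  infixl 6 _⊕_
  infix 4 _≟ₑ_

  _⊕_ : Exponent N → Exponent N → Exponent N
  _⊕_ = zipWith ℤ._+_

  _≟ₑ_ : DecidableEquality (Exponent N)
  _≟ₑ_ = Vec.≡-dec ℤ._≟_

  -- The linear functional that takes the value `f α` at the monomial with exponent `α`. Ring laws
  -- are proved by testing both sides against all these functionals: `lin-*` turns a product into an
  -- iterated sum, and repeated exponents never have to be collected.
  lin : (Exponent N → ℤ) → Laurent N → ℤ
  lin f []            = 0ℤ
  lin f ((c , α) ∷ p) = c ℤ.* f α + lin f p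

  δ : Exponent N → Exponent N → ℤ
  δ α β = if does (β ≟ₑ α) then 1ℤ else 0ℤ

  coeff-lin : ∀ α p → coeff p α ≡ lin (δ α) p
  coeff-lin α []            = refl
  coeff-lin α ((c , β) ∷ p) = cong₂ _+_ (lemma (does (β ≟ₑ α))) (coeff-lin α p)
    where
    lemma : ∀ b → (if b then c else 0ℤ) ≡ c ℤ.* (if b then 1ℤ else 0ℤ)
    lemma true  = sym (ℤ.*-identityʳ c)
    lemma false = sym (ℤ.*-zeroʳ c)

  lin-ext : ∀ {f g} → f ≗ g → lin f ≗ lin g
  lin-ext f≗g []            = refl
  lin-ext f≗g ((c , α) ∷ p) = cong₂ _+_ (cong (c ℤ.*_) (f≗g α)) (lin-ext f≗g p)

  lin-++ : ∀ f p q → lin f (p +ᴸ q) ≡ lin f p + lin f q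
  lin-++ f []            q = sym (ℤ.+-identityˡ _)
  lin-++ f ((c , α) ∷ p) q =
    trans (cong (λ z → c ℤ.* f α + z) (lin-++ f p q)) (sym (ℤ.+-assoc (c ℤ.* f α) _ _))

  infix 8 -ᴸ_
  -- In this form `p +ᴸ -ᴸ q` reduces to `p -ᴸ q`, so the subtraction in `D4` is literally the
  -- subtraction of the ring.
  -ᴸ_ : Laurent N → Laurent N
  -ᴸ p = 0ᴸ -ᴸ p

  lin-neg : ∀ f p → lin f (-ᴸ p) ≡ ℤ.- lin f p
  lin-neg f []            = refl
  lin-neg f ((c , α) ∷ p) = begin
    ℤ.- c ℤ.* f α + lin f (-ᴸ p)        ≡⟨ cong₂ _+_ (sym (ℤ.neg-distribˡ-* c (f α))) (lin-neg f p) ⟩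
    ℤ.- (c ℤ.* f α) + (ℤ.- lin f p)     ≡⟨ ℤ.neg-distrib-+ (c ℤ.* f α) _ ⟨
    ℤ.- (c ℤ.* f α + lin f p)           ∎
    where open ≡-Reasoning

  lin-zero : ∀ p → lin (λ _ → 0ℤ) p ≡ 0ℤ
  lin-zero []            = refl
  lin-zero ((c , α) ∷ p) = cong₂ _+_ (ℤ.*-zeroʳ c) (lin-zero p)

  lin-scale : ∀ c f p → lin (λ α → c ℤ.* f α) p ≡ c ℤ.* lin f p
  lin-scale c f []            = sym (ℤ.*-zeroʳ c)
  lin-scale c f ((d , α) ∷ p) =
    trans (cong (λ z → d ℤ.* (c ℤ.* f α) + z) (lin-scale c f p))
          (solve 4 (λ c d u v → d :* (c :* u) :+ c :* v := c :* (d :* u :+ v)) refl c d (f α) (lin f p))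
    where open ℤSolver.+-*-Solver

  lin-add : ∀ f g p → lin (λ α → f α + g α) p ≡ lin f p + lin g p
  lin-add f g []            = refl
  lin-add f g ((d , α) ∷ p) =
    trans (cong (λ z → d ℤ.* (f α + g α) + z) (lin-add f g p))
          (solve 5 (λ d a b u v → d :* (a :+ b) :+ (u :+ v) := d :* a :+ u :+ (d :* b :+ v)) refl
            d (f α) (g α) (lin f p) (lin g p))
    where open ℤSolver.+-*-Solver

  lin-swap : ∀ (f : Exponent N → Exponent N → ℤ) p q →
             lin (λ α → lin (f α) q) p ≡ lin (λ β → lin (λ α → f α β) p) q
  lin-swap f []            q = sym (lin-zero q)
  lin-swap f ((c , α) ∷ p) q = begin
    c ℤ.* lin (f α) q + lin (λ α → lin (f α) q) p
      ≡⟨ cong₂ _+_ (sym (lin-scale c (f α) q)) (lin-swap f p q) ⟩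
    lin (λ β → c ℤ.* f α β) q + lin (λ β → lin (λ α → f α β) p) q
      ≡⟨ lin-add (λ β → c ℤ.* f α β) _ q ⟨
    lin (λ β → c ℤ.* f α β + lin (λ α → f α β) p) q ∎
    where open ≡-Reasoning

  lin-term : ∀ f c α q → lin f (((c , α) ∷ []) *ᴸ q) ≡ c ℤ.* lin (λ β → f (α ⊕ β)) q
  lin-term f c α []            = sym (ℤ.*-zeroʳ c)
  lin-term f c α ((d , β) ∷ q) =
    trans (cong (λ z → c ℤ.* d ℤ.* f (α ⊕ β) + z) (lin-term f c α q))
          (solve 4 (λ c d u v → c :* d :* u :+ c :* v := c :* (d :* u :+ v)) refl
            c d (f (α ⊕ β)) (lin (λ β → f (α ⊕ β)) q))
    where open ℤSolver.+-*-Solver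

  lin-* : ∀ f p q → lin f (p *ᴸ q) ≡ lin (λ α → lin (λ β → f (α ⊕ β)) q) p
  lin-* f []            q = refl
  lin-* f ((c , α) ∷ p) q = begin
    lin f (((c , α) ∷ p) *ᴸ q)                        ≡⟨ cong (lin f) (product-∷ _ (c , α) p q) ⟩
    lin f (((c , α) ∷ []) *ᴸ q +ᴸ p *ᴸ q)             ≡⟨ lin-++ f (((c , α) ∷ []) *ᴸ q) (p *ᴸ q) ⟩
    lin f (((c , α) ∷ []) *ᴸ q) + lin f (p *ᴸ q)      ≡⟨ cong₂ _+_ (lin-term f c α q) (lin-* f p q) ⟩
    c ℤ.* lin (λ β → f (α ⊕ β)) q + lin (λ α → lin (λ β → f (α ⊕ β)) q) p ∎
    where
    open ≡-Reasoning
    product-∷ : ∀ {A B C : Set} (h : A → B → C) x xs ys →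
      cartesianProductWith h (x ∷ xs) ys ≡ cartesianProductWith h (x ∷ []) ys ++ cartesianProductWith h xs ys
    product-∷ h x xs ys = cong (_++ cartesianProductWith h xs ys) (sym (List.++-identityʳ (map (h x) ys)))

  remove : Exponent N → Laurent N → Laurent N
  remove α = filter (λ t → ¬? (proj₂ t ≟ₑ α))

  coeff-remove-≡ : ∀ α p → coeff (remove α p) α ≡ 0ℤ
  coeff-remove-≡ α []            = refl
  coeff-remove-≡ α ((c , β) ∷ p) with β ≟ₑ α in eq
  ... | yes _ = coeff-remove-≡ α p
  ... | no  _ rewrite eq = trans (ℤ.+-identityˡ _) (coeff-remove-≡ α p)

  coeff-remove-≢ : ∀ {α β} p → α ≢ β → coeff (remove α p) β ≡ coeff p β
  coeff-remove-≢         []            α≢β = refl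
  coeff-remove-≢ {α} {β} ((c , γ) ∷ p) α≢β with γ ≟ₑ α
  ... | no  _ = cong (λ z → (if does (γ ≟ₑ β) then c else 0ℤ) + z) (coeff-remove-≢ p α≢β)
  ... | yes refl with γ ≟ₑ β
  ...   | yes γ≡β = contradiction γ≡β α≢β
  ...   | no  _   = trans (coeff-remove-≢ p α≢β) (sym (ℤ.+-identityˡ _))

  lin-remove : ∀ f α p → lin f p ≡ coeff p α ℤ.* f α + lin f (remove α p)
  lin-remove f α []            = refl
  lin-remove f α ((c , β) ∷ p) with β ≟ₑ α
  ... | yes refl = trans (cong (λ z → c ℤ.* f α + z) (lin-remove f α p))
      (solve 4 (λ c u v w → c :* u :+ (v :* u :+ w) := (c :+ v) :* u :+ w) refl
        c (f α) (coeff p α) (lin f (remove α p)))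
    where open ℤSolver.+-*-Solver
  ... | no _ = trans (cong (λ z → c ℤ.* f β + z) (lin-remove f α p))
      (solve 4 (λ x u v w → x :+ (v :* u :+ w) := (con 0ℤ :+ v) :* u :+ (x :+ w)) refl
        (c ℤ.* f β) (f α) (coeff p α) (lin f (remove α p)))
    where open ℤSolver.+-*-Solver

  length-remove : ∀ α p → length (remove α p) ℕ.≤ length p
  length-remove α p = List.length-filter _ p

  remove-head : ∀ c α p → remove α ((c , α) ∷ p) ≡ remove α p
  remove-head c α p with α ≟ₑ α
  ... | yes _  = refl
  ... | no α≢α = contradiction refl α≢α

  -- Terms are collected one exponent at a time, since p may repeat exponents.
  byExponents : (P : Laurent N → Set) → P [] →
                (∀ α p → P (remove α p) → P p) → ∀ p → P p
  byExponents P base step p = go (length p) p ℕ.≤-refl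
    where
    go : ∀ k p → length p ℕ.≤ k → P p
    go k       []            _         = base
    go (suc k) ((c , α) ∷ p) (s≤s len) = step α _ (subst P (sym (remove-head c α p))
      (go k (remove α p) (ℕ.≤-trans (length-remove α p) len)))

  module _ (P : ℤ → Set) (P-0 : P 0ℤ) (P-+ : ∀ {a b} → P a → P b → P (a + b)) where

    -- Grouping by exponents writes `lin f p` as a sum of numbers `coeff p α ℤ.* f α`. The choice
    -- `_≡ 0ℤ` for `P` yields `lin-vanish`, the choice `0ℤ ℤ.≤_` yields `lin-nonNegative`.
    lin-closed : ∀ f p → (∀ α → P (coeff p α ℤ.* f α)) → P (lin f p)
    lin-closed f = byExponents _ (λ _ → P-0) λ α p rec hyp →
      subst P (sym (lin-remove f α p)) (P-+ (hyp α) (rec (λ β → removed α β p hyp)))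
      where
      removed : ∀ α β p → (∀ α → P (coeff p α ℤ.* f α)) → P (coeff (remove α p) β ℤ.* f β)
      removed α β p hyp with α ≟ₑ β
      ... | yes refl rewrite coeff-remove-≡ α p = P-0
      ... | no  α≢β  rewrite coeff-remove-≢ p α≢β = hyp β

  lin-vanish : ∀ f p → (∀ α → coeff p α ℤ.* f α ≡ 0ℤ) → lin f p ≡ 0ℤ
  lin-vanish = lin-closed (_≡ 0ℤ) refl (cong₂ _+_)

  -- Equality compares coefficients, that is, the functionals `lin (δ α)` only. It passes to every
  -- functional because all collected coefficients of `p +ᴸ -ᴸ q` vanish.
  lin-cong : ∀ f {p q} → p ≈ q → lin f p ≡ lin f q
  lin-cong f {p} {q} (mk≈ p≈q) = ℤ.i-j≡0⇒i≡j _ _ (begin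
    lin f p + (ℤ.- lin f q)     ≡⟨ cong (λ z → lin f p + z) (lin-neg f q) ⟨
    lin f p + lin f (-ᴸ q)      ≡⟨ lin-++ f p (-ᴸ q) ⟨
    lin f (p +ᴸ -ᴸ q)           ≡⟨ lin-vanish f (p +ᴸ -ᴸ q) (λ α → cong (ℤ._* f α) (coeff-0 α)) ⟩
    0ℤ                          ∎)
    where
    open ≡-Reasoning
    coeff-0 : ∀ α → coeff (p +ᴸ -ᴸ q) α ≡ 0ℤ
    coeff-0 α = begin
      coeff (p +ᴸ -ᴸ q) α               ≡⟨ coeff-lin α (p +ᴸ -ᴸ q) ⟩
      lin (δ α) (p +ᴸ -ᴸ q)             ≡⟨ lin-++ (δ α) p (-ᴸ q) ⟩
      lin (δ α) p + lin (δ α) (-ᴸ q)    ≡⟨ cong (λ z → lin (δ α) p + z) (lin-neg (δ α) q) ⟩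
      lin (δ α) p + ℤ.- lin (δ α) q     ≡⟨ ℤ.i≡j⇒i-j≡0 (trans (sym (coeff-lin α p)) (trans (p≈q α) (coeff-lin α q))) ⟩
      0ℤ                                ∎

  lin≡⇒≈ : ∀ {p q} → (∀ f → lin f p ≡ lin f q) → p ≈ q
  lin≡⇒≈ {p} {q} eq = mk≈ λ α → trans (coeff-lin α p) (trans (eq (δ α)) (sym (coeff-lin α q)))

  ≈-refl : ∀ {p : Laurent N} → p ≈ p
  ≈-refl = mk≈ λ _ → refl

  ≈-sym : ∀ {p q : Laurent N} → p ≈ q → q ≈ p
  ≈-sym (mk≈ e) = mk≈ λ α → sym (e α)

  ≈-trans : ∀ {p q r : Laurent N} → p ≈ q → q ≈ r → p ≈ r
  ≈-trans (mk≈ e) (mk≈ e′) = mk≈ λ α → trans (e α) (e′ α)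

  ⊕-comm : ∀ α β → α ⊕ β ≡ β ⊕ α
  ⊕-comm = Vec.zipWith-comm ℤ.+-comm

  ⊕-assoc : ∀ α β γ → (α ⊕ β) ⊕ γ ≡ α ⊕ (β ⊕ γ)
  ⊕-assoc = Vec.zipWith-assoc ℤ.+-assoc

  ⊕-identityˡ : ∀ α → replicate N 0ℤ ⊕ α ≡ α
  ⊕-identityˡ = Vec.zipWith-identityˡ ℤ.+-identityˡ

  +ᴸ-cong : ∀ {p p′ q q′ : Laurent N} → p ≈ p′ → q ≈ q′ → p +ᴸ q ≈ p′ +ᴸ q′
  +ᴸ-cong {p} {p′} {q} {q′} e e′ = lin≡⇒≈ λ f →
    trans (lin-++ f p q) (trans (cong₂ _+_ (lin-cong f e) (lin-cong f e′)) (sym (lin-++ f p′ q′)))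

  *ᴸ-cong : ∀ {p p′ q q′ : Laurent N} → p ≈ p′ → q ≈ q′ → p *ᴸ q ≈ p′ *ᴸ q′
  *ᴸ-cong {p} {p′} {q} {q′} e e′ = lin≡⇒≈ λ f →
    trans (lin-* f p q) (trans (lin-ext (λ α → lin-cong _ e′) p)
      (trans (lin-cong _ e) (sym (lin-* f p′ q′))))

  -ᴸ-cong : ∀ {p q : Laurent N} → p ≈ q → -ᴸ p ≈ -ᴸ q
  -ᴸ-cong {p} {q} e = lin≡⇒≈ λ f →
    trans (lin-neg f p) (trans (cong ℤ.-_ (lin-cong f e)) (sym (lin-neg f q)))

  +ᴸ-comm : ∀ (p q : Laurent N) → p +ᴸ q ≈ q +ᴸ p
  +ᴸ-comm p q = lin≡⇒≈ λ f → trans (lin-++ f p q) (trans (ℤ.+-comm (lin f p) _) (sym (lin-++ f q p)))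

  *ᴸ-comm : ∀ (p q : Laurent N) → p *ᴸ q ≈ q *ᴸ p
  *ᴸ-comm p q = lin≡⇒≈ λ f → trans (lin-* f p q) (trans (lin-swap (λ α β → f (α ⊕ β)) p q)
    (trans (lin-ext (λ β → lin-ext (λ α → cong f (⊕-comm α β)) p) q) (sym (lin-* f q p))))

  *ᴸ-assoc : ∀ (p q r : Laurent N) → (p *ᴸ q) *ᴸ r ≈ p *ᴸ (q *ᴸ r)
  *ᴸ-assoc p q r = lin≡⇒≈ λ f → begin
    lin f ((p *ᴸ q) *ᴸ r)
      ≡⟨ lin-* f (p *ᴸ q) r ⟩
    lin (λ α → lin (λ γ → f (α ⊕ γ)) r) (p *ᴸ q)
      ≡⟨ lin-* _ p q ⟩
    lin (λ α → lin (λ β → lin (λ γ → f ((α ⊕ β) ⊕ γ)) r) q) p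
      ≡⟨ lin-ext (λ α → lin-ext (λ β → lin-ext (λ γ → cong f (⊕-assoc α β γ)) r) q) p ⟩
    lin (λ α → lin (λ β → lin (λ γ → f (α ⊕ (β ⊕ γ))) r) q) p
      ≡⟨ lin-ext (λ α → lin-* (λ β → f (α ⊕ β)) q r) p ⟨
    lin (λ α → lin (λ β → f (α ⊕ β)) (q *ᴸ r)) p
      ≡⟨ lin-* f p (q *ᴸ r) ⟨
    lin f (p *ᴸ (q *ᴸ r)) ∎
    where open ≡-Reasoning

  *ᴸ-identityˡ : ∀ (p : Laurent N) → 1ᴸ *ᴸ p ≈ p
  *ᴸ-identityˡ p = lin≡⇒≈ λ f → trans (lin-* f 1ᴸ p) (trans (ℤ.+-identityʳ _) (trans (ℤ.*-identityˡ _)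
    (lin-ext (λ α → cong f (⊕-identityˡ α)) p)))

  *ᴸ-distribʳ : ∀ (p q r : Laurent N) → (q +ᴸ r) *ᴸ p ≈ (q *ᴸ p) +ᴸ (r *ᴸ p)
  *ᴸ-distribʳ p q r = lin≡⇒≈ λ f → trans (lin-* f (q +ᴸ r) p) (trans (lin-++ _ q r)
    (sym (trans (lin-++ f (q *ᴸ p) (r *ᴸ p)) (cong₂ _+_ (lin-* f q p) (lin-* f r p)))))

  -ᴸ-inverseʳ : ∀ (p : Laurent N) → p +ᴸ -ᴸ p ≈ 0ᴸ
  -ᴸ-inverseʳ p = lin≡⇒≈ λ f → trans (lin-++ f p (-ᴸ p))
    (trans (cong (λ z → lin f p + z) (lin-neg f p)) (ℤ.+-inverseʳ (lin f p)))

  laurentRing : CommutativeRing 0ℓ 0ℓ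
  laurentRing = record
    { Carrier = Laurent N
    ; _≈_ = _≈_ ; _+_ = _+ᴸ_ ; _*_ = _*ᴸ_ ; -_ = -ᴸ_ ; 0# = 0ᴸ ; 1# = 1ᴸ
    ; isCommutativeRing = record
      { isRing = record
        { +-isAbelianGroup = record
          { isGroup = record
            { isMonoid = record
              { isSemigroup = record
                { isMagma = record
                  { isEquivalence = record { refl = ≈-refl ; sym = ≈-sym ; trans = ≈-trans }
                  ; ∙-cong = +ᴸ-cong }
                ; assoc = λ p q r → ≡⇒≈ (List.++-assoc p q r) }
              ; identity = (λ p → ≈-refl) , λ p → ≡⇒≈ (List.++-identityʳ p) }
            ; inverse = (λ p → ≈-trans (+ᴸ-comm (-ᴸ p) p) (-ᴸ-inverseʳ p)) , -ᴸ-inverseʳ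
            ; ⁻¹-cong = -ᴸ-cong }
          ; comm = +ᴸ-comm }
        ; *-cong = *ᴸ-cong
        ; *-assoc = *ᴸ-assoc
        ; *-identity = *ᴸ-identityˡ , λ p → ≈-trans (*ᴸ-comm p 1ᴸ) (*ᴸ-identityˡ p)
        ; distrib = (λ p q r → ≈-trans (*ᴸ-comm p (q +ᴸ r)) (≈-trans (*ᴸ-distribʳ p q r)
                      (+ᴸ-cong (*ᴸ-comm q p) (*ᴸ-comm r p)))) , *ᴸ-distribʳ }
      ; *-comm = *ᴸ-comm } }
    where
    ≡⇒≈ : ∀ {p q : Laurent N} → p ≡ q → p ≈ q
    ≡⇒≈ refl = ≈-refl

-- Leading terms, zero divisors and positivity

_≺_ : ∀ {N} → Exponent N → Exponent N → Set
[]      ≺ []      = ⊥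
(a ∷ α) ≺ (b ∷ β) = a ℤ.< b ⊎ (a ≡ b × α ≺ β)

≺-cmp : ∀ {N} (α β : Exponent N) → α ≺ β ⊎ α ≡ β ⊎ β ≺ α
≺-cmp []      []      = inj₂ (inj₁ refl)
≺-cmp (a ∷ α) (b ∷ β) with ℤ.<-cmp a b
... | tri< a<b _ _ = inj₁ (inj₁ a<b)
... | tri> _ _ b<a = inj₂ (inj₂ (inj₁ b<a))
... | tri≈ _ refl _ with ≺-cmp α β
...   | inj₁ α≺β        = inj₁ (inj₂ (refl , α≺β))
...   | inj₂ (inj₁ α≡β) = inj₂ (inj₁ (cong (a ∷_) α≡β))
...   | inj₂ (inj₂ β≺α) = inj₂ (inj₂ (inj₂ (refl , β≺α)))

≺-trans : ∀ {N} {α β γ : Exponent N} → α ≺ β → β ≺ γ → α ≺ γ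
≺-trans {α = []} {[]} {[]} () _
≺-trans {α = _ ∷ _} {_ ∷ _} {_ ∷ _} (inj₁ a<b) (inj₁ b<c) = inj₁ (ℤ.<-trans a<b b<c)
≺-trans {α = _ ∷ _} {_ ∷ _} {_ ∷ _} (inj₁ a<b) (inj₂ (refl , _)) = inj₁ a<b
≺-trans {α = _ ∷ _} {_ ∷ _} {_ ∷ _} (inj₂ (refl , _)) (inj₁ b<c) = inj₁ b<c
≺-trans {α = _ ∷ _} {_ ∷ _} {_ ∷ _} (inj₂ (refl , p)) (inj₂ (refl , q)) = inj₂ (refl , ≺-trans p q)

≺-irrefl : ∀ {N} {α : Exponent N} → ¬ α ≺ α
≺-irrefl {α = _ ∷ _} (inj₁ a<a)     = ℤ.<-irrefl refl a<a
≺-irrefl {α = _ ∷ _} (inj₂ (_ , p)) = ≺-irrefl p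

⊕-monoˡ-≺ : ∀ {N} {α β : Exponent N} γ → α ≺ β → (α ⊕ γ) ≺ (β ⊕ γ)
⊕-monoˡ-≺ {α = []} {[]} [] ()
⊕-monoˡ-≺ {α = _ ∷ _} {_ ∷ _} (c ∷ γ) (inj₁ a<b)        = inj₁ (ℤ.+-monoˡ-< c a<b)
⊕-monoˡ-≺ {α = _ ∷ _} {_ ∷ _} (c ∷ γ) (inj₂ (refl , p)) = inj₂ (refl , ⊕-monoˡ-≺ γ p)

⊕-cancelˡ : ∀ {N} (α : Exponent N) {β γ} → α ⊕ β ≡ α ⊕ γ → β ≡ γ
⊕-cancelˡ []      {[]}    {[]}    _  = refl
⊕-cancelˡ (a ∷ α) {b ∷ β} {c ∷ γ} eq =
  cong₂ _∷_ (∙-cancelˡ a b c (proj₁ (Vec.∷-injective eq))) (⊕-cancelˡ α (proj₂ (Vec.∷-injective eq)))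
  where open Algebra.Properties.AbelianGroup ℤ.+-0-abelianGroup using (∙-cancelˡ)

module _ {N : ℕ} where

  open CommutativeRing (laurentRing {N}) using (ring; +-group; distribˡ)

  -- Leading terms for the lexicographic order of exponents multiply, so
  -- the ring has no zero divisors.
  Leading : Laurent N → Exponent N → Set
  Leading p α = coeff p α ≢ 0ℤ × (∀ β → α ≺ β → coeff p β ≡ 0ℤ)

  -- Restoring the exponent `α` to `remove α p` changes no other coefficient. The leading exponent
  -- is therefore the old one, or `α` if that is larger and its coefficient in `p` is nonzero.
  leading : ∀ p → p ≈ 0ᴸ ⊎ ∃ (Leading p)
  leading = byExponents _ (inj₁ ≈-refl) step
    where
    step : ∀ α p → remove α p ≈ 0ᴸ ⊎ ∃ (Leading (remove α p)) → p ≈ 0ᴸ ⊎ ∃ (Leading p)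
    step α p (inj₁ (mk≈ r≈0)) with coeff p α ℤ.≟ 0ℤ
    ... | no  c≢0 = inj₂ (α , c≢0 , λ β α≺β →
          trans (sym (coeff-remove-≢ p λ { refl → ≺-irrefl α≺β })) (r≈0 β))
    ... | yes c≡0 = inj₁ (mk≈ vanish)
      where
      vanish : ∀ β → coeff p β ≡ 0ℤ
      vanish β with α ≟ₑ β
      ... | yes refl = c≡0
      ... | no  α≢β  = trans (sym (coeff-remove-≢ p α≢β)) (r≈0 β)
    step α p (inj₂ (β , c≢0 , above)) = inj₂ (larger (≺-cmp α β))
      where
      α≢β : α ≢ β
      α≢β refl = c≢0 (coeff-remove-≡ α p)
      cβ≢0 : coeff p β ≢ 0ℤ
      cβ≢0 = c≢0 ∘ trans (coeff-remove-≢ p α≢β)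
      aboveβ : ∀ γ → β ≺ γ → α ≢ γ → coeff p γ ≡ 0ℤ
      aboveβ γ β≺γ α≢γ = trans (sym (coeff-remove-≢ p α≢γ)) (above γ β≺γ)
      larger : α ≺ β ⊎ α ≡ β ⊎ β ≺ α → ∃ (Leading p)
      larger (inj₁ α≺β) = β , cβ≢0 , λ γ β≺γ → aboveβ γ β≺γ λ { refl → ≺-irrefl (≺-trans α≺β β≺γ) }
      larger (inj₂ (inj₁ α≡β)) = contradiction α≡β α≢β
      larger (inj₂ (inj₂ β≺α)) with coeff p α ℤ.≟ 0ℤ
      ... | no  cα≢0 = α , cα≢0 , λ γ α≺γ → aboveβ γ (≺-trans β≺α α≺γ) λ { refl → ≺-irrefl α≺γ }
      ... | yes cα≡0 = β , cβ≢0 , aboveβ′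
        where
        aboveβ′ : ∀ γ → β ≺ γ → coeff p γ ≡ 0ℤ
        aboveβ′ γ β≺γ with α ≟ₑ γ
        ... | yes refl = cα≡0
        ... | no  α≢γ  = aboveβ γ β≺γ α≢γ

  δ-≡ : ∀ (α : Exponent N) {β} → β ≡ α → δ α β ≡ 1ℤ
  δ-≡ α {β} β≡α with β ≟ₑ α
  ... | yes _  = refl
  ... | no β≢α = contradiction β≡α β≢α

  δ-≢ : ∀ (α : Exponent N) {β} → β ≢ α → δ α β ≡ 0ℤ
  δ-≢ α {β} β≢α with β ≟ₑ α
  ... | yes β≡α = contradiction β≡α β≢α
  ... | no _    = refl

  -- Below, `g γ` is what the exponent `γ` of `p` contributes, per unit of its coefficient, to the
  -- exponent `α ⊕ β`. For `γ ≺ α` the partner in `q` would have to lie above `β`, where `q` has no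
  -- coefficients; for `γ` equal to `α` it must be `β` by cancellation.
  leading-* : ∀ {p q α β} → Leading p α → Leading q β →
              coeff (p *ᴸ q) (α ⊕ β) ≡ coeff p α ℤ.* coeff q β
  leading-* {p} {q} {α} {β} (_ , aboveα) (_ , aboveβ) = begin
    coeff (p *ᴸ q) (α ⊕ β)                      ≡⟨ coeff-lin (α ⊕ β) (p *ᴸ q) ⟩
    lin (δ (α ⊕ β)) (p *ᴸ q)                    ≡⟨ lin-* (δ (α ⊕ β)) p q ⟩
    lin g p                                     ≡⟨ lin-remove g α p ⟩
    coeff p α ℤ.* g α + lin g (remove α p)      ≡⟨ cong₂ _+_ (cong (coeff p α ℤ.*_) g-α)
                                                     (lin-vanish g (remove α p) rest) ⟩
    coeff p α ℤ.* coeff q β + 0ℤ                ≡⟨ ℤ.+-identityʳ _ ⟩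
    coeff p α ℤ.* coeff q β                     ∎
    where
    open ≡-Reasoning
    g : Exponent N → ℤ
    g γ = lin (λ β′ → δ (α ⊕ β) (γ ⊕ β′)) q
    δ-shift : ∀ β′ → δ (α ⊕ β) (α ⊕ β′) ≡ δ β β′
    δ-shift β′ with β′ ≟ₑ β
    ... | yes refl = δ-≡ (α ⊕ β) refl
    ... | no β′≢β  = δ-≢ (α ⊕ β) (β′≢β ∘ ⊕-cancelˡ α)
    g-α : g α ≡ coeff q β
    g-α = trans (lin-ext δ-shift q) (sym (coeff-lin β q))
    below : ∀ {γ} → γ ≺ α → ∀ β′ → coeff q β′ ℤ.* δ (α ⊕ β) (γ ⊕ β′) ≡ 0ℤ
    below {γ} γ≺α β′ with ≺-cmp β β′
    ... | inj₁ β≺β′ = cong (ℤ._* δ (α ⊕ β) (γ ⊕ β′)) (aboveβ β′ β≺β′)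
    ... | inj₂ (inj₁ refl) = trans (cong (coeff q β ℤ.*_)
            (δ-≢ (α ⊕ β) λ eq → ≺-irrefl (subst (_≺ (α ⊕ β)) eq (⊕-monoˡ-≺ β γ≺α)))) (ℤ.*-zeroʳ (coeff q β))
    ... | inj₂ (inj₂ β′≺β) = trans (cong (coeff q β′ ℤ.*_)
            (δ-≢ (α ⊕ β) λ eq → ≺-irrefl (subst (_≺ (α ⊕ β)) eq
              (≺-trans (⊕-monoˡ-≺ β′ γ≺α) (subst₂ _≺_ (⊕-comm β′ α) (⊕-comm β α) (⊕-monoˡ-≺ α β′≺β))))))
            (ℤ.*-zeroʳ (coeff q β′))
    rest : ∀ γ → coeff (remove α p) γ ℤ.* g γ ≡ 0ℤ
    rest γ with ≺-cmp α γ
    ... | inj₁ α≺γ = cong (ℤ._* g γ)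
            (trans (coeff-remove-≢ p λ { refl → ≺-irrefl α≺γ }) (aboveα γ α≺γ))
    ... | inj₂ (inj₁ refl) = cong (ℤ._* g γ) (coeff-remove-≡ α p)
    ... | inj₂ (inj₂ γ≺α) =
            trans (cong (coeff (remove α p) γ ℤ.*_) (lin-vanish _ q (below γ≺α))) (ℤ.*-zeroʳ (coeff (remove α p) γ))

  noZeroDivisors : ∀ {p q : Laurent N} → ¬ p ≈ 0ᴸ → p *ᴸ q ≈ 0ᴸ → q ≈ 0ᴸ
  noZeroDivisors {p} {q} p≉0 (mk≈ pq≈0) with leading p | leading q
  ... | inj₁ p≈0     | _            = contradiction p≈0 p≉0
  ... | inj₂ _       | inj₁ q≈0     = q≈0
  ... | inj₂ (α , l) | inj₂ (β , k) =
    [ (λ e → contradiction e (proj₁ l)) , (λ e → contradiction e (proj₁ k)) ]′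
      (ℤ.i*j≡0⇒i≡0∨j≡0 (coeff p α) (trans (sym (leading-* {p} {q} l k)) (pq≈0 (α ⊕ β))))

  *ᴸ-cancelˡ : ∀ {p q r : Laurent N} → ¬ p ≈ 0ᴸ → p *ᴸ q ≈ p *ᴸ r → q ≈ r
  *ᴸ-cancelˡ {p} {q} {r} p≉0 pq≈pr = Algebra.Properties.Group.x∙y⁻¹≈ε⇒x≈y +-group q r
    (noZeroDivisors p≉0 (≈-trans (distribˡ p q (-ᴸ r))
      (≈-trans (+ᴸ-cong ≈-refl (≈-sym (-‿distribʳ-* p r)))
      (≈-trans (+ᴸ-cong pq≈pr ≈-refl) (-ᴸ-inverseʳ (p *ᴸ r))))))
    where open Algebra.Properties.Ring ring using (-‿distribʳ-*)

  -- The value at the point where all variables are 1; it is additive and multiplicative and equals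
  -- 1 on monomials.
  ε : Laurent N → ℤ
  ε = lin (λ _ → 1ℤ)

  ε-* : ∀ p q → ε (p *ᴸ q) ≡ ε q ℤ.* ε p
  ε-* p q = trans (lin-* (λ _ → 1ℤ) p q)
    (trans (lin-ext (λ _ → sym (ℤ.*-identityʳ (ε q))) p) (lin-scale (ε q) (λ _ → 1ℤ) p))

  -- For nonnegative coefficients `0 < ε p` amounts to `p` being nonzero, but in a form that passes
  -- to sums and products at once, since `ε` is a ring homomorphism.
  record Positive (p : Laurent N) : Set where
    constructor positive
    field
      nonNegative : NonNegative p
      0<ε         : 0ℤ ℤ.< ε p
  open Positive public

  lin-nonNegative : ∀ f (p : Laurent N) → NonNegative p → (∀ α → 0ℤ ℤ.≤ f α) → 0ℤ ℤ.≤ lin f p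
  lin-nonNegative f p p≥0 f≥0 = lin-closed (0ℤ ℤ.≤_) ℤ.≤-refl ℤ.+-mono-≤ f p λ α →
    *-nonNeg {coeff p α} (p≥0 α) (f≥0 α)
    where
    *-nonNeg : ∀ {a b} → 0ℤ ℤ.≤ a → 0ℤ ℤ.≤ b → 0ℤ ℤ.≤ a ℤ.* b
    *-nonNeg {a} {b} 0≤a 0≤b =
      subst (ℤ._≤ a ℤ.* b) (ℤ.*-zeroʳ a) (ℤ.*-monoˡ-≤-nonNeg a {{ℤ.nonNegative 0≤a}} 0≤b)

  NonNegative-cong : ∀ {p q : Laurent N} → p ≈ q → NonNegative p → NonNegative q
  NonNegative-cong (mk≈ e) p≥0 α = subst (0ℤ ℤ.≤_) (e α) (p≥0 α)

  δ-nonNegative : ∀ (α β : Exponent N) → 0ℤ ℤ.≤ δ α β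
  δ-nonNegative α β with does (β ≟ₑ α)
  ... | true  = ℤ.+≤+ z≤n
  ... | false = ℤ.≤-refl

  Positive-cong : ∀ {p q : Laurent N} → p ≈ q → Positive p → Positive q
  Positive-cong p≈q (positive p≥0 0<ε) =
    positive (NonNegative-cong p≈q p≥0) (subst (0ℤ ℤ.<_) (lin-cong _ p≈q) 0<ε)

  Positive-+ : ∀ {p q : Laurent N} → Positive p → Positive q → Positive (p +ᴸ q)
  Positive-+ {p} {q} (positive p≥0 0<p) (positive q≥0 0<q) = positive
    (λ α → subst (0ℤ ℤ.≤_)
      (sym (trans (coeff-lin α (p +ᴸ q)) (trans (lin-++ (δ α) p q)
        (sym (cong₂ _+_ (coeff-lin α p) (coeff-lin α q))))))
      (ℤ.+-mono-≤ (p≥0 α) (q≥0 α)))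
    (subst (0ℤ ℤ.<_) (sym (lin-++ _ p q)) (ℤ.+-mono-< 0<p 0<q))

  Positive-* : ∀ {p q : Laurent N} → Positive p → Positive q → Positive (p *ᴸ q)
  Positive-* {p} {q} (positive p≥0 0<p) (positive q≥0 0<q) = positive
    (λ α → subst (0ℤ ℤ.≤_) (sym (trans (coeff-lin α (p *ᴸ q)) (lin-* (δ α) p q)))
      (lin-nonNegative _ p p≥0 (λ β → lin-nonNegative _ q q≥0 (λ γ → δ-nonNegative α (β ⊕ γ)))))
    (subst (0ℤ ℤ.<_) (sym (ε-* p q))
      (subst (ℤ._< ε q ℤ.* ε p) (ℤ.*-zeroʳ (ε q)) (ℤ.*-monoˡ-<-pos (ε q) {{ℤ.positive 0<q}} 0<p)))

  Positive-monomial : ∀ α → Positive (monomial α)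
  Positive-monomial α = positive
    (λ β → subst (0ℤ ℤ.≤_) (sym (coeff-lin β (monomial α)))
      (ℤ.+-mono-≤ (subst (0ℤ ℤ.≤_) (sym (ℤ.*-identityˡ (δ β α))) (δ-nonNegative β α)) ℤ.≤-refl))
    (ℤ.+<+ (s≤s z≤n))

  Positive⇒≉0 : ∀ {p : Laurent N} → Positive p → ¬ p ≈ 0ᴸ
  Positive⇒≉0 (positive _ 0<ε) p≈0 = ℤ.<-irrefl (sym (lin-cong _ p≈0)) 0<ε

  -- No coefficient exceeds the sum `ε p` of all of them when none is negative, so if that sum were
  -- not positive, all would vanish.
  ≉0⇒Positive : ∀ {p : Laurent N} → NonNegative p → ¬ p ≈ 0ᴸ → Positive p
  ≉0⇒Positive {p} p≥0 p≉0 with 0ℤ ℤ.<? ε p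
  ... | yes 0<ε = positive p≥0 0<ε
  ... | no  0≮ε = contradiction (mk≈ λ α → ℤ.≤-antisym (ℤ.≤-trans (coeff≤ε α) (ℤ.≮⇒≥ 0≮ε)) (p≥0 α)) p≉0
    where
    remove≥0 : ∀ α → NonNegative (remove α p)
    remove≥0 α β with α ≟ₑ β
    ... | yes refl = ℤ.≤-reflexive (sym (coeff-remove-≡ α p))
    ... | no  α≢β  = subst (0ℤ ℤ.≤_) (sym (coeff-remove-≢ p α≢β)) (p≥0 β)
    coeff≤ε : ∀ α → coeff p α ℤ.≤ ε p
    coeff≤ε α = subst₂ ℤ._≤_ (trans (ℤ.+-identityʳ _) (ℤ.*-identityʳ _)) (sym (lin-remove (λ _ → 1ℤ) α p))
      (ℤ.+-monoʳ-≤ (coeff p α ℤ.* 1ℤ) (lin-nonNegative (λ _ → 1ℤ) (remove α p) (remove≥0 α) (λ _ → ℤ.+≤+ z≤n)))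

  Positive-+-not-monomial : ∀ {p q : Laurent N} {α} → Positive p → Positive q → ¬ p +ᴸ q ≈ monomial α
  Positive-+-not-monomial {p} {q} {α} (positive _ 0<p) (positive _ 0<q) eq =
    ℤ.<-irrefl {x = 1ℤ} refl (ℤ.<-≤-trans {j = + 2} (ℤ.+<+ (s≤s (s≤s z≤n))) (ℤ.≤-trans
      (ℤ.+-mono-≤ (ℤ.i<j⇒suc[i]≤j 0<p) (ℤ.i<j⇒suc[i]≤j 0<q))
      (ℤ.≤-reflexive (trans (sym (lin-++ _ p q)) (lin-cong _ eq)))))

  monomial-injective : ∀ {α β : Exponent N} → monomial α ≈ monomial β → α ≡ β
  monomial-injective {α} {β} (mk≈ e) with β ≟ₑ α | e α
  ... | yes β≡α | _  = sym β≡α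
  ... | no  β≢α | eq with α ≟ₑ α
  ...   | no α≢α = contradiction refl α≢α
  monomial-injective {α} {β} (mk≈ e) | no _ | () | yes _

  var-injective : ∀ {j k : Fin N} → var j ≈ var k → j ≡ k
  var-injective {j} {k} eq = lemma j k (monomial-injective eq)
    where
    lemma : ∀ {N} (j k : Fin N) → replicate N 0ℤ [ j ]≔ 1ℤ ≡ replicate N 0ℤ [ k ]≔ 1ℤ → j ≡ k
    lemma zero    zero    _  = refl
    lemma (suc j) (suc k) eq = cong suc (lemma j k (proj₂ (Vec.∷-injective eq)))

  var-inverseʳ : ∀ k → var k *ᴸ var⁻¹ k ≈ 1ᴸ {N}
  var-inverseʳ k = subst (λ α → monomial α ≈ 1ᴸ) (sym (lemma k)) ≈-refl
    where
    lemma : ∀ {N} (k : Fin N) → (replicate N 0ℤ [ k ]≔ 1ℤ) ⊕ (replicate N 0ℤ [ k ]≔ -1ℤ) ≡ replicate N 0ℤ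
    lemma (suc k) = cong (0ℤ ∷_) (lemma k)
    lemma zero    = cong (0ℤ ∷_) (⊕-identityˡ _)

  laurentConstants : ℤ.+-*-rawRing -Raw-AlmostCommutative⟶ fromCommutativeRing (laurentRing {N})
  laurentConstants = record
    { ⟦_⟧    = λ c → (c , replicate N 0ℤ) ∷ []
    ; +-homo = λ a b → lin≡⇒≈ λ f →
        solve 3 (λ a b u → (a :+ b) :* u :+ con 0ℤ := a :* u :+ (b :* u :+ con 0ℤ)) refl a b (f _)
    ; *-homo = λ a b → lin≡⇒≈ λ f → cong (λ α → a ℤ.* b ℤ.* f α + 0ℤ) (sym (⊕-identityˡ (replicate N 0ℤ)))
    ; -‿homo = λ a → ≈-refl
    ; 0-homo = lin≡⇒≈ λ f → refl
    ; 1-homo = ≈-refl }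
    where open ℤSolver.+-*-Solver

-- Identities in commutative rings

module RingIdentities (R : CommutativeRing 0ℓ 0ℓ)
  (constants : ℤ.+-*-rawRing -Raw-AlmostCommutative⟶ fromCommutativeRing R) where

  open CommutativeRing R
    renaming (Carrier to A; _≈_ to _≋_; _+_ to _⊞_; _-_ to _⊟_; _*_ to _·_;
              refl to ≋-refl; sym to ≋-sym; trans to ≋-trans)
  open import Relation.Binary.Reasoning.Setoid setoid
  decideCoefficients : WeaklyDecidable (Induced-equivalence constants)
  decideCoefficients a b with a ℤ.≟ b
  ... | yes refl = just ≋-refl
  ... | no  _    = nothing

  open Algebra.Solver.Ring ℤ.+-*-rawRing (fromCommutativeRing R) constants decideCoefficients

  abstract

    det : A × A → A × A → A
    det (a , b) (c , d) = a · d ⊟ b · c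

    det-expand : ∀ a b c d → det (a , b) (c , d) ≋ a · d ⊟ b · c
    det-expand a b c d = ≋-refl

    det-unit : ∀ a → det (1# , 0#) (0# , a) ≋ a
    det-unit a = ≋-trans (+-cong (*-identityˡ a) (≋-trans (-‿cong (zeroˡ 0#)) -0#≈0#)) (+-identityʳ a)
      where open Algebra.Properties.Ring ring using (-0#≈0#)

    det-self : ∀ u → det u u ≋ 0#
    det-self (a , b) = ≋-trans (+-congʳ (*-comm a b)) (-‿inverseʳ (b · a))

    plücker : ∀ u v w z → det u w · det v z ≋ det u v · det w z ⊞ det u z · det v w
    plücker (a , b) (c , d) (e , f) (g , h) = solve 8 (λ a b c d e f g h →
      (a :* f :- b :* e) :* (c :* h :- d :* g) :=
      (a :* d :- b :* c) :* (e :* h :- f :* g) :+ (a :* h :- b :* g) :* (c :* f :- d :* e))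
      ≋-refl a b c d e f g h

    -- Cramer's rule: if `i` inverts `det u v`, this is the vector `c` with `det u c` equal to `g`
    -- and `det c v` equal to `f`. It places the apex of a triangle over a base whose end vectors
    -- are known.
    combine : A → A → A × A → A → A × A → A × A
    combine i f (a , b) g (c , d) = i · (f · a ⊞ g · c) , i · (f · b ⊞ g · d)

    det-combineˡ : ∀ {i e} f u g v → det u v ≋ e → e · i ≋ 1# → det u (combine i f u g v) ≋ g
    det-combineˡ {i} {e} f (a , b) g (c , d) uv ei = begin
      det (a , b) (combine i f (a , b) g (c , d))
        ≈⟨ solve 7 (λ a b c d f g i → a :* (i :* (f :* b :+ g :* d)) :- b :* (i :* (f :* a :+ g :* c))
             := g :* ((a :* d :- b :* c) :* i)) ≋-refl a b c d f g i ⟩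
      g · (det (a , b) (c , d) · i)   ≈⟨ *-congˡ (≋-trans (*-congʳ uv) ei) ⟩
      g · 1#                          ≈⟨ *-identityʳ g ⟩
      g                               ∎

    det-combineʳ : ∀ {i e} f u g v → det u v ≋ e → e · i ≋ 1# → det (combine i f u g v) v ≋ f
    det-combineʳ {i} {e} f (a , b) g (c , d) uv ei = begin
      det (combine i f (a , b) g (c , d)) (c , d)
        ≈⟨ solve 7 (λ a b c d f g i → (i :* (f :* a :+ g :* c)) :* d :- (i :* (f :* b :+ g :* d)) :* c
             := f :* ((a :* d :- b :* c) :* i)) ≋-refl a b c d f g i ⟩
      f · (det (a , b) (c , d) · i)   ≈⟨ *-congˡ (≋-trans (*-congʳ uv) ei) ⟩
      f · 1#                          ≈⟨ *-identityʳ f ⟩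
      f                               ∎

  divideˡ : ∀ {x i z r} → x · i ≋ 1# → x · z ≋ r → z ≋ i · r
  divideˡ {x} {i} {z} {r} xi xz = begin
    z              ≈⟨ *-identityˡ z ⟨
    1# · z         ≈⟨ *-congʳ xi ⟨
    (x · i) · z    ≈⟨ solve 3 (λ x i z → (x :* i) :* z := i :* (x :* z)) ≋-refl x i z ⟩
    i · (x · z)    ≈⟨ *-congˡ xz ⟩
    i · r          ∎

  cancel-regroup : ∀ {z d} e₁ e₂ u v → z · d ≋ 1# → (e₂ · (e₁ · (u · (v · z)))) · d ≋ (e₁ · e₂) · (u · v)
  cancel-regroup {z} {d} e₁ e₂ u v zd = begin
    (e₂ · (e₁ · (u · (v · z)))) · d
      ≈⟨ solve 6 (λ e₁ e₂ u v z d → (e₂ :* (e₁ :* (u :* (v :* z)))) :* d := ((e₁ :* e₂) :* (u :* v)) :* (z :* d))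
           ≋-refl e₁ e₂ u v z d ⟩
    ((e₁ · e₂) · (u · v)) · (z · d)     ≈⟨ *-congˡ zd ⟩
    ((e₁ · e₂) · (u · v)) · 1#          ≈⟨ *-identityʳ _ ⟩
    (e₁ · e₂) · (u · v)                 ∎

  -- The Ptolemy relation xz = yu + vt divided by xyv.
  divided-ptolemy : ∀ {x x′ y y′ v v′} {z u t} → x · x′ ≋ 1# → y · y′ ≋ 1# → v · v′ ≋ 1# →
    x · z ≋ y · u ⊞ v · t → z · (y′ · v′) ≋ u · (x′ · v′) ⊞ t · (x′ · y′)
  divided-ptolemy {x} {x′} {y} {y′} {v} {v′} {z} {u} {t} xx yy vv eq = begin
    z · (y′ · v′)                    ≈⟨ *-congʳ (divideˡ xx eq) ⟩
    (x′ · (y · u ⊞ v · t)) · (y′ · v′)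
      ≈⟨ solve 7 (λ x′ y u v t y′ v′ → (x′ :* (y :* u :+ v :* t)) :* (y′ :* v′)
           := (y :* y′) :* (u :* (x′ :* v′)) :+ (v :* v′) :* (t :* (x′ :* y′))) ≋-refl x′ y u v t y′ v′ ⟩
    (y · y′) · (u · (x′ · v′)) ⊞ (v · v′) · (t · (x′ · y′))
      ≈⟨ +-cong (≋-trans (*-congʳ yy) (*-identityˡ _)) (≋-trans (*-congʳ vv) (*-identityˡ _)) ⟩
    u · (x′ · v′) ⊞ t · (x′ · y′)     ∎

  -- The first two hypotheses are neighbouring diamonds between the rows `p`, `s`, `u` and `r`, `q`,
  -- `t`. Eliminating `ys` from them carries the three-term recurrence of the second row over to the
  -- first, up to the common factor `q`.
  recurrence-step : ∀ {p q r s t u ys y₀ y₁ a} →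
    p · q ⊟ r · s ≋ ys · y₀ → s · t ⊟ q · u ≋ ys · y₁ → y₁ · r ⊞ y₀ · t ≋ a · q →
    q · (y₁ · p ⊞ y₀ · u) ≋ q · (a · s)
  recurrence-step {p} {q} {r} {s} {t} {u} {ys} {y₀} {y₁} {a} e₀ e₁ e₂ = begin
    q · (y₁ · p ⊞ y₀ · u)
      ≈⟨ solve 8 (λ p q r s t u y₀ y₁ → q :* (y₁ :* p :+ y₀ :* u) :=
           y₁ :* (p :* q :- r :* s) :- y₀ :* (s :* t :- q :* u) :+ s :* (y₁ :* r :+ y₀ :* t))
           ≋-refl p q r s t u y₀ y₁ ⟩
    y₁ · (p · q ⊟ r · s) ⊟ y₀ · (s · t ⊟ q · u) ⊞ s · (y₁ · r ⊞ y₀ · t)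
      ≈⟨ +-cong (+-cong (*-congˡ e₀) (-‿cong (*-congˡ e₁))) (*-congˡ e₂) ⟩
    y₁ · (ys · y₀) ⊟ y₀ · (ys · y₁) ⊞ s · (a · q)
      ≈⟨ solve 6 (λ q s ys y₀ y₁ a → y₁ :* (ys :* y₀) :- y₀ :* (ys :* y₁) :+ s :* (a :* q) := q :* (a :* s))
           ≋-refl q s ys y₀ y₁ a ⟩
    q · (a · s) ∎

  recurrence-solved : ∀ {y₀ y₁ a p₀ p₁ p₂} → y₁ · p₀ ⊞ y₀ · p₂ ≋ a · p₁ → y₀ · p₂ ≋ a · p₁ ⊟ y₁ · p₀
  recurrence-solved {y₀} {y₁} {a} {p₀} {p₁} {p₂} e = begin
    y₀ · p₂
      ≈⟨ solve 4 (λ y₀ y₁ p₀ p₂ → y₀ :* p₂ := (y₁ :* p₀ :+ y₀ :* p₂) :- y₁ :* p₀) ≋-refl y₀ y₁ p₀ p₂ ⟩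
    (y₁ · p₀ ⊞ y₀ · p₂) ⊟ y₁ · p₀        ≈⟨ +-congʳ e ⟩
    a · p₁ ⊟ y₁ · p₀                     ∎

  -- The rows `p`, `q`, `r` obey one and the same recurrence, hence so do `x · r` and
  -- `b · q ⊟ c · p`. Agreement in two consecutive columns thus forces agreement in the third, up to
  -- the factor `y₀`.
  minor-step : ∀ {y₀ y₁ a b c x p₀ p₁ p₂ q₀ q₁ q₂ r₀ r₁ r₂} →
    y₁ · p₀ ⊞ y₀ · p₂ ≋ a · p₁ → y₁ · q₀ ⊞ y₀ · q₂ ≋ a · q₁ → y₁ · r₀ ⊞ y₀ · r₂ ≋ a · r₁ →
    x · r₀ ≋ b · q₀ ⊟ c · p₀ → x · r₁ ≋ b · q₁ ⊟ c · p₁ →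
    y₀ · (x · r₂) ≋ y₀ · (b · q₂ ⊟ c · p₂)
  minor-step {y₀} {y₁} {a} {b} {c} {x} {p₀} {p₁} {p₂} {q₀} {q₁} {q₂} {r₀} {r₁} {r₂} ep eq er e₀ e₁ = begin
    y₀ · (x · r₂)
      ≈⟨ solve 3 (λ y x r → y :* (x :* r) := x :* (y :* r)) ≋-refl y₀ x r₂ ⟩
    x · (y₀ · r₂)
      ≈⟨ *-congˡ (recurrence-solved er) ⟩
    x · (a · r₁ ⊟ y₁ · r₀)
      ≈⟨ solve 5 (λ x a r₁ y₁ r₀ → x :* (a :* r₁ :- y₁ :* r₀) := a :* (x :* r₁) :- y₁ :* (x :* r₀)) ≋-refl x a r₁ y₁ r₀ ⟩
    a · (x · r₁) ⊟ y₁ · (x · r₀)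
      ≈⟨ +-cong (*-congˡ e₁) (-‿cong (*-congˡ e₀)) ⟩
    a · (b · q₁ ⊟ c · p₁) ⊟ y₁ · (b · q₀ ⊟ c · p₀)
      ≈⟨ solve 8 (λ a b c y₁ p₀ p₁ q₀ q₁ → a :* (b :* q₁ :- c :* p₁) :- y₁ :* (b :* q₀ :- c :* p₀)
           := b :* (a :* q₁ :- y₁ :* q₀) :- c :* (a :* p₁ :- y₁ :* p₀)) ≋-refl a b c y₁ p₀ p₁ q₀ q₁ ⟩
    b · (a · q₁ ⊟ y₁ · q₀) ⊟ c · (a · p₁ ⊟ y₁ · p₀)
      ≈⟨ +-cong (*-congˡ (recurrence-solved eq)) (-‿cong (*-congˡ (recurrence-solved ep))) ⟨
    b · (y₀ · q₂) ⊟ c · (y₀ · p₂)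
      ≈⟨ solve 5 (λ b c y q p → b :* (y :* q) :- c :* (y :* p) := y :* (b :* q :- c :* p)) ≋-refl b c y₀ q₂ p₂ ⟩
    y₀ · (b · q₂ ⊟ c · p₂) ∎

  plücker-scaled : ∀ {y uw vz uv wz uz vw} (u v w z : A × A) →
    y · uw ≋ det u w → y · vz ≋ det v z → y · uv ≋ det u v → y · wz ≋ det w z →
    y · uz ≋ det u z → y · vw ≋ det v w →
    y · (y · (uw · vz)) ≋ y · (y · (uv · wz ⊞ uz · vw))
  plücker-scaled {y} {uw} {vz} {uv} {wz} {uz} {vw} u v w z e₁ e₂ e₃ e₄ e₅ e₆ = begin
    y · (y · (uw · vz))          ≈⟨ scale uw vz ⟩
    (y · uw) · (y · vz)          ≈⟨ *-cong e₁ e₂ ⟩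
    det u w · det v z            ≈⟨ plücker u v w z ⟩
    det u v · det w z ⊞ det u z · det v w
      ≈⟨ +-cong (*-cong e₃ e₄) (*-cong e₅ e₆) ⟨
    (y · uv) · (y · wz) ⊞ (y · uz) · (y · vw)
      ≈⟨ solve 5 (λ y a b c d → (y :* a) :* (y :* b) :+ (y :* c) :* (y :* d) := y :* (y :* (a :* b :+ c :* d)))
           ≋-refl y uv wz uz vw ⟩
    y · (y · (uv · wz ⊞ uz · vw)) ∎
    where
    scale : ∀ a b → y · (y · (a · b)) ≋ (y · a) · (y · b)
    scale = solve 3 (λ y a b → y :* (y :* (a :* b)) := (y :* a) :* (y :* b)) ≋-refl y

-- Non-crossing families of diagonals

module Combinatorics (m : ℕ) where

  open Frieze m

  next-inner : ∀ v → suc (toℕ v) ℕ.< n → toℕ (next v) ≡ suc (toℕ v)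
  next-inner v v+1<n = trans (Fin.toℕ-fromℕ< _) (ℕ.m<n⇒m%n≡m v+1<n)

  next-last : ∀ v → toℕ v ≡ 2 ℕ.+ m → toℕ (next v) ≡ 0
  next-last v v≡last = trans (Fin.toℕ-fromℕ< _) (trans (cong (λ k → suc k ℕ.% n) v≡last) (ℕ.n%n≡0 n))

  data NextView (v : Vertex) : Set where
    inner : suc (toℕ v) ℕ.< n → toℕ (next v) ≡ suc (toℕ v) → NextView v
    last  : toℕ v ≡ 2 ℕ.+ m → toℕ (next v) ≡ 0 → NextView v

  nextView : ∀ v → NextView v
  nextView v with ℕ.m≤n⇒m<n∨m≡n (Fin.toℕ<n v)
  ... | inj₁ v+1<n = inner v+1<n (next-inner v v+1<n)
  ... | inj₂ v+1≡n = last (ℕ.suc-injective v+1≡n) (next-last v (ℕ.suc-injective v+1≡n))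

  next-injective : ∀ {u v} → next u ≡ next v → u ≡ v
  next-injective {u} {v} eq with nextView u | nextView v
  ... | inner _ u′≡ | inner _ v′≡ = Fin.toℕ-injective (ℕ.suc-injective (trans (sym u′≡) (trans (cong toℕ eq) v′≡)))
  ... | last u≡ _   | last v≡ _   = Fin.toℕ-injective (trans u≡ (sym v≡))
  ... | inner _ u′≡ | last _ v′≡  = case trans (sym u′≡) (trans (cong toℕ eq) v′≡) of λ ()
  ... | last _ u′≡  | inner _ v′≡ = case trans (sym v′≡) (trans (cong toℕ (sym eq)) u′≡) of λ ()

  next-≢ : ∀ u → u ≢ next u
  next-≢ u eq with nextView u
  ... | inner _ u′≡   = ℕ.<-irrefl (trans (cong toℕ eq) u′≡) ℕ.≤-refl
  ... | last u≡ u′≡   = case trans (sym u≡) (trans (cong toℕ eq) u′≡) of λ ()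

  diagonal-gap : ∀ {u v} → IsDiagonal (u , v) → suc (toℕ u) ℕ.< toℕ v
  diagonal-gap {u} {v} (u<v , v≢next , _) = ℕ.≤∧≢⇒< u<v λ eq →
    v≢next (Fin.toℕ-injective (sym (trans (next-inner u (subst (ℕ._< n) (sym eq) (Fin.toℕ<n v))) eq)))

  diagonal-proper : ∀ {u v} → IsDiagonal (u , v) → toℕ u ≡ 0 → toℕ v ≢ 2 ℕ.+ m
  diagonal-proper {u} {v} (_ , _ , u≢next) u≡0 v≡last =
    u≢next (Fin.toℕ-injective (trans u≡0 (sym (next-last v v≡last))))

  gap⇒isDiagonal : ∀ {u v} → suc (toℕ u) ℕ.< toℕ v → (toℕ u ≡ 0 → toℕ v ≢ 2 ℕ.+ m) → IsDiagonal (u , v)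
  gap⇒isDiagonal {u} {v} gap proper = ℕ.<-trans ℕ.≤-refl gap , v≢ , u≢
    where
    v≢ : ¬ v ≡ next u
    v≢ refl = ℕ.<-irrefl (sym (next-inner u (ℕ.<-trans gap (Fin.toℕ<n v)))) gap
    u≢ : ¬ u ≡ next v
    u≢ refl with nextView v
    ... | inner _ eq = ℕ.<-asym (subst (toℕ v ℕ.<_) (sym eq) ℕ.≤-refl) (ℕ.<-trans ℕ.≤-refl gap)
    ... | last v≡ eq = proper eq v≡

  largest : (P : ℕ → Set) → (∀ c → Dec (P c)) → ∀ a b → a ℕ.< b → P a →
            ∃ λ c → a ℕ.≤ c × c ℕ.< b × P c × (∀ d → c ℕ.< d → d ℕ.< b → ¬ P d)
  largest P P? a (suc b) (s≤s a≤b) Pa with P? b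
  ... | yes Pb = b , a≤b , ℕ.≤-refl , Pb , λ d b<d d<1+b → ⊥-elim (ℕ.<⇒≱ b<d (ℕ.s≤s⁻¹ d<1+b))
  ... | no ¬Pb with ℕ.m≤n⇒m<n∨m≡n a≤b
  ...   | inj₂ refl = contradiction Pa ¬Pb
  ...   | inj₁ a<b with largest P P? a b a<b Pa
  ...     | c , a≤c , c<b , Pc , max = c , a≤c , ℕ.<-trans c<b ℕ.≤-refl , Pc , λ d c<d d<1+b →
              [ max d c<d , (λ { refl → ¬Pb }) ]′ (ℕ.m≤n⇒m<n∨m≡n (ℕ.s≤s⁻¹ d<1+b))

  -- The number `M` is left open because the same facts serve a triangulation, with `m` diagonals,
  -- and the counting argument, with one diagonal too many.
  module Family {M : ℕ} (D : Fin M → Chord) (isD : ∀ k → IsDiagonal (D k))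
                (nonCross : ∀ k l → ¬ Crosses (D k) (D l)) where

    Side : Set
    Side = Fin M ⊎ Fin n

    -- Minimum and maximum matter for the side from the last vertex to vertex 0: it becomes the
    -- interval from 0 to n - 1, which contains all others.
    lo hi : Side → ℕ
    lo (inj₁ k) = toℕ (proj₁ (D k))
    lo (inj₂ v) = toℕ v ℕ.⊓ toℕ (next v)
    hi (inj₁ k) = toℕ (proj₂ (D k))
    hi (inj₂ v) = toℕ v ℕ.⊔ toℕ (next v)

    data SideView : Side → Set where
      diag  : ∀ k → SideView (inj₁ k)
      inner : ∀ {v} → suc (toℕ v) ℕ.< n → lo (inj₂ v) ≡ toℕ v → hi (inj₂ v) ≡ suc (toℕ v) → SideView (inj₂ v)
      last  : ∀ {v} → toℕ v ≡ 2 ℕ.+ m → lo (inj₂ v) ≡ 0 → hi (inj₂ v) ≡ 2 ℕ.+ m → SideView (inj₂ v)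

    sideView : ∀ e → SideView e
    sideView (inj₁ k) = diag k
    sideView (inj₂ v) with nextView v
    ... | inner v+1<n eq = inner v+1<n
            (trans (cong (toℕ v ℕ.⊓_) eq) (ℕ.m≤n⇒m⊓n≡m (ℕ.n≤1+n _)))
            (trans (cong (toℕ v ℕ.⊔_) eq) (ℕ.m≤n⇒m⊔n≡n (ℕ.n≤1+n _)))
    ... | last v≡ eq = last v≡
            (trans (cong (toℕ v ℕ.⊓_) eq) (ℕ.⊓-zeroʳ (toℕ v)))
            (trans (cong (toℕ v ℕ.⊔_) eq) (trans (ℕ.⊔-identityʳ (toℕ v)) v≡))

    lo<hi : ∀ e → lo e ℕ.< hi e
    lo<hi e with sideView e
    ... | diag k          = proj₁ (isD k)
    ... | inner _ lo≡ hi≡ = subst₂ ℕ._<_ (sym lo≡) (sym hi≡) ℕ.≤-refl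
    ... | last _ lo≡ hi≡  = subst₂ ℕ._<_ (sym lo≡) (sym hi≡) (s≤s z≤n)

    hi<n : ∀ e → hi e ℕ.< n
    hi<n e with sideView e
    ... | diag k            = Fin.toℕ<n (proj₂ (D k))
    ... | inner v+1<n _ hi≡ = subst (ℕ._< n) (sym hi≡) v+1<n
    ... | last _ _ hi≡      = subst (ℕ._< n) (sym hi≡) ℕ.≤-refl

    hi≤last : ∀ e → hi e ℕ.≤ 2 ℕ.+ m
    hi≤last e = ℕ.s≤s⁻¹ (hi<n e)

    noncrossing : ∀ e f → lo e ℕ.< lo f → lo f ℕ.< hi e → ¬ hi e ℕ.< hi f
    noncrossing e f p q r with sideView e | sideView f
    ... | diag k | diag l = nonCross k l (inj₁ (p , q , r))
    ... | inner _ lo≡ hi≡ | _ =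
      ℕ.<⇒≱ (subst (ℕ._< lo f) lo≡ p) (ℕ.s≤s⁻¹ (subst (lo f ℕ.<_) hi≡ q))
    ... | last _ lo≡ hi≡ | _ = ℕ.<⇒≱ (subst (ℕ._< hi f) hi≡ r) (hi≤last f)
    ... | diag k | inner _ lo≡ hi≡ =
      ℕ.<⇒≱ (subst (ℕ._< hi e) lo≡ q) (ℕ.s≤s⁻¹ (subst (hi e ℕ.<_) hi≡ r))
    ... | diag k | last _ lo≡ hi≡ = ℕ.<⇒≱ (subst (lo e ℕ.<_) lo≡ p) z≤n

    Spans : ℕ → ℕ → Side → Set
    Spans a b e = lo e ≡ a × hi e ≡ b

    step : ∀ a → suc a ℕ.< n → ∃ (Spans a (suc a))
    step a a+1<n with sideView (inj₂ (fromℕ< (ℕ.<-trans ℕ.≤-refl a+1<n)))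
    ... | inner _ lo≡ hi≡ = inj₂ (fromℕ< _) , trans lo≡ toℕ≡ , trans hi≡ (cong suc toℕ≡)
      where toℕ≡ = Fin.toℕ-fromℕ< (ℕ.<-trans ℕ.≤-refl a+1<n)
    ... | last v≡ _ _ = contradiction a+1<n (ℕ.<-irrefl (cong suc (trans (sym (Fin.toℕ-fromℕ< _)) v≡)))

    root : Side
    root = inj₂ (Fin.fromℕ (2 ℕ.+ m))

    root-spans : Spans 0 (2 ℕ.+ m) root
    root-spans with sideView root
    ... | inner v+1<n _ _ = contradiction v+1<n (ℕ.<-irrefl (cong suc (Fin.toℕ-fromℕ (2 ℕ.+ m))))
    ... | last _ lo≡ hi≡  = lo≡ , hi≡

    spans? : ∀ a b → Dec (∃ (Spans a b))
    spans? a b with Fin.any? (λ k → lo (inj₁ k) ℕ.≟ a ×-dec hi (inj₁ k) ℕ.≟ b)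
                  | Fin.any? (λ v → lo (inj₂ v) ℕ.≟ a ×-dec hi (inj₂ v) ℕ.≟ b)
    ... | yes (k , s) | _           = yes (inj₁ k , s)
    ... | no _        | yes (v , s) = yes (inj₂ v , s)
    ... | no ¬k       | no ¬v       = no λ { (inj₁ k , s) → ¬k (k , s) ; (inj₂ v , s) → ¬v (v , s) }

    -- `c` is the third vertex of the triangle hanging below `e`, found as the far end of the
    -- longest side that starts at `lo e` and stops short of `hi e`. Only this left leg is recorded:
    -- it exists in every non-crossing family, as the counting argument requires, whereas the right
    -- leg is obtained from maximality in `apex`.
    record Middle (e : Side) (c : ℕ) : Set where
      field
        lo<c     : lo e ℕ.< c
        c<hi     : c ℕ.< hi e
        side     : Side
        spans    : Spans (lo e) c side
        furthest : ∀ f → lo f ≡ lo e → c ℕ.< hi f → ¬ hi f ℕ.< hi e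

    middle : ∀ e → suc (lo e) ℕ.< hi e → ∃ (Middle e)
    middle e gap with largest (λ c → ∃ (Spans (lo e) c)) (spans? (lo e)) (suc (lo e)) (hi e) gap
                              (step (lo e) (ℕ.<-trans gap (hi<n e)))
    ... | c , lo<c , c<hi , (f , s) , max = c , record
      { lo<c = lo<c ; c<hi = c<hi ; side = f ; spans = s
      ; furthest = λ g lo≡ c<hi-g hi-g< → max (hi g) c<hi-g hi-g< (g , lo≡ , refl) }

    module _ {e f c} (me : Middle e c) (mf : Middle f c) where
      private
        module E = Middle me
        module F = Middle mf

      middle-lo≮ : ¬ lo e ℕ.< lo f
      middle-lo≮ lt = noncrossing E.side f
        (subst (ℕ._< lo f) (sym (proj₁ E.spans)) lt)
        (subst (lo f ℕ.<_) (sym (proj₂ E.spans)) F.lo<c)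
        (subst (ℕ._< hi f) (sym (proj₂ E.spans)) F.c<hi)

      middle-hi≮ : lo e ≡ lo f → ¬ hi e ℕ.< hi f
      middle-hi≮ lo≡ = F.furthest e lo≡ E.c<hi

    -- If the lower ends differ, the left leg of the side that starts earlier ends at `c`, strictly
    -- inside the other side, and crosses it. If they agree and the upper ends differ, the shorter
    -- side would have been a longer left leg for the other one.
    middle-injective : ∀ {e f c} → Middle e c → Middle f c → lo e ≡ lo f × hi e ≡ hi f
    middle-injective me mf = lo≡ , ℕ.≤-antisym (ℕ.≮⇒≥ (middle-hi≮ mf me (sym lo≡))) (ℕ.≮⇒≥ (middle-hi≮ me mf lo≡))
      where lo≡ = ℕ.≤-antisym (ℕ.≮⇒≥ (middle-lo≮ mf me)) (ℕ.≮⇒≥ (middle-lo≮ me mf))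

    sides-distinct : (∀ {k l} → D k ≡ D l → k ≡ l) → ∀ e f → lo e ≡ lo f → hi e ≡ hi f → e ≡ f
    sides-distinct inj e f p q with sideView e | sideView f
    ... | diag k | diag l = cong inj₁ (inj (cong₂ _,_ (Fin.toℕ-injective p) (Fin.toℕ-injective q)))
    ... | diag k | inner _ lo≡ hi≡ =
      contradiction (diagonal-gap (isD k)) (ℕ.<-irrefl (trans (cong suc (trans p lo≡)) (sym (trans q hi≡))))
    ... | diag k | last _ lo≡ hi≡ = contradiction (trans q hi≡) (diagonal-proper (isD k) (trans p lo≡))
    ... | inner _ lo≡ hi≡ | diag k =
      contradiction (diagonal-gap (isD k)) (ℕ.<-irrefl (trans (cong suc (trans (sym p) lo≡)) (sym (trans (sym q) hi≡))))
    ... | last _ lo≡ hi≡ | diag k = contradiction (trans (sym q) hi≡) (diagonal-proper (isD k) (trans (sym p) lo≡))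
    ... | inner _ lo≡ _ | inner _ lo≡′ _ = cong inj₂ (Fin.toℕ-injective (trans (sym lo≡) (trans p lo≡′)))
    ... | last v≡ _ _ | last v≡′ _ _ = cong inj₂ (Fin.toℕ-injective (trans v≡ (sym v≡′)))
    ... | inner _ lo≡ hi≡ | last _ lo≡′ hi≡′ = case
      trans (sym (trans hi≡ (cong suc (trans (sym lo≡) (trans p lo≡′))))) (trans q hi≡′) of λ ()
    ... | last _ lo≡ hi≡ | inner _ lo≡′ hi≡′ = case
      trans (sym (trans hi≡′ (cong suc (trans (sym lo≡′) (trans (sym p) lo≡))))) (trans (sym q) hi≡) of λ ()

  -- Sending a diagonal or the side [v₀, vₙ₋₁] to its middle vertex is injective into the
  -- n − 2 vertices 1, …, n − 2, so there are at most n − 3 non-crossing diagonals.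
  diagonals-bounded : (D : Fin (suc m) → Chord) → (∀ k → IsDiagonal (D k)) →
    (∀ k l → ¬ Crosses (D k) (D l)) → ¬ (∀ {k l} → D k ≡ D l → k ≡ l)
  diagonals-bounded D isD nonCross inj =
    let k , l , k<l , eq = Fin.pigeonhole ℕ.≤-refl (proj₁ ∘ index)
        lo≡ , hi≡ = middle-injective (proj₂ (index k))
                      (subst (λ i → Middle (interval l) (suc (toℕ i))) (sym eq) (proj₂ (index l)))
    in Fin.<-irrefl (interval-injective k l (sides-distinct inj _ _ lo≡ hi≡)) k<l
    where
    open Family D isD nonCross
    interval : Fin (2 ℕ.+ m) → Side
    interval zero    = root
    interval (suc k) = inj₁ k
    interval-injective : ∀ k l → interval k ≡ interval l → k ≡ l
    interval-injective zero    zero    _    = refl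
    interval-injective (suc k) (suc l) refl = refl
    gap : ∀ k → suc (lo (interval k)) ℕ.< hi (interval k)
    gap zero    = subst₂ (λ a b → suc a ℕ.< b) (sym (proj₁ root-spans)) (sym (proj₂ root-spans)) (s≤s (s≤s z≤n))
    gap (suc k) = diagonal-gap (isD k)
    index : ∀ k → Σ[ i ∈ Fin (1 ℕ.+ m) ] Middle (interval k) (suc (toℕ i))
    index k with middle (interval k) (gap k)
    ... | zero  , mid = contradiction (Middle.lo<c mid) λ ()
    ... | suc c , mid = fromℕ< c<1+m , subst (λ i → Middle (interval k) (suc i)) (sym (Fin.toℕ-fromℕ< c<1+m)) mid
      where c<1+m = ℕ.s≤s⁻¹ (ℕ.≤-trans (Middle.c<hi mid) (hi≤last (interval k)))

-- All that the arguments on chord weights and friezes use of the Laurent ring.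
record Coefficients (m : ℕ) : Set₁ where
  open Frieze m using (Edge)
  field
    ring      : CommutativeRing 0ℓ 0ℓ
    constants : ℤ.+-*-rawRing -Raw-AlmostCommutative⟶ fromCommutativeRing ring
  open CommutativeRing ring public
    renaming (Carrier to A; _≈_ to _≋_; _+_ to _⊞_; _-_ to _⊟_; _*_ to _·_;
              refl to ≋-refl; sym to ≋-sym; trans to ≋-trans; ring to ring′)
  field
    cancelˡ   : ∀ {p q r} → ¬ p ≋ 0# → p · q ≋ p · r → q ≋ r
    Pos       : A → Set
    Pos-cong  : ∀ {p q} → p ≋ q → Pos p → Pos q
    Pos-+     : ∀ {p q} → Pos p → Pos q → Pos (p ⊞ q)
    Pos-*     : ∀ {p q} → Pos p → Pos q → Pos (p · q)
    Pos⇒≉0    : ∀ {p} → Pos p → ¬ p ≋ 0#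
    wt wt⁻¹   : Edge → A
    inverseʳ  : ∀ e → wt e · wt⁻¹ e ≋ 1#
    Pos-wt    : ∀ e → Pos (wt e)
    Pos-wt⁻¹  : ∀ e → Pos (wt⁻¹ e)

laurent : ∀ m → Coefficients m
laurent m = record
  { ring = laurentRing {N}
  ; constants = laurentConstants
  ; cancelˡ = *ᴸ-cancelˡ
  ; Pos = Positive ; Pos-cong = Positive-cong ; Pos-+ = Positive-+ ; Pos-* = Positive-* ; Pos⇒≉0 = Positive⇒≉0
  ; wt = wt
  ; wt⁻¹ = λ { (inj₁ k) → x⁻¹ k ; (inj₂ v) → var⁻¹ (m ↑ʳ v) }
  ; inverseʳ = λ { (inj₁ k) → var-inverseʳ (k ↑ˡ n) ; (inj₂ v) → var-inverseʳ (m ↑ʳ v) }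
  ; Pos-wt = λ { (inj₁ k) → Positive-monomial _ ; (inj₂ v) → Positive-monomial _ }
  ; Pos-wt⁻¹ = λ { (inj₁ k) → Positive-monomial _ ; (inj₂ v) → Positive-monomial _ } }
  where
  open Frieze m
  N : ℕ
  N = m ℕ.+ n

-- Chord weights of a triangulation

module Weights (m : ℕ) (C : Coefficients m) where

  open Frieze m hiding (wt; x; y; R)
  open Combinatorics m
  open Coefficients C
  open RingIdentities ring constants

  symmetrize : (ℕ → ℕ → A) → Vertex → Vertex → A
  symmetrize w u v = w (toℕ u ℕ.⊓ toℕ v) (toℕ u ℕ.⊔ toℕ v)

  -- w i j is the weight of the chord from vertex i to vertex j; only i ≤ j < n matters.
  record Ptolemaic (w : ℕ → ℕ → A) : Set where
    field
      loop     : ∀ {i} → i ℕ.< n → w i i ≋ 0#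
      boundary : ∀ v → symmetrize w v (next v) ≋ wt (inj₂ v)
      ptolemy  : ∀ {i j k l} → i ℕ.≤ j → j ℕ.≤ k → k ℕ.≤ l → l ℕ.< n →
                 w i k · w j l ≋ w i j · w k l ⊞ w i l · w j k
  open Ptolemaic public

  module Triangulation (Δ : WeightedTriangulation) where

    open WeightedTriangulation Δ using (distinct; maximal) public
    open Family (diagonal Δ) (WeightedTriangulation.isDiagonal Δ) (WeightedTriangulation.nonCrossing Δ) public

    side-≡ : ∀ {e f} → lo e ≡ lo f → hi e ≡ hi f → e ≡ f
    side-≡ = sides-distinct distinct _ _

    -- Suppose a diagonal crosses the chord from `c` to `hi e`. If it ends beyond `hi e`, it crosses
    -- `e`. Otherwise it ends between `c` and `hi e`: starting before `lo e` it crosses `e`,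
    -- starting at `lo e` it contradicts `furthest`, and starting later it crosses the left leg. So
    -- maximality makes this chord a side, unless it already is a boundary side.
    apex : ∀ e {c} → Middle e c → ∃ (Spans c (hi e))
    apex e {c} mid with ℕ.m≤n⇒m<n∨m≡n (Middle.c<hi mid)
    ... | inj₂ 1+c≡hi = let f , s = step c (subst (ℕ._< n) (sym 1+c≡hi) (hi<n e)) in
                        f , proj₁ s , trans (proj₂ s) 1+c≡hi
    ... | inj₁ 1+c<hi = spanning (maximal (u , v) isD noCross)
      where
      open Middle mid
      u v : Vertex
      u = fromℕ< (ℕ.<-trans c<hi (hi<n e))
      v = fromℕ< (hi<n e)
      u≡ : toℕ u ≡ c
      u≡ = Fin.toℕ-fromℕ< _
      v≡ : toℕ v ≡ hi e
      v≡ = Fin.toℕ-fromℕ< _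
      isD : IsDiagonal (u , v)
      isD = gap⇒isDiagonal (subst₂ (λ a b → suc a ℕ.< b) (sym u≡) (sym v≡) 1+c<hi)
        λ u≡0 → contradiction (subst (lo e ℕ.<_) (trans (sym u≡) u≡0) lo<c) λ ()
      noCross : ∀ k → ¬ Crosses (u , v) (diagonal Δ k)
      noCross k (inj₁ (u<p , p<v , v<q)) = noncrossing e (inj₁ k)
        (ℕ.<-trans lo<c (subst (ℕ._< lo (inj₁ k)) u≡ u<p)) (subst (lo (inj₁ k) ℕ.<_) v≡ p<v)
        (subst (ℕ._< hi (inj₁ k)) v≡ v<q)
      noCross k (inj₂ (p<u , u<q , q<v)) with ℕ.<-cmp (lo (inj₁ k)) (lo e)
      ... | tri< p<lo _ _ = noncrossing (inj₁ k) e p<lo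
              (ℕ.<-trans lo<c (subst (ℕ._< hi (inj₁ k)) u≡ u<q)) (subst (hi (inj₁ k) ℕ.<_) v≡ q<v)
      ... | tri≈ _ p≡lo _ = furthest (inj₁ k) p≡lo (subst (ℕ._< hi (inj₁ k)) u≡ u<q) (subst (hi (inj₁ k) ℕ.<_) v≡ q<v)
      ... | tri> _ _ lo<p = noncrossing side (inj₁ k) (subst (ℕ._< lo (inj₁ k)) (sym (proj₁ spans)) lo<p)
              (subst (lo (inj₁ k) ℕ.<_) (trans u≡ (sym (proj₂ spans))) p<u)
              (subst (ℕ._< hi (inj₁ k)) (trans u≡ (sym (proj₂ spans))) u<q)
      spanning : (∃ λ k → diagonal Δ k ≡ (u , v)) → ∃ (Spans c (hi e))
      spanning (k , eq) = inj₁ k , trans (cong (toℕ ∘ proj₁) eq) u≡ , trans (cong (toℕ ∘ proj₂) eq) v≡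

    -- The triangles of Δ between the side e and the boundary path below it.
    data Tree (e : Side) : Set where
      leaf : suc (lo e) ≡ hi e → Tree e
      node : ∀ l r → lo l ≡ lo e → hi l ≡ lo r → hi r ≡ hi e → Tree l → Tree r → Tree e

    tree : ∀ e → Tree e
    tree e = go (hi e) e (ℕ.m≤m+n (hi e) (lo e))
      where
      go : ∀ k e → hi e ℕ.≤ k ℕ.+ lo e → Tree e
      go zero    e hi≤ = contradiction (lo<hi e) (ℕ.≤⇒≯ hi≤)
      go (suc k) e hi≤ with ℕ.m≤n⇒m<n∨m≡n (lo<hi e)
      ... | inj₂ 1+lo≡hi = leaf 1+lo≡hi
      ... | inj₁ 1+lo<hi with middle e 1+lo<hi
      ...   | c , mid with apex e mid
      ...     | r , lo-r≡c , hi-r≡hi = node side r (proj₁ spans) (trans (proj₂ spans) (sym lo-r≡c)) hi-r≡hi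
                  (go k side (subst₂ (λ a b → a ℕ.≤ k ℕ.+ b) (sym (proj₂ spans)) (sym (proj₁ spans))
                    (ℕ.s≤s⁻¹ (ℕ.≤-trans c<hi hi≤))))
                  (go k r (subst₂ (λ a b → a ℕ.≤ k ℕ.+ b) (sym hi-r≡hi) (sym lo-r≡c)
                    (ℕ.≤-trans hi≤ (subst (ℕ._≤ k ℕ.+ c) (ℕ.+-suc k (lo e)) (ℕ.+-monoʳ-≤ k lo<c)))))
        where open Middle mid

    root-tree : Tree root
    root-tree = tree root

    module _ {e l r : Side} (lo≡ : lo l ≡ lo e) (mid≡ : hi l ≡ lo r) (hi≡ : hi r ≡ hi e) where

      data Location (f : Side) : Set where
        left  : hi f ℕ.≤ hi l → Location f
        right : lo r ℕ.≤ lo f → Location f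
        top   : f ≡ e → Location f

      -- A side below `e` that straddles the apex crosses the left leg unless it starts at `lo e`,
      -- and the right leg unless it ends at `hi e`; so it is `e` itself.
      locate : ∀ f → lo e ℕ.≤ lo f → hi f ℕ.≤ hi e → Location f
      locate f lo≤ ≤hi with hi f ℕ.≤? hi l | lo r ℕ.≤? lo f
      ... | yes p | _     = left p
      ... | no  _ | yes q = right q
      ... | no hi≰ | no lo≱ = top (side-≡
              (ℕ.≤-antisym (ℕ.≮⇒≥ λ lt → noncrossing l f (subst (ℕ._< lo f) (sym lo≡) lt)
                                 (subst (lo f ℕ.<_) (sym mid≡) (ℕ.≰⇒> lo≱)) (ℕ.≰⇒> hi≰)) lo≤)
              (ℕ.≤-antisym ≤hi (ℕ.≮⇒≥ λ lt → noncrossing f r (ℕ.≰⇒> lo≱)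
                                 (subst (ℕ._< hi f) mid≡ (ℕ.≰⇒> hi≰)) (subst (hi f ℕ.<_) (sym hi≡) lt))))

    below-leaf : ∀ {e f} → suc (lo e) ≡ hi e → lo e ℕ.≤ lo f → hi f ℕ.≤ hi e → f ≡ e
    below-leaf {e} {f} hi≡ lo≤ ≤hi = side-≡
      (ℕ.≤-antisym (ℕ.s≤s⁻¹ (ℕ.≤-trans (lo<hi f) (ℕ.≤-trans ≤hi (ℕ.≤-reflexive (sym hi≡))))) lo≤)
      (ℕ.≤-antisym ≤hi (ℕ.≤-trans (ℕ.≤-reflexive (sym hi≡)) (ℕ.≤-trans (s≤s lo≤) (lo<hi f))))

    Realizes : (ℕ → ℕ → A) → Set
    Realizes w = ∀ e → w (lo e) (hi e) ≋ wt e

    module _ (S : ℕ → ℕ → Set) (S-side : ∀ e → S (lo e) (hi e))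
      (S-quadˡ : ∀ {i j k l} → i ℕ.< j → j ℕ.< k → k ℕ.< l → l ℕ.< n → ∃ (Spans i k) →
                 S i j → S k l → S i l → S j k → S j l)
      (S-quadʳ : ∀ {i j k l} → i ℕ.< j → j ℕ.< k → k ℕ.< l → l ℕ.< n → ∃ (Spans j l) →
                 S i j → S k l → S i l → S j k → S i k)
      where

      -- A chord from `i` to `j` straddling the apex `c` of `e` is reached through two
      -- quadrilaterals. The vertices `lo e`, `i`, `c`, `hi e`, with the left leg as a diagonal,
      -- give the chord from `i` to `hi e`; then `i`, `c`, `j`, `hi e`, with the right leg as a
      -- diagonal, give the chord itself. The remaining chords involved are `e` or lie below one of
      -- the legs. Positivity and uniqueness of the weights are the two instances.
      quad-induction : ∀ {i j} → i ℕ.< j → j ℕ.< n → S i j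
      quad-induction i<j j<n = go root-tree (subst (ℕ._≤ _) (sym (proj₁ root-spans)) z≤n) i<j
        (subst (_ ℕ.≤_) (sym (proj₂ root-spans)) (ℕ.s≤s⁻¹ j<n))
        where
        go : ∀ {e i j} → Tree e → lo e ℕ.≤ i → i ℕ.< j → j ℕ.≤ hi e → S i j
        go {e} {i} {j} (leaf eq) lo≤i i<j j≤hi = subst₂ S
          (ℕ.≤-antisym lo≤i (ℕ.s≤s⁻¹ (ℕ.≤-trans i<j (ℕ.≤-trans j≤hi (ℕ.≤-reflexive (sym eq))))))
          (ℕ.≤-antisym (ℕ.≤-trans (ℕ.≤-reflexive (sym eq)) (ℕ.≤-trans (s≤s lo≤i) i<j)) j≤hi)
          (S-side e)
        go {e} {i} {j} (node l r lo≡ mid≡ hi≡ tl tr) lo≤i i<j j≤hi with j ℕ.≤? hi l | lo r ℕ.≤? i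
        ... | yes j≤c | _       = go tl (subst (ℕ._≤ i) (sym lo≡) lo≤i) i<j j≤c
        ... | no _    | yes c≤i = go tr c≤i i<j (subst (j ℕ.≤_) (sym hi≡) j≤hi)
        ... | no j≰c  | no c≰i  = straddling
          where
          c = hi l
          c<j : c ℕ.< j
          c<j = ℕ.≰⇒> j≰c
          i<c : i ℕ.< c
          i<c = subst (i ℕ.<_) (sym mid≡) (ℕ.≰⇒> c≰i)
          c<hi : c ℕ.< hi e
          c<hi = ℕ.<-≤-trans c<j j≤hi
          Sic : S i c
          Sic = go tl (subst (ℕ._≤ i) (sym lo≡) lo≤i) i<c ℕ.≤-refl
          S-c : ∀ {j} → c ℕ.< j → j ℕ.≤ hi e → S c j
          S-c c<j j≤hi = go tr (ℕ.≤-reflexive (sym mid≡)) c<j (subst (_ ℕ.≤_) (sym hi≡) j≤hi)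
          S-hi : S i (hi e)
          S-hi with ℕ.m≤n⇒m<n∨m≡n lo≤i
          ... | inj₂ refl = S-side e
          ... | inj₁ lo<i = S-quadˡ lo<i i<c c<hi (hi<n e) (l , lo≡ , refl)
                (go tl (ℕ.≤-reflexive lo≡) lo<i (ℕ.<⇒≤ i<c)) (S-c c<hi ℕ.≤-refl) (S-side e) Sic
          straddling : S i j
          straddling with ℕ.m≤n⇒m<n∨m≡n j≤hi
          ... | inj₂ refl = S-hi
          ... | inj₁ j<hi = S-quadʳ i<c c<j j<hi (hi<n e) (r , sym mid≡ , hi≡) Sic
                (go tr (ℕ.≤-trans (ℕ.≤-reflexive (sym mid≡)) (ℕ.<⇒≤ c<j)) j<hi (ℕ.≤-reflexive (sym hi≡)))
                S-hi (S-c c<j j≤hi)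

    module _ {w : ℕ → ℕ → A} (pt : Ptolemaic w) (real : Realizes w) where

      side-unit : ∀ {i j} ((e , _) : ∃ (Spans i j)) → w i j · wt⁻¹ e ≋ 1#
      side-unit (e , refl , refl) = ≋-trans (*-congʳ (real e)) (inverseʳ e)

      solve-quadˡ : ∀ {i j k l} → i ℕ.< j → j ℕ.< k → k ℕ.< l → l ℕ.< n → ((e , _) : ∃ (Spans i k)) →
                    w j l ≋ wt⁻¹ e · (w i j · w k l ⊞ w i l · w j k)
      solve-quadˡ i<j j<k k<l l<n s = divideˡ (side-unit s) (ptolemy pt (ℕ.<⇒≤ i<j) (ℕ.<⇒≤ j<k) (ℕ.<⇒≤ k<l) l<n)

      solve-quadʳ : ∀ {i j k l} → i ℕ.< j → j ℕ.< k → k ℕ.< l → l ℕ.< n → ((e , _) : ∃ (Spans j l)) →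
                    w i k ≋ wt⁻¹ e · (w i j · w k l ⊞ w i l · w j k)
      solve-quadʳ {i} {j} {k} {l} i<j j<k k<l l<n s = divideˡ (side-unit s)
        (≋-trans (*-comm (w j l) (w i k)) (ptolemy pt (ℕ.<⇒≤ i<j) (ℕ.<⇒≤ j<k) (ℕ.<⇒≤ k<l) l<n))

      chords-positive : ∀ {i j} → i ℕ.< j → j ℕ.< n → Pos (w i j)
      chords-positive = quad-induction (λ i j → Pos (w i j))
        (λ e → Pos-cong (≋-sym (real e)) (Pos-wt e))
        (λ i<j j<k k<l l<n s a b c d → Pos-cong (≋-sym (solve-quadˡ i<j j<k k<l l<n s)) (combination s a b c d))
        (λ i<j j<k k<l l<n s a b c d → Pos-cong (≋-sym (solve-quadʳ i<j j<k k<l l<n s)) (combination s a b c d))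
        where
        combination : ∀ {i j p q r t} ((e , _) : ∃ (Spans i j)) → Pos p → Pos q → Pos r → Pos t →
                      Pos (wt⁻¹ e · (p · q ⊞ r · t))
        combination (e , _) a b c d = Pos-* (Pos-wt⁻¹ e) (Pos-+ (Pos-* a b) (Pos-* c d))

    chords-unique : ∀ {w w′} → Ptolemaic w → Realizes w → Ptolemaic w′ → Realizes w′ →
                    ∀ {i j} → i ℕ.< j → j ℕ.< n → w i j ≋ w′ i j
    chords-unique {w} {w′} pt real pt′ real′ = quad-induction (λ i j → w i j ≋ w′ i j)
      (λ e → ≋-trans (real e) (≋-sym (real′ e)))
      (λ i<j j<k k<l l<n s a b c d → ≋-trans (solve-quadˡ pt real i<j j<k k<l l<n s)
        (≋-trans (*-congˡ (+-cong (*-cong a b) (*-cong c d))) (≋-sym (solve-quadˡ pt′ real′ i<j j<k k<l l<n s))))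
      (λ i<j j<k k<l l<n s a b c d → ≋-trans (solve-quadʳ pt real i<j j<k k<l l<n s)
        (≋-trans (*-congˡ (+-cong (*-cong a b) (*-cong c d))) (≋-sym (solve-quadʳ pt′ real′ i<j j<k k<l l<n s))))

    select : ∀ {B : Set} → ℕ → (ℕ → B) → (ℕ → B) → ℕ → B
    select c f g i with i ℕ.≤? c
    ... | yes _ = f i
    ... | no  _ = g i

    select-≤ : ∀ {B : Set} {c i} (f g : ℕ → B) → i ℕ.≤ c → select c f g i ≡ f i
    select-≤ {c = c} {i} f g i≤c with i ℕ.≤? c
    ... | yes _   = refl
    ... | no  i≰c = contradiction i≤c i≰c

    select-> : ∀ {B : Set} {c i} (f g : ℕ → B) → c ℕ.< i → select c f g i ≡ g i
    select-> {c = c} {i} f g c<i with i ℕ.≤? c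
    ... | yes i≤c = contradiction i≤c (ℕ.<⇒≱ c<i)
    ... | no  _   = refl

    select-≥ : ∀ {B : Set} {c i} (f g : ℕ → B) → c ℕ.≤ i → f c ≡ g c → select c f g i ≡ g i
    select-≥ {c = c} {i} f g c≤i eq with i ℕ.≤? c
    ... | no  _   = refl
    ... | yes i≤c = subst (λ k → f k ≡ g k) (ℕ.≤-antisym c≤i i≤c) eq

    record Vectors (e : Side) (a b : A × A) : Set where
      field
        vec     : ℕ → A × A
        vec-lo  : vec (lo e) ≡ a
        vec-hi  : vec (hi e) ≡ b
        det-vec : ∀ f → lo e ℕ.≤ lo f → hi f ℕ.≤ hi e → det (vec (lo f)) (vec (hi f)) ≋ wt f

    leafVectors : ∀ {e} → suc (lo e) ≡ hi e → ∀ a b → det a b ≋ wt e → Vectors e a b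
    leafVectors {e} eq a b det≈ = record
      { vec = vec ; vec-lo = vec-lo ; vec-hi = vec-hi
      ; det-vec = λ f lo≤ ≤hi → subst (λ f → det (vec (lo f)) (vec (hi f)) ≋ wt f) (sym (below-leaf eq lo≤ ≤hi))
          (subst₂ (λ a b → det a b ≋ wt e) (sym vec-lo) (sym vec-hi) det≈) }
      where
      vec : ℕ → A × A
      vec = select (lo e) (λ _ → a) (λ _ → b)
      vec-lo : vec (lo e) ≡ a
      vec-lo = select-≤ {i = lo e} (λ _ → a) (λ _ → b) ℕ.≤-refl
      vec-hi : vec (hi e) ≡ b
      vec-hi = select-> (λ _ → a) (λ _ → b) (lo<hi e)
    glueVectors : ∀ {e l r a b c} → lo l ≡ lo e → hi l ≡ lo r → hi r ≡ hi e →
                  Vectors l a c → Vectors r c b → det a b ≋ wt e → Vectors e a b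
    glueVectors {e} {l} {r} {a} {b} lo≡ mid≡ hi≡ vl vr det≈ = record
      { vec = vec
      ; vec-lo = trans (cong vec (sym lo≡)) (trans (vec-left (ℕ.<⇒≤ (lo<hi l))) L.vec-lo)
      ; vec-hi = trans (cong vec (sym hi≡)) (trans (vec-right (ℕ.<⇒≤ (lo<hi r))) Rt.vec-hi)
      ; det-vec = det-vec }
      where
      module L = Vectors vl
      module Rt = Vectors vr
      vec : ℕ → A × A
      vec = select (hi l) L.vec Rt.vec
      vec-left : ∀ {i} → i ℕ.≤ hi l → vec i ≡ L.vec i
      vec-left = select-≤ L.vec Rt.vec
      vec-right : ∀ {i} → lo r ℕ.≤ i → vec i ≡ Rt.vec i
      vec-right lo≤i = select-≥ L.vec Rt.vec (ℕ.≤-trans (ℕ.≤-reflexive mid≡) lo≤i)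
        (trans L.vec-hi (trans (sym Rt.vec-lo) (cong Rt.vec (sym mid≡))))
      det-vec : ∀ f → lo e ℕ.≤ lo f → hi f ℕ.≤ hi e → det (vec (lo f)) (vec (hi f)) ≋ wt f
      det-vec f lo≤ ≤hi with locate {e} {l} {r} lo≡ mid≡ hi≡ f lo≤ ≤hi
      ... | left hi≤ = subst₂ (λ a b → det a b ≋ wt f)
              (sym (vec-left (ℕ.≤-trans (ℕ.<⇒≤ (lo<hi f)) hi≤))) (sym (vec-left hi≤))
              (L.det-vec f (subst (ℕ._≤ lo f) (sym lo≡) lo≤) hi≤)
      ... | right ≤lo = subst₂ (λ a b → det a b ≋ wt f)
              (sym (vec-right ≤lo)) (sym (vec-right (ℕ.≤-trans ≤lo (ℕ.<⇒≤ (lo<hi f)))))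
              (Rt.det-vec f ≤lo (subst (hi f ℕ.≤_) (sym hi≡) ≤hi))
      ... | top refl = subst₂ (λ a b → det a b ≋ wt e)
              (sym (trans (cong vec (sym lo≡)) (trans (vec-left (ℕ.<⇒≤ (lo<hi l))) L.vec-lo)))
              (sym (trans (cong vec (sym hi≡)) (trans (vec-right (ℕ.<⇒≤ (lo<hi r))) Rt.vec-hi))) det≈

    vectors : ∀ {e} → Tree e → ∀ a b → det a b ≋ wt e → Vectors e a b
    vectors     (leaf eq) a b det≈ = leafVectors eq a b det≈
    vectors {e} (node l r lo≡ mid≡ hi≡ tl tr) a b det≈ = glueVectors lo≡ mid≡ hi≡
      (vectors tl a c (det-combineˡ (wt r) a (wt l) b det≈ (inverseʳ e)))
      (vectors tr c b (det-combineʳ (wt r) a (wt l) b det≈ (inverseʳ e))) det≈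
      where
      c : A × A
      c = combine (wt⁻¹ e) (wt r) a (wt l) b

    abstract
      weights : Σ[ w ∈ (ℕ → ℕ → A) ] (Ptolemaic w × Realizes w)
      weights = (λ i j → det (vec i) (vec j)) , record
        { loop     = λ {i} _ → det-self (vec i)
        ; boundary = λ v → real (inj₂ v)
        ; ptolemy  = λ {i} {j} {k} {l} _ _ _ _ → plücker (vec i) (vec j) (vec k) (vec l) } , real
        where
        -- Only the determinant of the two end vectors matters: another pair with determinant
        -- `wt root` would transform all vectors by a matrix of determinant 1.
        open Vectors (vectors root-tree (1# , 0#) (0# , wt root)
          (det-unit (wt root)))
        real : ∀ f → det (vec (lo f)) (vec (hi f)) ≋ wt f
        real f = det-vec f (ℕ.≤-trans (ℕ.≤-reflexive (proj₁ root-spans)) z≤n)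
                           (ℕ.≤-trans (hi≤last f) (ℕ.≤-reflexive (sym (proj₂ root-spans))))

-- Subscripts modulo n

module VertexArithmetic (m : ℕ) where

  open Frieze m
  open Combinatorics m

  vertex-decompose : ∀ i → i ≡ + toℕ (vertex i) + (i ℤ./ℕ n) ℤ.* + n
  vertex-decompose i = trans (ℤ.a≡a%ℕn+[a/ℕn]*n i n)
    (cong (λ r → + r + (i ℤ./ℕ n) ℤ.* + n) (sym (Fin.toℕ-fromℕ< (ℤ.n%ℕd<d i n))))

  -- Two residues differ by less than n, while a nonzero multiple of n is at least n in absolute
  -- value.
  residue-unique : ∀ {p p′} q q′ → p ℕ.< n → p′ ℕ.< n →
                   + p + q ℤ.* + n ≡ + p′ + q′ ℤ.* + n → p ≡ p′
  residue-unique {p} {p′} q q′ p<n p′<n eq = from _ (q′ ℤ.- q) refl (begin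
    + p ℤ.- + p′                                             ≡⟨ lemma (+ p) (+ p′) q q′ (+ n) ⟩
    (+ p + q ℤ.* + n) ℤ.- (+ p′ + q′ ℤ.* + n) + (q′ ℤ.- q) ℤ.* + n
      ≡⟨ cong (λ z → z ℤ.- (+ p′ + q′ ℤ.* + n) + (q′ ℤ.- q) ℤ.* + n) eq ⟩
    (+ p′ + q′ ℤ.* + n) ℤ.- (+ p′ + q′ ℤ.* + n) + (q′ ℤ.- q) ℤ.* + n
      ≡⟨ cong (λ z → z + (q′ ℤ.- q) ℤ.* + n) (ℤ.+-inverseʳ (+ p′ + q′ ℤ.* + n)) ⟩
    0ℤ + (q′ ℤ.- q) ℤ.* + n                                  ≡⟨ ℤ.+-identityˡ _ ⟩
    (q′ ℤ.- q) ℤ.* + n                                       ∎)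
    where
    open ≡-Reasoning
    lemma : ∀ a b c d e → a ℤ.- b ≡ (a + c ℤ.* e) ℤ.- (b + d ℤ.* e) + (d ℤ.- c) ℤ.* e
    lemma = solve 5 (λ a b c d e → a :- b := (a :+ c :* e) :- (b :+ d :* e) :+ (d :- c) :* e) refl
      where open ℤSolver.+-*-Solver
    from : ∀ k d → ℤ.∣ d ∣ ≡ k → + p ℤ.- + p′ ≡ d ℤ.* + n → p ≡ p′
    from zero    d ∣d∣ eq = ℤ.+-injective (ℤ.i-j≡0⇒i≡j (+ p) (+ p′) (trans eq (cong (ℤ._* + n) (ℤ.∣i∣≡0⇒i≡0 {d} ∣d∣))))
    from (suc k) d ∣d∣ eq = contradiction n≤ (ℕ.<⇒≱ small)
      where
      small : ℤ.∣ + p ℤ.- + p′ ∣ ℕ.< n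
      small = ℕ.≤-<-trans (subst (λ z → ℤ.∣ z ∣ ℕ.≤ p ℕ.⊔ p′) (sym (ℤ.m-n≡m⊖n p p′)) (ℤ.∣m⊝n∣≤m⊔n p p′))
                (ℕ.⊔-pres-<m p<n p′<n)
      n≤ : n ℕ.≤ ℤ.∣ + p ℤ.- + p′ ∣
      n≤ = subst (n ℕ.≤_) (sym (trans (cong ℤ.∣_∣ eq) (trans (ℤ.abs-* d (+ n)) (cong (ℕ._* n) ∣d∣)))) (ℕ.m≤m+n n (k ℕ.* n))

  vertex-unique : ∀ {i p} q → p ℕ.< n → i ≡ + p + q ℤ.* + n → toℕ (vertex i) ≡ p
  vertex-unique {i} q p<n eq =
    residue-unique (i ℤ./ℕ n) q (Fin.toℕ<n (vertex i)) p<n (trans (sym (vertex-decompose i)) eq)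

  vertex-+ : ∀ v → vertex (+ toℕ v) ≡ v
  vertex-+ v = Fin.toℕ-injective (vertex-unique {+ toℕ v} 0ℤ (Fin.toℕ<n v) (sym (ℤ.+-identityʳ (+ toℕ v))))

  data Shifted (i : ℤ) (d : ℕ) : Set where
    within : toℕ (vertex i) ℕ.+ d ℕ.< n → toℕ (vertex (i + + d)) ≡ toℕ (vertex i) ℕ.+ d → Shifted i d
    wraps  : n ℕ.+ toℕ (vertex (i + + d)) ≡ toℕ (vertex i) ℕ.+ d → Shifted i d

  shifted : ∀ i d → d ℕ.≤ n → Shifted i d
  shifted i d d≤n with toℕ (vertex i) ℕ.+ d ℕ.<? n
  ... | yes p+d<n = within p+d<n (vertex-unique (i ℤ./ℕ n) p+d<n (begin
          i + + d                          ≡⟨ cong (_+ + d) (vertex-decompose i) ⟩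
          + p + q ℤ.* + n + + d            ≡⟨ lemma (+ p) (q ℤ.* + n) (+ d) ⟩
          + (p ℕ.+ d) + q ℤ.* + n          ∎))
    where
    open ≡-Reasoning
    p = toℕ (vertex i)
    q = i ℤ./ℕ n
    lemma : ∀ a b c → a + b + c ≡ a + c + b
    lemma = solve 3 (λ a b c → a :+ b :+ c := a :+ c :+ b) refl where open ℤSolver.+-*-Solver
  ... | no p+d≮n = wraps (trans (cong (n ℕ.+_) (vertex-unique (1ℤ + q) r<n (begin
          i + + d                          ≡⟨ cong (_+ + d) (vertex-decompose i) ⟩
          + p + q ℤ.* + n + + d            ≡⟨ lemma (+ p) (q ℤ.* + n) (+ d) ⟩
          + (p ℕ.+ d) + q ℤ.* + n          ≡⟨ cong (λ z → + z + q ℤ.* + n) n+r≡p+d ⟨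
          + n + + r + q ℤ.* + n            ≡⟨ lemma′ (+ n) (+ r) q ⟩
          + r + (1ℤ + q) ℤ.* + n           ∎))) n+r≡p+d)
    where
    open ≡-Reasoning
    p = toℕ (vertex i)
    q = i ℤ./ℕ n
    r = p ℕ.+ d ∸ n
    n+r≡p+d : n ℕ.+ r ≡ p ℕ.+ d
    n+r≡p+d = ℕ.m+[n∸m]≡n (ℕ.≮⇒≥ p+d≮n)
    r<n : r ℕ.< n
    r<n = ℕ.+-cancelˡ-< n r n (subst (ℕ._< n ℕ.+ n) (sym n+r≡p+d) (ℕ.+-mono-<-≤ (Fin.toℕ<n (vertex i)) d≤n))
    lemma : ∀ a b c → a + b + c ≡ a + c + b
    lemma = solve 3 (λ a b c → a :+ b :+ c := a :+ c :+ b) refl where open ℤSolver.+-*-Solver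
    lemma′ : ∀ a b c → a + b + c ℤ.* a ≡ b + (1ℤ + c) ℤ.* a
    lemma′ = solve 3 (λ a b c → a :+ b :+ c :* a := b :+ (con 1ℤ :+ c) :* a) refl where open ℤSolver.+-*-Solver

  vertex-period : ∀ i → vertex (i + + n) ≡ vertex i
  vertex-period i with shifted i n ℕ.≤-refl
  ... | within p+n<n _ = contradiction p+n<n (ℕ.≤⇒≯ (ℕ.m≤n+m n _))
  ... | wraps eq = Fin.toℕ-injective (ℕ.+-cancelˡ-≡ n _ _ (trans eq (ℕ.+-comm _ n)))

  vertex-next : ∀ i → vertex (i + + 1) ≡ next (vertex i)
  vertex-next i with shifted i 1 (s≤s z≤n) | nextView (vertex i)
  ... | within _ eq   | inner _ eq′ = Fin.toℕ-injective (trans eq (trans (ℕ.+-comm _ 1) (sym eq′)))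
  ... | within p<n _  | last p≡ _ = contradiction p<n (ℕ.<-irrefl (trans (ℕ.+-comm _ 1) (cong suc p≡)))
  ... | wraps eq      | inner p<n _ =
          contradiction p<n (ℕ.≤⇒≯ (ℕ.≤-trans (ℕ.m≤m+n n _) (ℕ.≤-reflexive (trans eq (ℕ.+-comm _ 1)))))
  ... | wraps eq      | last p≡ eq′ = Fin.toℕ-injective (trans
          (ℕ.+-cancelˡ-≡ n _ 0 (trans eq (trans (ℕ.+-comm _ 1) (trans (cong suc p≡) (sym (ℕ.+-identityʳ n))))))
          (sym eq′))

  gap-offset : ∀ {l h i j} → Gap l h i j → ∃ λ d → l ℕ.≤ d × d ℕ.≤ h × j ≡ i + + d
  gap-offset {l} {h} {i} {j} (l≤ , ≤h) with j ℤ.- i in eq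
  ... | + d = d , ℤ.drop‿+≤+ l≤ , ℤ.drop‿+≤+ ≤h ,
        trans (solve 2 (λ i j → j := i :+ (j :- i)) refl i j) (cong (λ z → i + z) eq)
    where open ℤSolver.+-*-Solver
  ... | ℤ.-[1+ _ ] = case l≤ of λ ()

  offset-gap : ∀ {l h d} i → l ℕ.≤ d → d ℕ.≤ h → Gap l h i (i + + d)
  offset-gap {l} {h} {d} i l≤d d≤h =
    subst (λ z → + l ℤ.≤ z × z ℤ.≤ + h) (sym ([i+j]-i i (+ d))) (ℤ.+≤+ l≤d , ℤ.+≤+ d≤h)
    where
    [i+j]-i : ∀ i j → (i + j) ℤ.- i ≡ j
    [i+j]-i = solve 2 (λ i j → (i :+ j) :- i := j) refl where open ℤSolver.+-*-Solver

  offset-distinct : ∀ i {d} → 1 ℕ.≤ d → d ℕ.< n → vertex i ≢ vertex (i + + d)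
  offset-distinct i {d} 1≤d d<n eq with shifted i d (ℕ.<⇒≤ d<n)
  ... | within _ e = ℕ.<-irrefl (trans (ℕ.+-cancelˡ-≡ (toℕ (vertex i)) 0 d
          (trans (ℕ.+-identityʳ _) (trans (cong toℕ eq) e))) refl) 1≤d
  ... | wraps e = ℕ.<-irrefl (ℕ.+-cancelˡ-≡ (toℕ (vertex i)) d n
          (trans (sym e) (trans (cong (λ v → n ℕ.+ toℕ v) (sym eq)) (ℕ.+-comm n _)))) d<n

-- Recurrence, minors and glide symmetry of a frieze

module FriezeWeights (m : ℕ) (C : Coefficients m) where

  open Frieze m hiding (wt; x; y; R; W)
  open Combinatorics m
  open VertexArithmetic m
  open Coefficients C
  open RingIdentities ring constants
  open Weights m C

  Y : ℤ → A
  Y i = wt (inj₂ (vertex i))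

  record IsFrieze (W : ℤ → ℤ → A) : Set where
    field
      D1ˡ : ∀ i → W i i ≋ 0#
      D1ʳ : ∀ i → W i (i + + n) ≋ 0#
      D2ˡ : ∀ i → W i (i + + 1) ≋ Y i
      D2ʳ : ∀ i → W i (i + + (n ∸ 1)) ≋ Y (i ℤ.- + 1)
      D3  : ∀ i j → Interior i j → ¬ W i j ≋ 0#
      D4  : ∀ i j → Gap 1 (n ∸ 1) i j →
            W i j · W (i + + 1) (j + + 1) ⊟ W (i + + 1) j · W i (j + + 1) ≋ Y i · Y j

  -- A frieze read from a base index on, so that rows and columns are natural numbers.
  record BasedFrieze : Set where
    field
      M      : ℕ → ℕ → A
      y      : ℕ → A
      zeroˡ′ : ∀ a → M a a ≋ 0#
      zeroʳ′ : ∀ a → M a (n ℕ.+ a) ≋ 0#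
      edgeˡ  : ∀ a → M a (suc a) ≋ y a
      edgeʳ  : ∀ a → M (suc a) (n ℕ.+ a) ≋ y a
      y≉0    : ∀ a → ¬ y a ≋ 0#
      M≉0    : ∀ {a b} → a ℕ.< b → b ℕ.< n ℕ.+ a → ¬ M a b ≋ 0#
      rule   : ∀ {a b} → a ℕ.< b → b ℕ.< n ℕ.+ a →
               M a b · M (suc a) (suc b) ⊟ M (suc a) b · M a (suc b) ≋ y a · y b

    -- The coefficients depend on the column `b` alone. Induction moves from row `b`, where `M b b`
    -- vanishes and the claim is a boundary condition, up to row `a`; each step cancels the nonzero
    -- entry `M (suc a) (suc b)`.
    recurrence : ∀ k {a b} → k ℕ.+ a ≡ b → 2 ℕ.+ b ℕ.≤ n ℕ.+ a →
                 y (suc b) · M a b ⊞ y b · M a (2 ℕ.+ b) ≋ M b (2 ℕ.+ b) · M a (suc b)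
    recurrence zero {a} refl _ = begin
      y (suc a) · M a a ⊞ y a · M a (2 ℕ.+ a)     ≈⟨ +-congʳ (*-congˡ (zeroˡ′ a)) ⟩
      y (suc a) · 0# ⊞ y a · M a (2 ℕ.+ a)        ≈⟨ +-congʳ (zeroʳ _) ⟩
      0# ⊞ y a · M a (2 ℕ.+ a)                    ≈⟨ +-identityˡ _ ⟩
      y a · M a (2 ℕ.+ a)                         ≈⟨ *-comm _ _ ⟩
      M a (2 ℕ.+ a) · y a                         ≈⟨ *-congˡ (edgeˡ a) ⟨
      M a (2 ℕ.+ a) · M a (suc a)                 ∎
      where open Relation.Binary.Reasoning.Setoid setoid
    recurrence (suc k) {a} {b} eq 2+b≤ = cancelˡ
      (M≉0 (s≤s a<b) (ℕ.≤-trans 2+b≤ (ℕ.+-monoʳ-≤ n (ℕ.n≤1+n a))))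
      (recurrence-step (rule a<b (ℕ.<-trans ℕ.≤-refl 2+b≤)) (rule (ℕ.<-trans a<b ℕ.≤-refl) 2+b≤)
        (recurrence k (trans (ℕ.+-suc k a) eq) (ℕ.≤-trans 2+b≤ (ℕ.+-monoʳ-≤ n (ℕ.n≤1+n a)))))
      where
      a<b : a ℕ.< b
      a<b = subst (a ℕ.<_) eq (s≤s (ℕ.m≤n+m a k))

    -- As functions of `b` both sides obey the recurrence. They agree at `b` equal to `a`, where
    -- both vanish, and at `suc a`, where the claim is the diamond rule of rows 0 and 1.
    minor : ∀ k {a b} → k ℕ.+ a ≡ b → 1 ℕ.≤ a → b ℕ.≤ n → y 0 · M a b ≋ M 0 a · M 1 b ⊟ M 1 a · M 0 b
    minor zero {a} refl _ _ = begin
      y 0 · M a a                          ≈⟨ *-congˡ (zeroˡ′ a) ⟩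
      y 0 · 0#                             ≈⟨ zeroʳ _ ⟩
      0#                                   ≈⟨ -‿inverseʳ _ ⟨
      M 0 a · M 1 a ⊟ M 0 a · M 1 a        ≈⟨ +-congˡ (-‿cong (*-comm _ _)) ⟩
      M 0 a · M 1 a ⊟ M 1 a · M 0 a        ∎
      where open Relation.Binary.Reasoning.Setoid setoid
    minor (suc zero) {a} refl 1≤a a<n = begin
      y 0 · M a (suc a)                                ≈⟨ *-congˡ (edgeˡ a) ⟩
      y 0 · y a                                        ≈⟨ rule 1≤a (ℕ.≤-trans a<n (ℕ.m≤m+n n 0)) ⟨
      M 0 a · M 1 (suc a) ⊟ M 1 a · M 0 (suc a)        ∎
      where open Relation.Binary.Reasoning.Setoid setoid
    minor (suc (suc k)) {suc a} refl 1≤a b≤n = cancelˡ (y≉0 b) (minor-step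
      (recurrence b (ℕ.+-identityʳ b) (ℕ.≤-trans b≤n (ℕ.m≤m+n n 0)))
      (recurrence (k ℕ.+ a) (trans (ℕ.+-comm _ 1) (sym (ℕ.+-suc k a))) (ℕ.≤-trans b≤n (ℕ.m≤m+n n 1)))
      (recurrence k refl (ℕ.≤-trans b≤n (ℕ.m≤m+n n (suc a))))
      (minor k refl 1≤a (ℕ.≤-trans (ℕ.m≤n+m b 2) b≤n))
      (minor (suc k) refl 1≤a (ℕ.≤-trans (ℕ.n≤1+n (suc b)) b≤n)))
      where b = k ℕ.+ suc a

    -- In the last column of `minor`, the entry `M 0 n` is zero and `M 1 n` is the boundary value
    -- `y 0`, so only `M 0 a` times `y 0` remains, and `y 0` cancels.
    glide : ∀ {a} → a ℕ.≤ n → M a n ≋ M 0 a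
    glide {zero}  _   = ≋-trans (subst (λ b → M 0 b ≋ 0#) (ℕ.+-identityʳ n) (zeroʳ′ 0)) (≋-sym (zeroˡ′ 0))
    glide {suc a} a<n = cancelˡ (y≉0 0) (begin
      y 0 · M (suc a) n
        ≈⟨ minor (n ∸ suc a) (ℕ.m∸n+n≡m a<n) (s≤s z≤n) ℕ.≤-refl ⟩
      M 0 (suc a) · M 1 n ⊟ M 1 (suc a) · M 0 n
        ≈⟨ +-cong (*-congˡ (subst (λ b → M 1 b ≋ y 0) (ℕ.+-identityʳ n) (edgeʳ 0)))
                  (-‿cong (≋-trans (*-congˡ (subst (λ b → M 0 b ≋ 0#) (ℕ.+-identityʳ n) (zeroʳ′ 0))) (zeroʳ _))) ⟩
      M 0 (suc a) · y 0 ⊟ 0#         ≈⟨ +-congˡ -0#≈0# ⟩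
      M 0 (suc a) · y 0 ⊞ 0#         ≈⟨ +-identityʳ _ ⟩
      M 0 (suc a) · y 0              ≈⟨ *-comm _ _ ⟩
      y 0 · M 0 (suc a)              ∎)
      where
      open Relation.Binary.Reasoning.Setoid setoid
      open Algebra.Properties.Ring ring′ using (-0#≈0#)

    -- Row 1 of the frieze has no entry in column 0. The value `- y 0` continues `M 0 1`
    -- antisymmetrically, which makes `M-det` hold for column 0 as well.
    column : ℕ → A × A
    column zero    = M 0 0 , - y 0
    column (suc a) = M 0 (suc a) , M 1 (suc a)

    M-det : ∀ {a b} → a ℕ.≤ b → b ℕ.≤ n → y 0 · M a b ≋ det (column a) (column b)
    M-det {suc a} {suc b} a≤b b≤n = ≋-trans
      (minor (b ∸ a) (trans (ℕ.+-suc _ a) (cong suc (ℕ.m∸n+n≡m (ℕ.s≤s⁻¹ a≤b)))) (s≤s z≤n) b≤n)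
      (≋-sym (det-expand _ _ _ _))
    M-det {zero}  {b}     a≤b b≤n = first b
      where
      open Relation.Binary.Reasoning.Setoid setoid
      open Algebra.Properties.Ring ring′ using (-‿distribˡ-*; -‿involutive)
      expand : ∀ b c → y 0 · M 0 b ≋ det (column 0) (M 0 b , c)
      expand b c = begin
        y 0 · M 0 b                               ≈⟨ -‿involutive _ ⟨
        - (- (y 0 · M 0 b))                       ≈⟨ -‿cong (-‿distribˡ-* _ _) ⟩
        - (- y 0 · M 0 b)                         ≈⟨ +-identityˡ _ ⟨
        0# ⊟ - y 0 · M 0 b                        ≈⟨ +-congʳ (≋-trans (*-congʳ (zeroˡ′ 0)) (zeroˡ c)) ⟨
        M 0 0 · c ⊟ - y 0 · M 0 b                 ≈⟨ det-expand _ _ _ _ ⟨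
        det (column 0) (M 0 b , c)                ∎
      first : ∀ b → y 0 · M 0 b ≋ det (column 0) (column b)
      first zero    = expand 0 _
      first (suc b) = expand (suc b) _

    M-ptolemy : ∀ {i j k l} → i ℕ.≤ j → j ℕ.≤ k → k ℕ.≤ l → l ℕ.≤ n →
                M i k · M j l ≋ M i j · M k l ⊞ M i l · M j k
    M-ptolemy {i} {j} {k} {l} i≤j j≤k k≤l l≤n = cancelˡ (y≉0 0) (cancelˡ (y≉0 0)
      (plücker-scaled (column i) (column j) (column k) (column l)
        (M-det (ℕ.≤-trans i≤j j≤k) k≤n) (M-det (ℕ.≤-trans j≤k k≤l) l≤n)
        (M-det i≤j (ℕ.≤-trans j≤k k≤n)) (M-det k≤l l≤n)
        (M-det (ℕ.≤-trans i≤j (ℕ.≤-trans j≤k k≤l)) l≤n) (M-det j≤k k≤n)))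
      where k≤n = ℕ.≤-trans k≤l l≤n

-- Friezes as functions of chords, and back

module FriezeReduction (m : ℕ) (C : Coefficients m) where

  open Frieze m hiding (wt; x; y; R; W)
  open Combinatorics m
  open VertexArithmetic m
  open Coefficients C
  open Weights m C
  open FriezeWeights m C

  symmetrize-sym : ∀ w u v → symmetrize w u v ≡ symmetrize w v u
  symmetrize-sym w u v = cong₂ w (ℕ.⊓-comm (toℕ u) (toℕ v)) (ℕ.⊔-comm (toℕ u) (toℕ v))

  symmetrize-≤ : ∀ w {u v} → toℕ u ℕ.≤ toℕ v → symmetrize w u v ≡ w (toℕ u) (toℕ v)
  symmetrize-≤ w u≤v = cong₂ w (ℕ.m≤n⇒m⊓n≡m u≤v) (ℕ.m≤n⇒m⊔n≡n u≤v)

  symmetrize-≥ : ∀ w {u v} → toℕ v ℕ.≤ toℕ u → symmetrize w u v ≡ w (toℕ v) (toℕ u)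
  symmetrize-≥ w {u} {v} v≤u = trans (symmetrize-sym w u v) (symmetrize-≤ w v≤u)

  ≡⇒≋ : ∀ {p q} → p ≡ q → p ≋ q
  ≡⇒≋ refl = ≋-refl

  module FromFrieze {W : ℤ → ℤ → A} (frieze : IsFrieze W) where
    open IsFrieze frieze

    offset : ∀ s a k → s + + a + + k ≡ s + + (k ℕ.+ a)
    offset s a k = trans (ℤ.+-assoc s (+ a) (+ k)) (cong (λ k → s + + k) (ℕ.+-comm a k))

    pred-suc : ∀ s a → s + + suc a ℤ.- + 1 ≡ s + + a
    pred-suc s a = trans (ℤ.+-assoc s (+ suc a) (ℤ.- + 1)) (cong (λ z → s + z) (ℤ.+-comm (+ suc a) (ℤ.- + 1)))

    Y≉0 : ∀ i → ¬ Y i ≋ 0#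
    Y≉0 i = Pos⇒≉0 (Pos-wt _)

    entry≉0 : ∀ i d → 1 ℕ.≤ d → d ℕ.< n → ¬ W i (i + + d) ≋ 0#
    entry≉0 i d 1≤d (s≤s d≤2+m) with ℕ.m≤n⇒m<n∨m≡n 1≤d | ℕ.m≤n⇒m<n∨m≡n d≤2+m
    ... | inj₂ refl | _          = Y≉0 i ∘ ≋-trans (≋-sym (D2ˡ i))
    ... | inj₁ _    | inj₂ refl  = Y≉0 (i ℤ.- + 1) ∘ ≋-trans (≋-sym (D2ʳ i))
    ... | inj₁ 2≤d  | inj₁ d<2+m = D3 i (i + + d) (offset-gap i 2≤d (ℕ.s≤s⁻¹ d<2+m))

    based : ℤ → BasedFrieze
    based s = record
      { M = M
      ; y = y
      ; zeroˡ′ = λ a → D1ˡ (s + + a)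
      ; zeroʳ′ = λ a → subst (λ j → W (s + + a) j ≋ 0#) (offset s a n) (D1ʳ (s + + a))
      ; edgeˡ = λ a → subst (λ j → W (s + + a) j ≋ y a) (offset s a 1) (D2ˡ (s + + a))
      ; edgeʳ = λ a → subst₂ (λ j k → W (s + + suc a) j ≋ Y k)
          (trans (offset s (suc a) (2 ℕ.+ m)) (cong (λ k → s + + k) (ℕ.+-suc (2 ℕ.+ m) a))) (pred-suc s a)
          (D2ʳ (s + + suc a))
      ; y≉0 = λ a → Y≉0 (s + + a)
      ; M≉0 = λ {a} {b} a<b b<n+a → subst (λ j → ¬ W (s + + a) j ≋ 0#) (to (ℕ.<⇒≤ a<b))
          (entry≉0 (s + + a) (b ∸ a) (ℕ.m<n⇒0<n∸m a<b) (diff< a<b b<n+a))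
      ; rule = λ {a} {b} a<b b<n+a → subst₂ (λ i j → M a b · W i j ⊟ W i (s + + b) · W (s + + a) j ≋ y a · y b)
          (offset s a 1) (offset s b 1)
          (D4 (s + + a) (s + + b) (subst (Gap 1 (2 ℕ.+ m) (s + + a)) (to (ℕ.<⇒≤ a<b))
            (offset-gap (s + + a) (ℕ.m<n⇒0<n∸m a<b) (ℕ.s≤s⁻¹ (diff< a<b b<n+a))))) }
      where
      M : ℕ → ℕ → A
      M a b = W (s + + a) (s + + b)
      y : ℕ → A
      y a = Y (s + + a)
      to : ∀ {a b} → a ℕ.≤ b → s + + a + + (b ∸ a) ≡ s + + b
      to {a} {b} a≤b = trans (offset s a (b ∸ a)) (cong (λ k → s + + k) (ℕ.m∸n+n≡m a≤b))
      diff< : ∀ {a b} → a ℕ.< b → b ℕ.< n ℕ.+ a → b ∸ a ℕ.< n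
      diff< {a} {b} a<b b<n+a = ℕ.+-cancelʳ-< a (b ∸ a) n
        (subst (ℕ._< n ℕ.+ a) (sym (ℕ.m∸n+n≡m (ℕ.<⇒≤ a<b))) b<n+a)

    glide : ∀ s {a} → a ℕ.≤ n → W (s + + a) (s + + n) ≋ W s (s + + a)
    glide s {a} a≤n = subst (λ i → W (s + + a) (s + + n) ≋ W i (s + + a)) (ℤ.+-identityʳ s)
      (BasedFrieze.glide (based s) a≤n)

    -- Two glides: the one based at `i + + d` leads to the entry in row `i + + d` and column
    -- `i + + n`, and the one based at `i` leads from there to `W i (i + + d)`.
    period : ∀ i {d} → d ℕ.≤ n → W (i + + n) (i + + n + + d) ≋ W i (i + + d)
    period i {d} d≤n = ≋-trans (subst₂ (λ j k → W j k ≋ W (i + + d) j) middle end (≋-sym-glide)) (glide i d≤n)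
      where
      ≋-sym-glide : W (i + + d + + (n ∸ d)) (i + + d + + n) ≋ W (i + + d) (i + + d + + (n ∸ d))
      ≋-sym-glide = glide (i + + d) (ℕ.m∸n≤m n d)
      middle : i + + d + + (n ∸ d) ≡ i + + n
      middle = trans (offset i d (n ∸ d)) (cong (λ k → i + + k) (ℕ.m∸n+n≡m d≤n))
      end : i + + d + + n ≡ i + + n + + d
      end = trans (offset i d n) (trans (cong (λ k → i + + k) (ℕ.+-comm n d)) (sym (offset i n d)))

    period-* : ∀ k i {d} → d ℕ.≤ n → W (i + + (k ℕ.* n)) (i + + (k ℕ.* n) + + d) ≋ W i (i + + d)
    period-* zero    i {d} d≤n = ≡⇒≋ (cong (λ i → W i (i + + d)) (ℤ.+-identityʳ i))
    period-* (suc k) i {d} d≤n = ≋-trans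
      (≡⇒≋ (cong (λ i → W i (i + + d)) (sym (offset i (k ℕ.* n) n))))
      (≋-trans (period (i + + (k ℕ.* n)) d≤n) (period-* k i d≤n))

    period-residue : ∀ i {d} → d ℕ.≤ n → W i (i + + d) ≋ W (+ toℕ (vertex i)) (+ (toℕ (vertex i) ℕ.+ d))
    period-residue i {d} d≤n with i ℤ./ℕ n | vertex-decompose i
    ... | + k        | eq = ≋-trans (≡⇒≋ (cong (λ i → W i (i + + d)) (trans eq
              (cong (λ z → + toℕ (vertex i) + z) (sym (ℤ.pos-* k n)))))) (period-* k (+ toℕ (vertex i)) d≤n)
    ... | ℤ.-[1+ k ] | eq = ≋-sym (≋-trans (≡⇒≋ (cong (λ j → W j (j + + d)) back)) (period-* (suc k) i d≤n))
      where
      open ℤSolver.+-*-Solver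
      back : + toℕ (vertex i) ≡ i + + (suc k ℕ.* n)
      back = trans (solve 3 (λ p k n → p := p :+ (:- k) :* n :+ k :* n) refl (+ toℕ (vertex i)) (+ suc k) (+ n))
        (cong₂ ℤ._+_ (sym eq) (sym (ℤ.pos-* (suc k) n)))

    w : ℕ → ℕ → A
    w i j = W (+ i) (+ j)

    -- Periodicity moves the row to its residue. If the column then reaches n or beyond, one glide
    -- brings it back and exchanges the two vertices; hence an entry depends on the unordered pair
    -- only.
    reduce : ∀ i {d} → d ℕ.≤ n → W i (i + + d) ≋ symmetrize w (vertex i) (vertex (i + + d))
    reduce i {d} d≤n with shifted i d d≤n
    ... | within _ eq = ≋-trans (period-residue i d≤n) (≡⇒≋ (sym (trans
            (symmetrize-≤ w (ℕ.≤-trans (ℕ.m≤m+n _ d) (ℕ.≤-reflexive (sym eq)))) (cong (w _) eq))))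
    ... | wraps eq = ≋-trans (period-residue i d≤n) (≋-trans
            (≡⇒≋ (cong₂ (λ j k → W (+ j) (+ k)) (sym p≡) (trans (sym eq) (ℕ.+-comm n q))))
            (≋-trans (glide (+ q) (ℕ.m∸n≤m n d)) (≡⇒≋ (sym (trans (symmetrize-≥ w q≤p) (cong (w q) (sym p≡)))))))
      where
      p = toℕ (vertex i)
      q = toℕ (vertex (i + + d))
      p≡ : q ℕ.+ (n ∸ d) ≡ p
      p≡ = ℕ.+-cancelʳ-≡ d _ _ (trans (ℕ.+-assoc q (n ∸ d) d)
             (trans (cong (q ℕ.+_) (ℕ.m∸n+n≡m d≤n)) (trans (ℕ.+-comm q n) eq)))
      q≤p : q ℕ.≤ p
      q≤p = subst (q ℕ.≤_) p≡ (ℕ.m≤m+n q (n ∸ d))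

    ptolemaic : Ptolemaic w
    ptolemaic = record
      { loop = λ {i} _ → D1ˡ (+ i)
      ; boundary = boundary′
      ; ptolemy = λ i≤j j≤k k≤l l<n → BasedFrieze.M-ptolemy (based 0ℤ) i≤j j≤k k≤l (ℕ.<⇒≤ l<n) }
      where
      boundary′ : ∀ v → symmetrize w v (next v) ≋ wt (inj₂ v)
      boundary′ v = ≋-trans (≋-sym (subst₂ (λ u v′ → W (+ toℕ v) (+ toℕ v + + 1) ≋ symmetrize w u v′)
          (vertex-+ v) (trans (vertex-next (+ toℕ v)) (cong next (vertex-+ v))) (reduce (+ toℕ v) (s≤s z≤n))))
        (≋-trans (D2ˡ (+ toℕ v)) (≡⇒≋ (cong (wt ∘ inj₂) (vertex-+ v))))

  module FromWeights {w : ℕ → ℕ → A} (pt : Ptolemaic w)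
    (pos : ∀ {i j} → i ℕ.< j → j ℕ.< n → Pos (w i j)) where

    s : Vertex → Vertex → A
    s = symmetrize w

    entry : ℤ → ℤ → A
    entry i j = s (vertex i) (vertex j)

    s-diag : ∀ v → s v v ≋ 0#
    s-diag v = ≋-trans (≡⇒≋ (symmetrize-≤ w {v} {v} ℕ.≤-refl)) (loop pt (Fin.toℕ<n v))

    s-pos : ∀ {u v} → u ≢ v → Pos (s u v)
    s-pos {u} {v} u≢v with ℕ.<-cmp (toℕ u) (toℕ v)
    ... | tri< u<v _ _ = subst Pos (sym (symmetrize-≤ w (ℕ.<⇒≤ u<v))) (pos u<v (Fin.toℕ<n v))
    ... | tri≈ _ u≡v _ = contradiction (Fin.toℕ-injective u≡v) u≢v
    ... | tri> _ _ v<u = subst Pos (sym (symmetrize-≥ w (ℕ.<⇒≤ v<u))) (pos v<u (Fin.toℕ<n u))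

    -- Ptolemy's relation for `u`, `u + 1`, `v`, `v + 1`. If `v` is the last vertex, its successor
    -- is 0, and the relation is that for 0, `u`, `u + 1`, `v`, with its products in other places.
    diamond-< : ∀ {u v} → toℕ u ℕ.< toℕ v →
      s u v · s (next u) (next v) ≋ s u (next u) · s v (next v) ⊞ s (next u) v · s u (next v)
    diamond-< {u} {v} u<v with nextView u | nextView v
    ... | last u≡ _ | _ = contradiction (Fin.toℕ<n v) (ℕ.≤⇒≯ (subst (λ p → suc p ℕ.≤ toℕ v) u≡ u<v))
    ... | inner _ u′≡ | inner v′<n v′≡
      rewrite symmetrize-≤ w {u} {v} (ℕ.<⇒≤ u<v)
            | symmetrize-≤ w {next u} {next v} (subst₂ ℕ._≤_ (sym u′≡) (sym v′≡) (s≤s (ℕ.<⇒≤ u<v)))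
            | symmetrize-≤ w {u} {next u} (subst (toℕ u ℕ.≤_) (sym u′≡) (ℕ.n≤1+n _))
            | symmetrize-≤ w {v} {next v} (subst (toℕ v ℕ.≤_) (sym v′≡) (ℕ.n≤1+n _))
            | symmetrize-≤ w {next u} {v} (subst (ℕ._≤ toℕ v) (sym u′≡) u<v)
            | symmetrize-≤ w {u} {next v} (subst (toℕ u ℕ.≤_) (sym v′≡) (ℕ.≤-trans (ℕ.<⇒≤ u<v) (ℕ.n≤1+n _)))
            | u′≡ | v′≡
      = ≋-trans (ptolemy pt (ℕ.n≤1+n _) u<v (ℕ.n≤1+n _) v′<n) (+-congˡ (*-comm _ _))
    ... | inner _ u′≡ | last _ v′≡
      rewrite symmetrize-≤ w {u} {v} (ℕ.<⇒≤ u<v)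
            | symmetrize-≥ w {next u} {next v} (subst (ℕ._≤ toℕ (next u)) (sym v′≡) z≤n)
            | symmetrize-≤ w {u} {next u} (subst (toℕ u ℕ.≤_) (sym u′≡) (ℕ.n≤1+n _))
            | symmetrize-≥ w {v} {next v} (subst (ℕ._≤ toℕ v) (sym v′≡) z≤n)
            | symmetrize-≤ w {next u} {v} (subst (ℕ._≤ toℕ v) (sym u′≡) u<v)
            | symmetrize-≥ w {u} {next v} (subst (ℕ._≤ toℕ u) (sym v′≡) z≤n)
            | u′≡ | v′≡
      = ≋-trans (*-comm _ _) (≋-trans (ptolemy pt z≤n (ℕ.n≤1+n _) u<v (Fin.toℕ<n v))
          (≋-trans (+-comm _ _) (+-cong (*-comm _ _) (*-comm _ _))))

    diamond : ∀ {u v} → u ≢ v →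
      s u v · s (next u) (next v) ≋ s u (next u) · s v (next v) ⊞ s (next u) v · s u (next v)
    diamond {u} {v} u≢v with ℕ.<-cmp (toℕ u) (toℕ v)
    ... | tri< u<v _ _ = diamond-< u<v
    ... | tri≈ _ u≡v _ = contradiction (Fin.toℕ-injective u≡v) u≢v
    ... | tri> _ _ v<u = ≋-trans (≡⇒≋ (cong₂ _·_ (symmetrize-sym w u v) (symmetrize-sym w (next u) (next v))))
          (≋-trans (diamond-< v<u) (+-cong (*-comm _ _) (≋-trans (*-comm _ _)
            (≡⇒≋ (cong₂ _·_ (symmetrize-sym w v (next u)) (symmetrize-sym w (next v) u))))))

    isFrieze : IsFrieze entry
    isFrieze = record
      { D1ˡ = λ i → s-diag (vertex i)
      ; D1ʳ = λ i → ≋-trans (≡⇒≋ (cong (s (vertex i)) (vertex-period i))) (s-diag (vertex i))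
      ; D2ˡ = λ i → ≋-trans (≡⇒≋ (cong (s (vertex i)) (vertex-next i))) (boundary pt (vertex i))
      ; D2ʳ = λ i → ≋-trans (≡⇒≋ (cong₂ s
                  (trans (cong vertex (sym (back i))) (vertex-next (i ℤ.- + 1)))
                  (trans (cong vertex (around i)) (vertex-period (i ℤ.- + 1)))))
                (≋-trans (≡⇒≋ (symmetrize-sym w (next (vertex (i ℤ.- + 1))) _)) (boundary pt (vertex (i ℤ.- + 1))))
      ; D3 = λ i j gap → let d , 2≤d , d≤1+m , j≡ = gap-offset {2} {1 ℕ.+ m} {i} {j} gap in
          Pos⇒≉0 (subst (λ j → Pos (entry i j)) (sym j≡)
            (s-pos (offset-distinct i (ℕ.≤-trans (ℕ.n≤1+n 1) 2≤d) (s≤s (ℕ.≤-trans d≤1+m (ℕ.n≤1+n _))))))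
      ; D4 = rule }
      where
      open ℤSolver.+-*-Solver
      back : ∀ i → i ℤ.- + 1 + + 1 ≡ i
      back = solve 1 (λ i → i :- con (+ 1) :+ con (+ 1) := i) refl
      around : ∀ i → i + + (2 ℕ.+ m) ≡ i ℤ.- + 1 + + n
      around i = trans (cong (λ j → j + + (2 ℕ.+ m)) (sym (back i))) (ℤ.+-assoc (i ℤ.- + 1) (+ 1) (+ (2 ℕ.+ m)))
      subtract : ∀ {p q r} → p ≋ q ⊞ r → p ⊟ r ≋ q
      subtract {p} {q} {r} eq = ≋-trans (+-congʳ eq) (≋-trans (+-assoc q r (- r))
        (≋-trans (+-congˡ (-‿inverseʳ r)) (+-identityʳ q)))
      rule : ∀ i j → Gap 1 (2 ℕ.+ m) i j →
        entry i j · entry (i + + 1) (j + + 1) ⊟ entry (i + + 1) j · entry i (j + + 1) ≋ Y i · Y j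
      rule i j gap with gap-offset {1} {2 ℕ.+ m} {i} {j} gap
      ... | d , 1≤d , d≤2+m , refl rewrite vertex-next i | vertex-next (i + + d) =
        ≋-trans (subtract (diamond (offset-distinct i 1≤d (s≤s d≤2+m))))
          (*-cong (boundary pt (vertex i)) (boundary pt (vertex (i + + d))))

-- Telescoping over the fan of a vertex

module Fans (m : ℕ) (C : Coefficients m) (Δ : Frieze.WeightedTriangulation m) where

  open Frieze m hiding (wt; x; y; R; W)
  open Combinatorics m
  open Coefficients C
  open RingIdentities ring constants
  open Weights m C
  open FriezeReduction m C using (≡⇒≋; symmetrize-≤; symmetrize-≥)
  open Triangulation Δ

  ∑ : {B : Set} → (B → A) → List B → A
  ∑ f xs = List.foldr _⊞_ 0# (map f xs)

  ∑-++ : {B : Set} (f : B → A) (xs ys : List B) → ∑ f (xs ++ ys) ≋ ∑ f xs ⊞ ∑ f ys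
  ∑-++ f []       ys = ≋-sym (+-identityˡ _)
  ∑-++ f (x ∷ xs) ys = ≋-trans (+-congˡ (∑-++ f xs ys)) (≋-sym (+-assoc _ _ _))

  loV hiV : Side → Vertex
  loV e = fromℕ< (ℕ.<-trans (lo<hi e) (hi<n e))
  hiV e = fromℕ< (hi<n e)

  toℕ-loV : ∀ e → toℕ (loV e) ≡ lo e
  toℕ-loV e = Fin.toℕ-fromℕ< _

  toℕ-hiV : ∀ e → toℕ (hiV e) ≡ hi e
  toℕ-hiV e = Fin.toℕ-fromℕ< _

  -- The summand of Q at v divided by the weights of the two boundary sides at v.
  share : Vertex → Triple Δ → A
  share v (triple p q r qr pr pq) with v Fin.≟ p | v Fin.≟ q | v Fin.≟ r
  ... | yes _ | _     | _     = wt qr · (wt⁻¹ pq · wt⁻¹ pr)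
  ... | no _  | yes _ | _     = wt pr · (wt⁻¹ pq · wt⁻¹ qr)
  ... | no _  | no _  | yes _ = wt pq · (wt⁻¹ qr · wt⁻¹ pr)
  ... | no _  | no _  | no _  = 0#

  share-p : ∀ {v p q r qr pr pq} → v ≡ p → share v (triple p q r qr pr pq) ≡ wt qr · (wt⁻¹ pq · wt⁻¹ pr)
  share-p {v} {p} {q} {r} v≡p with v Fin.≟ p | v Fin.≟ q | v Fin.≟ r
  ... | yes _ | _ | _ = refl
  ... | no ¬p | _ | _ = contradiction v≡p ¬p

  share-q : ∀ {v p q r qr pr pq} → v ≢ p → v ≡ q → share v (triple p q r qr pr pq) ≡ wt pr · (wt⁻¹ pq · wt⁻¹ qr)
  share-q {v} {p} {q} {r} v≢p v≡q with v Fin.≟ p | v Fin.≟ q | v Fin.≟ r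
  ... | yes v≡p | _     | _ = contradiction v≡p v≢p
  ... | no _    | yes _ | _ = refl
  ... | no _    | no ¬q | _ = contradiction v≡q ¬q

  share-r : ∀ {v p q r qr pr pq} → v ≢ p → v ≢ q → v ≡ r →
            share v (triple p q r qr pr pq) ≡ wt pq · (wt⁻¹ qr · wt⁻¹ pr)
  share-r {v} {p} {q} {r} v≢p v≢q v≡r with v Fin.≟ p | v Fin.≟ q | v Fin.≟ r
  ... | yes v≡p | _       | _     = contradiction v≡p v≢p
  ... | no _    | yes v≡q | _     = contradiction v≡q v≢q
  ... | no _    | no _    | yes _ = refl
  ... | no _    | no _    | no ¬r = contradiction v≡r ¬r

  share-none : ∀ {v p q r qr pr pq} → v ≢ p → v ≢ q → v ≢ r → share v (triple p q r qr pr pq) ≡ 0#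
  share-none {v} {p} {q} {r} v≢p v≢q v≢r with v Fin.≟ p | v Fin.≟ q | v Fin.≟ r
  ... | yes v≡p | _       | _       = contradiction v≡p v≢p
  ... | no _    | yes v≡q | _       = contradiction v≡q v≢q
  ... | no _    | no _    | yes v≡r = contradiction v≡r v≢r
  ... | no _    | no _    | no _    = refl

  face : Side → Side → Side → Triple Δ
  face e l r = triple (loV e) (hiV l) (hiV e) r e l

  faces : ∀ {e} → Tree e → List (Triple Δ)
  faces     (leaf _)               = []
  faces {e} (node l r _ _ _ tl tr) = face e l r ∷ faces tl ++ faces tr

  ∉-lo : ∀ {v} e → toℕ v ≢ lo e → v ≢ loV e
  ∉-lo e v≢ refl = v≢ (toℕ-loV e)

  ∉-hi : ∀ {v} e → toℕ v ≢ hi e → v ≢ hiV e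
  ∉-hi e v≢ refl = v≢ (toℕ-hiV e)

  ∈-lo : ∀ {v} e → toℕ v ≡ lo e → v ≡ loV e
  ∈-lo e v≡ = Fin.toℕ-injective (trans v≡ (sym (toℕ-loV e)))

  ∈-hi : ∀ {v} e → toℕ v ≡ hi e → v ≡ hiV e
  ∈-hi e v≡ = Fin.toℕ-injective (trans v≡ (sym (toℕ-hiV e)))

  fan : ∀ {e} → Vertex → Tree e → A
  fan v t = ∑ (share v) (faces t)

  fan-node : ∀ v {e l r a b c} (tl : Tree l) (tr : Tree r) →
             share v (face e l r) ≋ a → fan v tl ≋ b → fan v tr ≋ c →
             ∑ (share v) (face e l r ∷ faces tl ++ faces tr) ≋ a ⊞ (b ⊞ c)
  fan-node v tl tr a b c = +-cong a (≋-trans (∑-++ (share v) (faces tl) (faces tr)) (+-cong b c))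

  0⊞0⊞0 : 0# ⊞ (0# ⊞ 0#) ≋ 0#
  0⊞0⊞0 = ≋-trans (+-identityˡ _) (+-identityˡ _)

  fan-outside : ∀ v {e} (t : Tree e) → toℕ v ℕ.< lo e ⊎ hi e ℕ.< toℕ v → fan v t ≋ 0#
  fan-outside v (leaf _) _ = ≋-refl
  fan-outside v {e} (node l r lo≡ mid≡ hi≡ tl tr) out = ≋-trans
    (fan-node v tl tr (≡⇒≋ (share-none (∉-lo e (≢lo out)) (∉-hi l (≢mid out)) (∉-hi e (≢hi out))))
      (fan-outside v tl (outˡ out)) (fan-outside v tr (outʳ out)))
    0⊞0⊞0
    where
    Out : ℕ → ℕ → Set
    Out a b = toℕ v ℕ.< a ⊎ b ℕ.< toℕ v
    lo<mid : lo e ℕ.< hi l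
    lo<mid = subst (ℕ._< hi l) lo≡ (lo<hi l)
    mid<hi : hi l ℕ.< hi e
    mid<hi = subst₂ ℕ._<_ (sym mid≡) hi≡ (lo<hi r)
    ≢lo : Out (lo e) (hi e) → toℕ v ≢ lo e
    ≢lo (inj₁ lt) eq = ℕ.<-irrefl eq lt
    ≢lo (inj₂ lt) eq = ℕ.<-asym lt (subst (ℕ._< hi e) (sym eq) (lo<hi e))
    ≢mid : Out (lo e) (hi e) → toℕ v ≢ hi l
    ≢mid (inj₁ lt) eq = ℕ.<-asym lt (subst (lo e ℕ.<_) (sym eq) lo<mid)
    ≢mid (inj₂ lt) eq = ℕ.<-asym lt (subst (ℕ._< hi e) (sym eq) mid<hi)
    ≢hi : Out (lo e) (hi e) → toℕ v ≢ hi e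
    ≢hi (inj₁ lt) eq = ℕ.<-asym lt (subst (lo e ℕ.<_) (sym eq) (lo<hi e))
    ≢hi (inj₂ lt) eq = ℕ.<-irrefl (sym eq) lt
    outˡ : Out (lo e) (hi e) → Out (lo l) (hi l)
    outˡ (inj₁ lt) = inj₁ (subst (toℕ v ℕ.<_) (sym lo≡) lt)
    outˡ (inj₂ lt) = inj₂ (ℕ.<-trans mid<hi lt)
    outʳ : Out (lo e) (hi e) → Out (lo r) (hi r)
    outʳ (inj₁ lt) = inj₁ (ℕ.<-trans lt (subst (lo e ℕ.<_) mid≡ lo<mid))
    outʳ (inj₂ lt) = inj₂ (subst (ℕ._< toℕ v) (sym hi≡) lt)

  module _ {w : ℕ → ℕ → A} (pt : Ptolemaic w) (real : Realizes w) where

    private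
      w-side : ∀ {i j e} → Spans i j e → w i j ≋ wt e
      w-side {e = e} (refl , refl) = real e

      unit : ∀ {i j e} → Spans i j e → w i j · wt⁻¹ e ≋ 1#
      unit {e = e} s = side-unit pt real (e , s)

    -- The partial sum over the triangles at `v` between the boundary side `b` and `e`. The
    -- recursion replaces `e` by its left leg `l`; the triangle below `e` is added by Ptolemy's
    -- relation for `v`, `v + 1`, `hi l`, `hi e`. At a leaf the sum is empty, and the right side
    -- contains a loop, which has weight zero.
    fan-lo : ∀ v {e b} (t : Tree e) → toℕ v ≡ lo e → Spans (toℕ v) (suc (toℕ v)) b →
             fan v t ≋ w (suc (toℕ v)) (hi e) · (wt⁻¹ b · wt⁻¹ e)
    fan-lo v {e} {b} (leaf eq) v≡ sb = ≋-sym (≋-trans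
      (*-congʳ (≋-trans (≡⇒≋ (cong (λ k → w k (hi e)) (trans (cong suc v≡) eq))) (loop pt (hi<n e)))) (zeroˡ _))
    fan-lo v {e} {b} (node l r lo≡ mid≡ hi≡ tl tr) v≡ sb = begin
      fan v (node l r lo≡ mid≡ hi≡ tl tr)
        ≈⟨ fan-node v tl tr (≡⇒≋ (share-p (∈-lo e v≡))) (fan-lo v tl v≡l sb)
             (fan-outside v tr (inj₁ (subst₂ ℕ._<_ (sym v≡l) mid≡ (lo<hi l)))) ⟩
      wt r · (wt⁻¹ l · wt⁻¹ e) ⊞ (w (suc a) c · (wt⁻¹ b · wt⁻¹ l) ⊞ 0#)
        ≈⟨ +-cong (*-congʳ (w-side (sym mid≡ , hi≡))) (+-congʳ (*-congˡ (*-comm _ _))) ⟨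
      w c d · (wt⁻¹ l · wt⁻¹ e) ⊞ (w (suc a) c · (wt⁻¹ l · wt⁻¹ b) ⊞ 0#)
        ≈⟨ +-congˡ (+-identityʳ _) ⟩
      w c d · (wt⁻¹ l · wt⁻¹ e) ⊞ w (suc a) c · (wt⁻¹ l · wt⁻¹ b)
        ≈⟨ divided-ptolemy (unit (sym v≡l , refl)) (unit sb) (unit (sym v≡ , refl))
             (ptolemy pt (ℕ.n≤1+n a) (subst (ℕ._< c) (sym v≡l) (lo<hi l)) c≤d (hi<n e)) ⟨
      w (suc a) d · (wt⁻¹ b · wt⁻¹ e) ∎
      where
      open Relation.Binary.Reasoning.Setoid setoid
      a = toℕ v
      c = hi l
      d = hi e
      v≡l : toℕ v ≡ lo l
      v≡l = trans v≡ (sym lo≡)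
      c≤d : c ℕ.≤ d
      c≤d = ℕ.<⇒≤ (subst₂ ℕ._<_ (sym mid≡) hi≡ (lo<hi r))

    fan-hi : ∀ v {e b h} (t : Tree e) → toℕ v ≡ suc h → toℕ v ≡ hi e → Spans h (suc h) b →
             fan v t ≋ w (lo e) h · (wt⁻¹ b · wt⁻¹ e)
    fan-hi v {e} {b} {h} (leaf eq) v≡h v≡ sb = ≋-sym (≋-trans
      (*-congʳ (≋-trans (≡⇒≋ (cong (w (lo e)) (ℕ.suc-injective (trans (sym v≡h) (trans v≡ (sym eq))))))
        (loop pt (ℕ.<-trans (lo<hi e) (hi<n e))))) (zeroˡ _))
    fan-hi v {e} {b} {h} (node l r lo≡ mid≡ hi≡ tl tr) v≡h v≡ sb = begin
      fan v (node l r lo≡ mid≡ hi≡ tl tr)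
        ≈⟨ fan-node v tl tr
             (≡⇒≋ (share-r (∉-lo e λ eq → ℕ.<-irrefl (trans (sym eq) v≡) (lo<hi e))
                          (∉-hi l λ eq → ℕ.<-irrefl (trans (sym eq) v≡) c<d) (∈-hi e v≡)))
             (fan-outside v tl (inj₂ (subst (hi l ℕ.<_) (sym v≡) c<d)))
             (fan-hi v tr v≡h (trans v≡ (sym hi≡)) sb) ⟩
      wt l · (wt⁻¹ r · wt⁻¹ e) ⊞ (0# ⊞ w (lo r) h · (wt⁻¹ b · wt⁻¹ r))
        ≈⟨ +-cong (*-congʳ (≋-sym (w-side (lo≡ , mid≡)))) (≋-trans (+-identityˡ _) (*-congˡ (*-comm _ _))) ⟩
      w a c · (wt⁻¹ r · wt⁻¹ e) ⊞ w c h · (wt⁻¹ r · wt⁻¹ b)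
        ≈⟨ divided-ptolemy (unit (refl , hi≡)) (unit (proj₁ sb , trans (proj₂ sb) h+1≡d)) (unit (refl , refl))
             (≋-trans (*-comm _ _) (≋-trans
               (ptolemy pt a≤c (ℕ.s≤s⁻¹ (subst (c ℕ.<_) (sym h+1≡d) (subst (c ℕ.<_) hi≡ (lo<hi r))))
                 (subst (h ℕ.≤_) h+1≡d (ℕ.n≤1+n h)) (hi<n e))
               (+-congʳ (*-comm _ _)))) ⟨
      w a h · (wt⁻¹ b · wt⁻¹ e) ∎
      where
      open Relation.Binary.Reasoning.Setoid setoid
      a = lo e
      c = lo r
      d = hi e
      h+1≡d : suc h ≡ d
      h+1≡d = trans (sym v≡h) v≡
      c<d : hi l ℕ.< d
      c<d = subst₂ ℕ._<_ (sym mid≡) hi≡ (lo<hi r)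
      a≤c : a ℕ.≤ c
      a≤c = ℕ.<⇒≤ (subst₂ ℕ._<_ lo≡ mid≡ (lo<hi l))

    -- The descent stops at the triangle whose apex is `v`. There the fan consists of this triangle,
    -- the fan at the upper end of the left leg and the fan at the lower end of the right leg.
    -- Ptolemy's relation for `lo e`, `h`, `v`, `hi e` joins the first two, and that for `h`, `v`,
    -- `v + 1`, `hi e` adds the third.
    fan-inner : ∀ v {e b b′ h} (t : Tree e) → toℕ v ≡ suc h → lo e ℕ.< toℕ v → toℕ v ℕ.< hi e →
                Spans h (toℕ v) b → Spans (toℕ v) (suc (toℕ v)) b′ →
                fan v t ≋ w h (suc (toℕ v)) · (wt⁻¹ b · wt⁻¹ b′)
    fan-inner v (leaf eq) _ lo<v v<hi _ _ =
      contradiction (subst (toℕ v ℕ.<_) (sym eq) v<hi) (ℕ.≤⇒≯ lo<v)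
    fan-inner v {e} {b} {b′} {h} (node l r lo≡ mid≡ hi≡ tl tr) v≡h lo<v v<hi sb sb′ with ℕ.<-cmp (toℕ v) (hi l)
    ... | tri< v<c v≢c _ = ≋-trans
      (fan-node v tl tr
        (≡⇒≋ (share-none (∉-lo e λ eq → ℕ.<-irrefl (sym eq) lo<v) (∉-hi l v≢c) (∉-hi e λ eq → ℕ.<-irrefl eq v<hi)))
        (fan-inner v tl v≡h (subst (ℕ._< toℕ v) (sym lo≡) lo<v) v<c sb sb′)
        (fan-outside v tr (inj₁ (subst (toℕ v ℕ.<_) mid≡ v<c))))
      (≋-trans (+-identityˡ _) (+-identityʳ _))
    ... | tri> _ v≢c c<v = ≋-trans
      (fan-node v tl tr
        (≡⇒≋ (share-none (∉-lo e λ eq → ℕ.<-irrefl (sym eq) lo<v) (∉-hi l v≢c) (∉-hi e λ eq → ℕ.<-irrefl eq v<hi)))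
        (fan-outside v tl (inj₂ c<v))
        (fan-inner v tr v≡h (subst (ℕ._< toℕ v) mid≡ c<v) (subst (toℕ v ℕ.<_) (sym hi≡) v<hi) sb sb′))
      (≋-trans (+-identityˡ _) (+-identityˡ _))
    ... | tri≈ _ v≡c _ = begin
      fan v (node l r lo≡ mid≡ hi≡ tl tr)
        ≈⟨ fan-node v tl tr (≡⇒≋ (share-q (∉-lo e λ eq → ℕ.<-irrefl (sym eq) lo<v) (∈-hi l v≡c)))
             (fan-hi v tl v≡h v≡c (proj₁ sb , trans (proj₂ sb) v≡h)) (fan-lo v tr (trans v≡c mid≡) sb′) ⟩
      wt e · (wt⁻¹ l · wt⁻¹ r) ⊞ (w (lo l) h · (wt⁻¹ b · wt⁻¹ l) ⊞ w (suc c) (hi r) · (wt⁻¹ b′ · wt⁻¹ r))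
        ≈⟨ +-cong (*-congʳ (≋-sym (real e))) (+-cong
             (≋-trans (*-congʳ (≡⇒≋ (cong (λ k → w k h) lo≡))) (*-congˡ (*-comm _ _)))
             (≋-trans (*-congʳ (≡⇒≋ (cong (w (suc c)) hi≡))) (*-congˡ (*-comm _ _)))) ⟩
      w a d · (wt⁻¹ l · wt⁻¹ r) ⊞ (w a h · (wt⁻¹ l · wt⁻¹ b) ⊞ w (suc c) d · (wt⁻¹ r · wt⁻¹ b′))
        ≈⟨ rearrange _ _ _ ⟩
      w (suc c) d · (wt⁻¹ r · wt⁻¹ b′) ⊞ (w a h · (wt⁻¹ l · wt⁻¹ b) ⊞ w a d · (wt⁻¹ l · wt⁻¹ r))
        ≈⟨ +-congˡ (divided-ptolemy (unit (lo≡ , sym v≡c)) (unit sr) (unit sb)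
             (≋-trans (ptolemy pt a≤h h≤c c≤d (hi<n e)) (+-cong (*-comm _ _) (*-comm _ _)))) ⟨
      w (suc c) d · (wt⁻¹ r · wt⁻¹ b′) ⊞ w h d · (wt⁻¹ r · wt⁻¹ b)
        ≈⟨ divided-ptolemy (unit sr) (unit sb) (unit sb′)
             (≋-trans (*-comm _ _) (≋-trans (ptolemy pt h≤c (ℕ.n≤1+n c) v<hi (hi<n e)) (+-congˡ (*-comm _ _)))) ⟨
      w h (suc c) · (wt⁻¹ b · wt⁻¹ b′) ∎
      where
      open Relation.Binary.Reasoning.Setoid setoid
      a = lo e
      c = toℕ v
      d = hi e
      sr : Spans c d r
      sr = trans (sym mid≡) (sym v≡c) , hi≡
      h≤c : h ℕ.≤ c
      h≤c = subst (h ℕ.≤_) (sym v≡h) (ℕ.n≤1+n h)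
      a≤h : a ℕ.≤ h
      a≤h = ℕ.s≤s⁻¹ (subst (a ℕ.<_) v≡h lo<v)
      c≤d : c ℕ.≤ d
      c≤d = ℕ.<⇒≤ v<hi
      rearrange : ∀ p q r → p ⊞ (q ⊞ r) ≋ r ⊞ (q ⊞ p)
      rearrange p q r = ≋-trans (+-comm p _) (≋-trans (+-congʳ (+-comm q r)) (+-assoc r q p))

    -- When `next u` is the last vertex or vertex 0, it is an end of the root, and the root itself
    -- is one of its two boundary sides; `fan-hi` and `fan-lo` then replace `fan-inner`.
    fan-root : ∀ u → fan (next u) root-tree ≋
               symmetrize w u (next (next u)) · (wt⁻¹ (inj₂ u) · wt⁻¹ (inj₂ (next u)))
    fan-root u with sideView (inj₂ u) | nextView u | sideView (inj₂ (next u)) | nextView (next u)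
    ... | inner u+1<n lo≡ hi≡ | inner _ v≡ | inner v+1<n lo≡′ hi≡′ | inner _ v′≡ = ≋-trans
      (fan-inner v root-tree v≡ (subst₂ ℕ._<_ (sym (proj₁ root-spans)) (sym v≡) (s≤s z≤n))
        (subst (toℕ v ℕ.<_) (sym (proj₂ root-spans)) (ℕ.s≤s⁻¹ v+1<n)) (lo≡ , trans hi≡ (sym v≡)) (lo≡′ , hi≡′))
      (*-congʳ (≡⇒≋ (sym (trans (symmetrize-≤ w (subst (toℕ u ℕ.≤_) (sym v′≡)
        (ℕ.≤-trans (ℕ.n≤1+n _) (ℕ.≤-trans (ℕ.≤-reflexive (sym v≡)) (ℕ.n≤1+n _))))) (cong (w (toℕ u)) v′≡)))))
      where v = next u
    ... | inner u+1<n lo≡ hi≡ | inner _ v≡ | last v≡last lo≡′ hi≡′ | last _ v′≡ = ≋-trans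
      (fan-hi v root-tree v≡ (trans v≡last (sym (proj₂ root-spans))) (lo≡ , hi≡))
      (*-cong (≡⇒≋ (trans (cong (λ k → w k (toℕ u)) (trans (proj₁ root-spans) (sym v′≡)))
                (sym (symmetrize-≥ w (subst (ℕ._≤ toℕ u) (sym v′≡) z≤n)))))
              (*-congˡ (≡⇒≋ (cong wt⁻¹ (side-≡ (trans (proj₁ root-spans) (sym lo≡′)) (trans (proj₂ root-spans) (sym hi≡′)))))))
      where v = next u
    ... | last u≡ lo≡ hi≡ | last _ v≡ | inner v+1<n lo≡′ hi≡′ | inner _ v′≡ = ≋-trans
      (fan-lo v root-tree (trans v≡ (sym (proj₁ root-spans))) (lo≡′ , hi≡′))
      (*-cong (≡⇒≋ (trans (cong₂ w (sym v′≡) (trans (proj₂ root-spans) (sym u≡)))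
                (sym (symmetrize-≥ w (subst₂ ℕ._≤_ (sym (trans v′≡ (cong suc v≡))) (sym u≡) (s≤s z≤n))))))
              (≋-trans (*-comm _ _) (*-congʳ (≡⇒≋ (cong wt⁻¹
                (side-≡ (trans (proj₁ root-spans) (sym lo≡)) (trans (proj₂ root-spans) (sym hi≡))))))))
      where v = next u
    ... | inner u+1<n _ _ | last u≡ _ | _ | _ = contradiction u+1<n (ℕ.<-irrefl (cong suc u≡))
    ... | last u≡ _ _ | inner u+1<n _ | _ | _ = contradiction u+1<n (ℕ.<-irrefl (cong suc u≡))
    ... | _ | _ | inner v+1<n _ _ | last v≡ _ = contradiction v+1<n (ℕ.<-irrefl (cong suc v≡))
    ... | _ | _ | last v≡ _ _ | inner v+1<n _ = contradiction v+1<n (ℕ.<-irrefl (cong suc v≡))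
    ... | _ | last _ v≡0 | last v≡ _ _ | _ = case trans (sym v≡0) v≡ of λ ()

-- Lists without repetitions

unique-↭ : {B : Set} {xs ys : List B} → Unique xs → Unique ys →
           (∀ {b} → b ∈ xs → b ∈ ys) → (∀ {b} → b ∈ ys → b ∈ xs) → xs ↭ ys
unique-↭ u u′ f g = ∼bag⇒↭ (unique∧set⇒bag u u′ (mk⇔ f g))

All-concatMap : {B B′ : Set} {P : B′ → Set} (f : B → List B′) → (∀ b → All P (f b)) → ∀ bs → All P (List.concatMap f bs)
All-concatMap f Pf []       = []
All-concatMap f Pf (b ∷ bs) = All.++⁺ (Pf b) (All-concatMap f Pf bs)

-- The map `π` recovers from an element the index of the block containing it, so distinct indices
-- have disjoint blocks.
Unique-concatMap : {B B′ : Set} (π : B′ → B) (f : B → List B′) → (∀ b → All (λ c → π c ≡ b) (f b)) →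
                   (∀ b → Unique (f b)) → ∀ {bs} → Unique bs → Unique (List.concatMap f bs)
Unique-concatMap π f πf uf {[]}     _        = []
Unique-concatMap π f πf uf {b ∷ bs} (b∉ ∷ u) = Unique.++⁺ (uf b) (Unique-concatMap π f πf uf u) disjoint
  where
  disjoint : ∀ {c} → ¬ (c ∈ f b × c ∈ List.concatMap f bs)
  disjoint (c∈b , c∈bs) with find (∈-concatMap⁻ f {bs} c∈bs)
  ... | b′ , b′∈bs , c∈b′ =
    All.lookup b∉ b′∈bs (trans (sym (All.lookup (πf b) c∈b)) (All.lookup (πf b′) c∈b′))

∈-concatMap : {B B′ : Set} (f : B → List B′) {b : B} {c : B′} {bs : List B} → b ∈ bs → c ∈ f b → c ∈ List.concatMap f bs
∈-concatMap f b∈bs c∈b = ∈-concatMap⁺ f (lose b∈bs c∈b)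

module _ (Mon : CommutativeMonoid 0ℓ 0ℓ) where
  private module Mon = CommutativeMonoid Mon

  foldr-↭ : {B : Set} (f : B → Mon.Carrier) {xs ys : List B} → xs ↭ ys →
            List.foldr Mon._∙_ Mon.ε (map f xs) Mon.≈ List.foldr Mon._∙_ Mon.ε (map f ys)
  foldr-↭ f Perm.refl          = Mon.refl
  foldr-↭ f (Perm.prep b p)    = Mon.∙-congˡ (foldr-↭ f p)
  foldr-↭ f (Perm.trans p q)   = Mon.trans (foldr-↭ f p) (foldr-↭ f q)
  foldr-↭ f (Perm.swap b c p)  = Mon.trans (Mon.sym (Mon.assoc _ _ _)) (Mon.trans
    (Mon.∙-cong (Mon.comm _ _) (foldr-↭ f p)) (Mon.assoc _ _ _))

-- The quiddity formula

module Quiddity (m : ℕ) (C : Coefficients m) (Δ : Frieze.WeightedTriangulation m) where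

  open Frieze m hiding (wt; x; y; R; W)
  open Combinatorics m
  open Coefficients C
  open Weights m C
  open Triangulation Δ
  open Fans m C Δ

  ends : Side → Chord
  ends = endpoints Δ

  endsView : ∀ e → (toℕ (proj₁ (ends e)) ≡ lo e × toℕ (proj₂ (ends e)) ≡ hi e)
                 ⊎ (toℕ (proj₁ (ends e)) ≡ hi e × toℕ (proj₂ (ends e)) ≡ lo e)
  endsView (inj₁ k) = inj₁ (refl , refl)
  endsView (inj₂ v) with sideView (inj₂ v) | nextView v
  ... | inner _ lo≡ hi≡ | inner _ v′≡ = inj₁ (sym lo≡ , trans v′≡ (sym hi≡))
  ... | last v≡ lo≡ hi≡ | last _ v′≡  = inj₂ (trans v≡ (sym hi≡) , trans v′≡ (sym lo≡))
  ... | inner v+1<n _ _ | last v≡ _   = contradiction v+1<n (ℕ.<-irrefl (cong suc v≡))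
  ... | last v≡ _ _     | inner v+1<n _ = contradiction v+1<n (ℕ.<-irrefl (cong suc v≡))

  joins⇒spans : ∀ e {u v} → u Fin.< v → Joins Δ e u v → Spans (toℕ u) (toℕ v) e
  joins⇒spans e u<v (inj₁ refl) with endsView e
  ... | inj₁ (a , b) = sym a , sym b
  ... | inj₂ (a , b) = contradiction (subst₂ ℕ._<_ a b u<v) (ℕ.<-asym (lo<hi e))
  joins⇒spans e u<v (inj₂ refl) with endsView e
  ... | inj₁ (a , b) = contradiction (subst₂ ℕ._<_ b a u<v) (ℕ.<-asym (lo<hi e))
  ... | inj₂ (a , b) = sym b , sym a

  spans⇒joins : ∀ e {u v} → Spans (toℕ u) (toℕ v) e → Joins Δ e u v
  spans⇒joins e (lo≡ , hi≡) with endsView e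
  ... | inj₁ (a , b) = inj₁ (cong₂ _,_ (Fin.toℕ-injective (trans a lo≡)) (Fin.toℕ-injective (trans b hi≡)))
  ... | inj₂ (a , b) = inj₂ (cong₂ _,_ (Fin.toℕ-injective (trans a hi≡)) (Fin.toℕ-injective (trans b lo≡)))

  joins⇒incidentˡ : ∀ e {u v} → Joins Δ e u v → Incident Δ u e
  joins⇒incidentˡ e (inj₁ refl) = inj₁ refl
  joins⇒incidentˡ e (inj₂ refl) = inj₂ refl

  joins⇒incidentʳ : ∀ e {u v} → Joins Δ e u v → Incident Δ v e
  joins⇒incidentʳ e (inj₁ refl) = inj₂ refl
  joins⇒incidentʳ e (inj₂ refl) = inj₁ refl

  joins-incident : ∀ e {u v w} → Joins Δ e u v → Incident Δ w e → w ≡ u ⊎ w ≡ v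
  joins-incident e (inj₁ refl) inc = inc
  joins-incident e (inj₂ refl) inc = [ inj₂ , inj₁ ]′ inc

  ∈-edges : ∀ e → e ∈ edges
  ∈-edges (inj₁ k) = ∈-++⁺ˡ (∈-map⁺ inj₁ (∈-allFin k))
  ∈-edges (inj₂ v) = ∈-++⁺ʳ (map inj₁ (allFin m)) (∈-map⁺ inj₂ (∈-allFin v))

  Unique-edges : Unique edges
  Unique-edges = Unique.++⁺ (Unique.map⁺ (λ { refl → refl }) (Unique.allFin⁺ m))
    (Unique.map⁺ (λ { refl → refl }) (Unique.allFin⁺ n))
    λ (e∈ , e∈′) → case ∈-map⁻ inj₁ e∈ , ∈-map⁻ inj₂ e∈′ of λ { ((_ , _ , refl) , (_ , _ , ())) }

  ∈-edgesAt : ∀ {v} e → Incident Δ v e → e ∈ edgesAt Δ v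
  ∈-edgesAt {v} e inc = ∈-filter⁺ (incident? Δ v) (∈-edges e) inc

  edgesAt⇒incident : ∀ {v e} → e ∈ edgesAt Δ v → Incident Δ v e
  edgesAt⇒incident {v} e∈ = proj₂ (∈-filter⁻ (incident? Δ v) {xs = edges} e∈)

  Unique-edgesAt : ∀ v → Unique (edgesAt Δ v)
  Unique-edgesAt v = Unique.filter⁺ (incident? Δ v) Unique-edges

  ∏ : {B : Set} → (B → A) → List B → A
  ∏ f xs = List.foldr _·_ 1# (map f xs)

  tp tq tr : Triple Δ → Vertex
  tp (triple p q r qr pr pq) = p
  tq (triple p q r qr pr pq) = q
  tr (triple p q r qr pr pq) = r

  tqr tpr : Triple Δ → Edge
  tqr (triple p q r qr pr pq) = qr
  tpr (triple p q r qr pr pq) = pr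

  -- The nested blocks of `triples` receive names so that `Unique-concatMap` can be applied one
  -- level at a time.
  triples₅ : Vertex → Vertex → Vertex → Edge → Edge → List (Triple Δ)
  triples₅ p q r qr pr = map (triple p q r qr pr) edges
  triples₄ : Vertex → Vertex → Vertex → Edge → List (Triple Δ)
  triples₄ p q r qr = List.concatMap (triples₅ p q r qr) edges
  triples₃ : Vertex → Vertex → Vertex → List (Triple Δ)
  triples₃ p q r = List.concatMap (triples₄ p q r) edges
  triples₂ : Vertex → Vertex → List (Triple Δ)
  triples₂ p q = List.concatMap (triples₃ p q) (allFin n)
  triples₁ : Vertex → List (Triple Δ)
  triples₁ p = List.concatMap (triples₂ p) (allFin n)

  ∈-triples : ∀ T → T ∈ triples Δ
  ∈-triples (triple p q r qr pr pq) =
    ∈-concatMap triples₁ (∈-allFin p) (∈-concatMap (triples₂ p) (∈-allFin q) (∈-concatMap (triples₃ p q) (∈-allFin r)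
      (∈-concatMap (triples₄ p q r) (∈-edges qr) (∈-concatMap (triples₅ p q r qr) (∈-edges pr)
        (∈-map⁺ (triple p q r qr pr) (∈-edges pq))))))

  module _ {P : Triple Δ → Set} where
    all₅ : ∀ p q r qr pr → (∀ pq → P (triple p q r qr pr pq)) → All P (triples₅ p q r qr pr)
    all₅ p q r qr pr h = All.map⁺ (All.universal h edges)
    all₄ : ∀ p q r qr → (∀ pr pq → P (triple p q r qr pr pq)) → All P (triples₄ p q r qr)
    all₄ p q r qr h = All-concatMap (triples₅ p q r qr) (λ pr → all₅ p q r qr pr (h pr)) edges
    all₃ : ∀ p q r → (∀ qr pr pq → P (triple p q r qr pr pq)) → All P (triples₃ p q r)
    all₃ p q r h = All-concatMap (triples₄ p q r) (λ qr → all₄ p q r qr (h qr)) edges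
    all₂ : ∀ p q → (∀ r qr pr pq → P (triple p q r qr pr pq)) → All P (triples₂ p q)
    all₂ p q h = All-concatMap (triples₃ p q) (λ r → all₃ p q r (h r)) (allFin n)
    all₁ : ∀ p → (∀ q r qr pr pq → P (triple p q r qr pr pq)) → All P (triples₁ p)
    all₁ p h = All-concatMap (triples₂ p) (λ q → all₂ p q (h q)) (allFin n)

  Unique-triples : Unique (triples Δ)
  Unique-triples =
    Unique-concatMap tp triples₁ (λ p → all₁ p λ _ _ _ _ _ → refl) (λ p →
    Unique-concatMap tq (triples₂ p) (λ q → all₂ p q λ _ _ _ _ → refl) (λ q →
    Unique-concatMap tr (triples₃ p q) (λ r → all₃ p q r λ _ _ _ → refl) (λ r →
    Unique-concatMap tqr (triples₄ p q r) (λ qr → all₄ p q r qr λ _ _ → refl) (λ qr →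
    Unique-concatMap tpr (triples₅ p q r qr) (λ pr → all₅ p q r qr pr λ _ → refl) (λ pr →
    Unique.map⁺ (λ { refl → refl }) Unique-edges)
    Unique-edges) Unique-edges) (Unique.allFin⁺ n)) (Unique.allFin⁺ n)) (Unique.allFin⁺ n)

  face-isTriangle : ∀ {e l r} → lo l ≡ lo e → hi l ≡ lo r → hi r ≡ hi e → IsTriangle Δ (face e l r)
  face-isTriangle {e} {l} {r} lo≡ mid≡ hi≡ =
    ( subst₂ ℕ._<_ (trans lo≡ (sym (toℕ-loV e))) (sym (toℕ-hiV l)) (lo<hi l)
    , subst₂ ℕ._<_ (trans (sym mid≡) (sym (toℕ-hiV l))) (trans hi≡ (sym (toℕ-hiV e))) (lo<hi r)) ,
    ( spans⇒joins r (trans (sym mid≡) (sym (toℕ-hiV l)) , trans hi≡ (sym (toℕ-hiV e)))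
    , spans⇒joins e (sym (toℕ-loV e) , sym (toℕ-hiV e))
    , spans⇒joins l (trans lo≡ (sym (toℕ-loV e)) , sym (toℕ-hiV l)))

  faces-triangles : ∀ {e} (t : Tree e) {T} → T ∈ faces t → IsTriangle Δ T
  faces-triangles {e} (node l r lo≡ mid≡ hi≡ tl tr) (here refl) = face-isTriangle {e} {l} {r} lo≡ mid≡ hi≡
  faces-triangles (node l r lo≡ mid≡ hi≡ tl tr) (there T∈) =
    [ faces-triangles tl , faces-triangles tr ]′ (∈-++⁻ (faces tl) T∈)

  faces-within : ∀ {e} (t : Tree e) {T} → T ∈ faces t → lo e ℕ.≤ toℕ (tp T) × toℕ (tr T) ℕ.≤ hi e
  faces-within {e} (node l r lo≡ mid≡ hi≡ tl tr) (here refl) =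
    ℕ.≤-reflexive (sym (toℕ-loV e)) , ℕ.≤-reflexive (toℕ-hiV e)
  faces-within {e} (node l r lo≡ mid≡ hi≡ t t′) (there T∈) with ∈-++⁻ (faces t) T∈
  ... | inj₁ T∈ˡ = let ≤p , r≤ = faces-within t T∈ˡ in
        subst (ℕ._≤ _) lo≡ ≤p , ℕ.≤-trans r≤ (ℕ.<⇒≤ (subst₂ ℕ._<_ (sym mid≡) hi≡ (lo<hi r)))
  ... | inj₂ T∈ʳ = let ≤p , r≤ = faces-within t′ T∈ʳ in
        ℕ.≤-trans (ℕ.<⇒≤ (subst₂ ℕ._<_ lo≡ mid≡ (lo<hi l))) ≤p , subst (_ ℕ.≤_) hi≡ r≤

  triangle-p<r : ∀ T → IsTriangle Δ T → toℕ (tp T) ℕ.< toℕ (tr T)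
  triangle-p<r (triple _ _ _ _ _ _) ((p<q , q<r) , _) = ℕ.<-trans p<q q<r

  Unique-faces : ∀ {e} (t : Tree e) → Unique (faces t)
  Unique-faces     (leaf _) = []
  Unique-faces {e} (node l r lo≡ mid≡ hi≡ t t′) =
    All.++⁺ (All.tabulate ∉ˡ) (All.tabulate ∉ʳ) ∷ Unique.++⁺ (Unique-faces t) (Unique-faces t′) disjoint
    where
    ∉ˡ : ∀ {T} → T ∈ faces t → face e l r ≢ T
    ∉ˡ T∈ refl = ℕ.<⇒≱ (subst₂ ℕ._<_ (sym mid≡) hi≡ (lo<hi r))
      (subst (ℕ._≤ hi l) (toℕ-hiV e) (proj₂ (faces-within t T∈)))
    ∉ʳ : ∀ {T} → T ∈ faces t′ → face e l r ≢ T
    ∉ʳ T∈ refl = ℕ.<⇒≱ (subst₂ ℕ._<_ lo≡ mid≡ (lo<hi l))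
      (subst (lo r ℕ.≤_) (toℕ-loV e) (proj₁ (faces-within t′ T∈)))
    disjoint : ∀ {T} → ¬ (T ∈ faces t × T ∈ faces t′)
    disjoint {T} (T∈ , T∈′) = ℕ.<⇒≱ (triangle-p<r T (faces-triangles t T∈))
      (ℕ.≤-trans (proj₂ (faces-within t T∈)) (ℕ.≤-trans (ℕ.≤-reflexive mid≡) (proj₁ (faces-within t′ T∈′))))

  -- The widest side `pr` of the triangle lies below the left leg, lies below the right leg, or is
  -- `e`. In the last case the vertex `q` must be the apex: further left `qr` would cross the left
  -- leg, further right `pq` would cross the right leg.
  faces-complete : ∀ {e} (t : Tree e) {T} → IsTriangle Δ T → lo e ℕ.≤ toℕ (tp T) → toℕ (tr T) ℕ.≤ hi e → T ∈ faces t
  faces-complete (leaf eq) {triple p q r qr pr pq} ((p<q , q<r) , _) ≤p r≤ =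
    contradiction (ℕ.≤-trans q<r (ℕ.≤-trans r≤ (ℕ.≤-reflexive (sym eq)))) (ℕ.<⇒≱ (s≤s (ℕ.≤-<-trans ≤p p<q)))
  faces-complete {e} (node l r lo≡ mid≡ hi≡ t t′) {triple p q r′ qr pr pq} tri@((p<q , q<r) , jqr , jpr , jpq) ≤p r≤
    with joins⇒spans qr q<r jqr | joins⇒spans pr (ℕ.<-trans p<q q<r) jpr | joins⇒spans pq p<q jpq
  ... | qr-lo , qr-hi | pr-lo , pr-hi | pq-lo , pq-hi
    with locate {e} {l} {r} lo≡ mid≡ hi≡ pr (subst (lo e ℕ.≤_) (sym pr-lo) ≤p) (subst (ℕ._≤ hi e) (sym pr-hi) r≤)
  ... | left hi≤  = there (∈-++⁺ˡ (faces-complete t tri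
            (subst (ℕ._≤ toℕ p) (sym lo≡) ≤p) (subst (ℕ._≤ hi l) pr-hi hi≤)))
  ... | right ≤lo = there (∈-++⁺ʳ (faces t) (faces-complete t′ tri
            (subst (lo r ℕ.≤_) pr-lo ≤lo) (subst (toℕ r′ ℕ.≤_) (sym hi≡) r≤)))
  ... | top refl with ℕ.<-cmp (toℕ q) (hi l)
  ...   | tri< q<c _ _ = ⊥-elim (noncrossing l qr
            (subst₂ ℕ._<_ (trans (sym pr-lo) (sym lo≡)) (sym qr-lo) p<q) (subst (ℕ._< hi l) (sym qr-lo) q<c)
            (subst₂ ℕ._<_ (sym mid≡) (trans hi≡ (trans pr-hi (sym qr-hi))) (lo<hi r)))
  ...   | tri> _ _ c<q = ⊥-elim (noncrossing pq r
            (subst₂ ℕ._<_ (trans lo≡ (trans pr-lo (sym pq-lo))) mid≡ (lo<hi l))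
            (subst₂ ℕ._<_ mid≡ (sym pq-hi) c<q)
            (subst₂ ℕ._<_ (sym pq-hi) (trans (sym pr-hi) (sym hi≡)) q<r))
  ...   | tri≈ _ q≡c _ = here (faces-≡
            (Fin.toℕ-injective (trans (sym pr-lo) (sym (toℕ-loV pr))))
            (Fin.toℕ-injective (trans q≡c (sym (toℕ-hiV l))))
            (Fin.toℕ-injective (trans (sym pr-hi) (sym (toℕ-hiV pr))))
            (side-≡ (trans qr-lo (trans q≡c mid≡)) (trans qr-hi (trans (sym pr-hi) (sym hi≡))))
            (side-≡ (trans pq-lo (trans (sym pr-lo) (sym lo≡))) (trans pq-hi q≡c)))
    where
    faces-≡ : ∀ {p p′ q q′ r r′ : Vertex} {a a′ b c c′ : Edge} → p ≡ p′ → q ≡ q′ → r ≡ r′ → a ≡ a′ → c ≡ c′ →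
              triple {Δ} p q r a b c ≡ triple p′ q′ r′ a′ b c′
    faces-≡ refl refl refl refl refl = refl

  triangles↭faces : triangles Δ ↭ faces root-tree
  triangles↭faces = unique-↭ (Unique.filter⁺ (isTriangle? Δ) Unique-triples) (Unique-faces root-tree)
    (λ T∈ → faces-complete root-tree (proj₂ (∈-filter⁻ (isTriangle? Δ) {xs = triples Δ} T∈))
      (ℕ.≤-trans (ℕ.≤-reflexive (proj₁ root-spans)) z≤n)
      (ℕ.≤-trans (ℕ.s≤s⁻¹ (Fin.toℕ<n _)) (ℕ.≤-reflexive (sym (proj₂ root-spans)))))
    (λ {T} T∈ → ∈-filter⁺ (isTriangle? Δ) (∈-triples T) (faces-triangles root-tree T∈))

  outside-↭ : ∀ v T e₁ e₂ → e₁ ≢ e₂ → Incident Δ v e₁ → Incident Δ v e₂ → IsSide Δ e₁ T → IsSide Δ e₂ T →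
              (∀ e → Incident Δ v e → IsSide Δ e T → e ≡ e₁ ⊎ e ≡ e₂) →
              edgesAt Δ v ↭ e₁ ∷ e₂ ∷ edgesAtOutside Δ v T
  outside-↭ v T e₁ e₂ e₁≢e₂ inc₁ inc₂ side₁ side₂ only = unique-↭ (Unique-edgesAt v)
    ((e₁≢e₂ ∷ All.tabulate (outside≢ side₁)) ∷ All.tabulate (outside≢ side₂) ∷
      Unique.filter⁺ outside? (Unique-edgesAt v)) to from
    where
    outside? : ∀ e → Dec (¬ IsSide Δ e T)
    outside? e = ¬? (isSide? Δ e T)
    outside≢ : ∀ {e f} → IsSide Δ e T → f ∈ edgesAtOutside Δ v T → e ≢ f
    outside≢ side f∈ refl = proj₂ (∈-filter⁻ outside? {xs = edgesAt Δ v} f∈) side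
    to : ∀ {e} → e ∈ edgesAt Δ v → e ∈ e₁ ∷ e₂ ∷ edgesAtOutside Δ v T
    to {e} e∈ with isSide? Δ e T
    ... | no ¬side = there (there (∈-filter⁺ outside? e∈ ¬side))
    ... | yes side = [ here , (λ eq → there (here eq)) ]′ (only e (edgesAt⇒incident e∈) side)
    from : ∀ {e} → e ∈ e₁ ∷ e₂ ∷ edgesAtOutside Δ v T → e ∈ edgesAt Δ v
    from (here refl)         = ∈-edgesAt e₁ inc₁
    from (there (here refl)) = ∈-edgesAt e₂ inc₂
    from (there (there e∈))  = proj₁ (∈-filter⁻ outside? {xs = edgesAt Δ v} e∈)

  boundary-↭ : ∀ u → edgesAt Δ (next u) ↭ inj₂ u ∷ inj₂ (next u) ∷ map inj₁ (diagonalsAt Δ (next u))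
  boundary-↭ u = unique-↭ (Unique-edgesAt v)
    (((λ eq → next-≢ u (inj₂-injective eq)) ∷ All.map⁺ (All.universal (λ _ ()) _)) ∷ All.map⁺ (All.universal (λ _ ()) _) ∷
      Unique.map⁺ (λ { refl → refl }) (Unique.filter⁺ at? (Unique.allFin⁺ m)))
    (λ {e} e∈ → to e (edgesAt⇒incident e∈)) from
    where
    v = next u
    at? : ∀ k → Dec (Incident Δ v (inj₁ k))
    at? k = incident? Δ v (inj₁ k)
    to : ∀ e → Incident Δ v e → e ∈ inj₂ u ∷ inj₂ v ∷ map inj₁ (diagonalsAt Δ v)
    to (inj₁ k) inc         = there (there (∈-map⁺ inj₁ (∈-filter⁺ at? (∈-allFin k) inc)))
    to (inj₂ _) (inj₁ refl) = there (here refl)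
    to (inj₂ _) (inj₂ eq)   = here (cong inj₂ (sym (next-injective eq)))
    from : ∀ {e} → e ∈ inj₂ u ∷ inj₂ v ∷ map inj₁ (diagonalsAt Δ v) → e ∈ edgesAt Δ v
    from (here refl)         = ∈-edgesAt (inj₂ u) (inj₂ refl)
    from (there (here refl)) = ∈-edgesAt (inj₂ v) (inj₁ refl)
    from (there (there e∈)) with ∈-map⁻ inj₁ e∈
    ... | k , k∈ , refl = ∈-edgesAt (inj₁ k) (proj₂ (∈-filter⁻ at? {xs = allFin m} k∈))

  ∏-inverse : ∀ (ks : List (Fin m)) → ∏ wt (map inj₁ ks) · ∏ (λ k → wt⁻¹ (inj₁ k)) ks ≋ 1#
  ∏-inverse []       = *-identityˡ 1#
  ∏-inverse (k ∷ ks) = begin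
    (wt (inj₁ k) · P) · (wt⁻¹ (inj₁ k) · D)     ≈⟨ *-assoc _ _ _ ⟩
    wt (inj₁ k) · (P · (wt⁻¹ (inj₁ k) · D))
      ≈⟨ *-congˡ (≋-trans (≋-sym (*-assoc _ _ _)) (≋-trans (*-congʳ (*-comm _ _)) (*-assoc _ _ _))) ⟩
    wt (inj₁ k) · (wt⁻¹ (inj₁ k) · (P · D))     ≈⟨ *-assoc _ _ _ ⟨
    (wt (inj₁ k) · wt⁻¹ (inj₁ k)) · (P · D)     ≈⟨ *-cong (inverseʳ (inj₁ k)) (∏-inverse ks) ⟩
    1# · 1#                                     ≈⟨ *-identityˡ 1# ⟩
    1#                                          ∎
    where
    open Relation.Binary.Reasoning.Setoid setoid
    P = ∏ wt (map inj₁ ks)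
    D = ∏ (λ k → wt⁻¹ (inj₁ k)) ks

  opp-p : ∀ {v} p q r qr pr pq → v ≡ p → opp Δ v (triple p q r qr pr pq) ≡ qr
  opp-p {v} p q r qr pr pq v≡p with v Fin.≟ p
  ... | yes _ = refl
  ... | no ¬p = contradiction v≡p ¬p

  opp-q : ∀ {v} p q r qr pr pq → v ≢ p → v ≡ q → opp Δ v (triple p q r qr pr pq) ≡ pr
  opp-q {v} p q r qr pr pq v≢p v≡q with v Fin.≟ p | v Fin.≟ q
  ... | yes v≡p | _     = contradiction v≡p v≢p
  ... | no _    | yes _ = refl
  ... | no _    | no ¬q = contradiction v≡q ¬q

  opp-r : ∀ {v} p q r qr pr pq → v ≢ p → v ≢ q → opp Δ v (triple p q r qr pr pq) ≡ pq
  opp-r {v} p q r qr pr pq v≢p v≢q with v Fin.≟ p | v Fin.≟ q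
  ... | yes v≡p | _       = contradiction v≡p v≢p
  ... | no _    | yes v≡q = contradiction v≡q v≢q
  ... | no _    | no _    = refl

  dividing : Vertex → A
  dividing v = ∏ (λ k → wt⁻¹ (inj₁ k)) (diagonalsAt Δ v)

  summand : Vertex → Triple Δ → A
  summand v T = wt (opp Δ v T) · ∏ wt (edgesAtOutside Δ v T)

  -- `Q` over abstract coefficients; for the Laurent ring it unfolds to `Q Δ v`.
  quotient : Vertex → A
  quotient v = ∑ (summand v) (filter (contains? Δ v) (triangles Δ)) · dividing v

  module _ (u : Vertex) where
    private
      v = next u

    -- The product of all edge weights at `v` is read in two ways: as the two sides of `T` times the
    -- edges outside `T`, and as the two boundary sides times the diagonals. Comparison turns the
    -- product outside `T`, divided by the diagonals, into the boundary weights divided by the two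
    -- sides of `T`.
    outside-product : ∀ T e₁ e₂ → edgesAt Δ v ↭ e₁ ∷ e₂ ∷ edgesAtOutside Δ v T →
      ∏ wt (edgesAtOutside Δ v T) · dividing v ≋ (wt⁻¹ e₁ · wt⁻¹ e₂) · (wt (inj₂ u) · wt (inj₂ v))
    outside-product T e₁ e₂ perm = ≋-trans
      (*-congʳ (divideˡ (inverseʳ e₂) (divideˡ (inverseʳ e₁)
        (≋-trans (≋-sym (foldr-↭ *-commutativeMonoid wt perm)) (foldr-↭ *-commutativeMonoid wt (boundary-↭ u))))))
      (cancel-regroup _ _ _ _ (∏-inverse (diagonalsAt Δ v)))
      where open RingIdentities ring constants using (divideˡ; cancel-regroup)

    summand-share : ∀ T → IsTriangle Δ T → Contains Δ v T →
                    summand v T · dividing v ≋ share v T · (wt (inj₂ u) · wt (inj₂ v))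
    summand-share (triple p q r qr pr pq) ((p<q , q<r) , jqr , jpr , jpq) = cases
      where
      T = triple p q r qr pr pq
      p<r : p Fin.< r
      p<r = ℕ.<-trans p<q q<r
      qr-spans = joins⇒spans qr q<r jqr
      pr-spans = joins⇒spans pr p<r jpr
      pq-spans = joins⇒spans pq p<q jpq
      p≢q : p ≢ q
      p≢q refl = ℕ.<-irrefl refl p<q
      q≢r : q ≢ r
      q≢r refl = ℕ.<-irrefl refl q<r
      p≢r : p ≢ r
      p≢r refl = ℕ.<-irrefl refl p<r
      conclude : ∀ o e₁ e₂ → opp Δ v T ≡ o → share v T ≡ wt o · (wt⁻¹ e₁ · wt⁻¹ e₂) →
                 edgesAt Δ v ↭ e₁ ∷ e₂ ∷ edgesAtOutside Δ v T →
                 summand v T · dividing v ≋ share v T · (wt (inj₂ u) · wt (inj₂ v))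
      conclude o e₁ e₂ opp≡ share≡ perm = begin
        wt (opp Δ v T) · ∏ wt (edgesAtOutside Δ v T) · dividing v
          ≈⟨ *-assoc _ _ _ ⟩
        wt (opp Δ v T) · (∏ wt (edgesAtOutside Δ v T) · dividing v)
          ≈⟨ *-cong (reflexive (cong wt opp≡)) (outside-product T e₁ e₂ perm) ⟩
        wt o · ((wt⁻¹ e₁ · wt⁻¹ e₂) · (wt (inj₂ u) · wt (inj₂ v)))
          ≈⟨ *-assoc _ _ _ ⟨
        (wt o · (wt⁻¹ e₁ · wt⁻¹ e₂)) · (wt (inj₂ u) · wt (inj₂ v))
          ≈⟨ *-congʳ (reflexive share≡) ⟨
        share v T · (wt (inj₂ u) · wt (inj₂ v)) ∎
        where open Relation.Binary.Reasoning.Setoid setoid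
      cases : Contains Δ v T → summand v T · dividing v ≋ share v T · (wt (inj₂ u) · wt (inj₂ v))
      cases (inj₁ v≡p) = conclude qr pq pr (opp-p p q r qr pr pq v≡p) (share-p v≡p)
        (outside-↭ v T pq pr (λ { refl → q≢r (Fin.toℕ-injective (trans (sym (proj₂ pq-spans)) (proj₂ pr-spans))) })
          (subst (λ v → Incident Δ v pq) (sym v≡p) (joins⇒incidentˡ pq jpq))
          (subst (λ v → Incident Δ v pr) (sym v≡p) (joins⇒incidentˡ pr jpr)) (inj₂ (inj₂ refl)) (inj₂ (inj₁ refl))
          λ { e inc (inj₁ refl) → ⊥-elim ([ (λ v≡q → p≢q (trans (sym v≡p) v≡q)) , (λ v≡r → p≢r (trans (sym v≡p) v≡r)) ]′
                (joins-incident qr jqr inc))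
            ; e inc (inj₂ (inj₁ eq)) → inj₂ eq ; e inc (inj₂ (inj₂ eq)) → inj₁ eq })
      cases (inj₂ (inj₁ v≡q)) = conclude pr pq qr (opp-q p q r qr pr pq v≢p v≡q) (share-q v≢p v≡q)
        (outside-↭ v T pq qr (λ { refl → p≢q (Fin.toℕ-injective (trans (sym (proj₁ pq-spans)) (proj₁ qr-spans))) })
          (subst (λ v → Incident Δ v pq) (sym v≡q) (joins⇒incidentʳ pq jpq))
          (subst (λ v → Incident Δ v qr) (sym v≡q) (joins⇒incidentˡ qr jqr)) (inj₂ (inj₂ refl)) (inj₁ refl)
          λ { e inc (inj₁ eq) → inj₂ eq
            ; e inc (inj₂ (inj₁ refl)) → ⊥-elim ([ v≢p , (λ v≡r → q≢r (trans (sym v≡q) v≡r)) ]′ (joins-incident pr jpr inc))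
            ; e inc (inj₂ (inj₂ eq)) → inj₁ eq })
        where
        v≢p : v ≢ p
        v≢p v≡p = p≢q (trans (sym v≡p) v≡q)
      cases (inj₂ (inj₂ v≡r)) = conclude pq qr pr (opp-r p q r qr pr pq v≢p v≢q) (share-r v≢p v≢q v≡r)
        (outside-↭ v T qr pr (λ { refl → p≢q (Fin.toℕ-injective (trans (sym (proj₁ pr-spans)) (proj₁ qr-spans))) })
          (subst (λ v → Incident Δ v qr) (sym v≡r) (joins⇒incidentʳ qr jqr))
          (subst (λ v → Incident Δ v pr) (sym v≡r) (joins⇒incidentʳ pr jpr)) (inj₁ refl) (inj₂ (inj₁ refl))
          λ { e inc (inj₁ eq) → inj₁ eq ; e inc (inj₂ (inj₁ eq)) → inj₂ eq
            ; e inc (inj₂ (inj₂ refl)) → ⊥-elim ([ v≢p , v≢q ]′ (joins-incident pq jpq inc)) })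
        where
        v≢p : v ≢ p
        v≢p v≡p = p≢r (trans (sym v≡p) v≡r)
        v≢q : v ≢ q
        v≢q v≡q = q≢r (trans (sym v≡q) v≡r)

    -- Triangles away from v have share 0, so the filter may be dropped.
    sum-shares : ∀ Ts → All (IsTriangle Δ) Ts →
      ∑ (summand v) (filter (contains? Δ v) Ts) · dividing v ≋ ∑ (share v) Ts · (wt (inj₂ u) · wt (inj₂ v))
    sum-shares []       []           = ≋-trans (zeroˡ _) (≋-sym (zeroˡ _))
    sum-shares (T ∷ Ts) (tri ∷ tris) = step′ (contains? Δ v T)
      where
      open Relation.Binary.Reasoning.Setoid setoid
      selected : List (Triple Δ) → List (Triple Δ)
      selected = filter (contains? Δ v)
      UV = wt (inj₂ u) · wt (inj₂ v)
      none : ∀ T → ¬ Contains Δ v T → share v T ≋ 0#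
      none (triple p q r qr pr pq) v∉ = reflexive (share-none (v∉ ∘ inj₁) (v∉ ∘ inj₂ ∘ inj₁) (v∉ ∘ inj₂ ∘ inj₂))
      step′ : Dec (Contains Δ v T) → ∑ (summand v) (selected (T ∷ Ts)) · dividing v ≋ ∑ (share v) (T ∷ Ts) · UV
      step′ (yes v∈T) = begin
        ∑ (summand v) (selected (T ∷ Ts)) · dividing v
          ≈⟨ *-congʳ (reflexive (cong (∑ (summand v)) (List.filter-accept (contains? Δ v) v∈T))) ⟩
        (summand v T ⊞ ∑ (summand v) (selected Ts)) · dividing v
          ≈⟨ distribʳ _ _ _ ⟩
        summand v T · dividing v ⊞ ∑ (summand v) (selected Ts) · dividing v
          ≈⟨ +-cong (summand-share T tri v∈T) (sum-shares Ts tris) ⟩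
        share v T · UV ⊞ ∑ (share v) Ts · UV
          ≈⟨ distribʳ _ _ _ ⟨
        (share v T ⊞ ∑ (share v) Ts) · UV ∎
      step′ (no v∉T) = begin
        ∑ (summand v) (selected (T ∷ Ts)) · dividing v
          ≈⟨ *-congʳ (reflexive (cong (∑ (summand v)) (List.filter-reject (contains? Δ v) v∉T))) ⟩
        ∑ (summand v) (selected Ts) · dividing v
          ≈⟨ sum-shares Ts tris ⟩
        ∑ (share v) Ts · UV
          ≈⟨ *-congʳ (≋-trans (+-congʳ (none T v∉T)) (+-identityˡ _)) ⟨
        (share v T ⊞ ∑ (share v) Ts) · UV ∎

    quiddity : {w : ℕ → ℕ → A} → Ptolemaic w → Realizes w → quotient v ≋ symmetrize w u (next v)
    quiddity {w} pt real = begin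
      ∑ (summand v) (filter (contains? Δ v) (triangles Δ)) · dividing v
        ≈⟨ sum-shares (triangles Δ) (All.tabulate λ T∈ → proj₂ (∈-filter⁻ (isTriangle? Δ) {xs = triples Δ} T∈)) ⟩
      ∑ (share v) (triangles Δ) · (U · V)
        ≈⟨ *-congʳ (≋-trans (foldr-↭ +-commutativeMonoid (share v) triangles↭faces) (fan-root pt real u)) ⟩
      (symmetrize w u (next v) · (U⁻¹ · V⁻¹)) · (U · V)
        ≈⟨ ≋-trans (*-assoc _ _ _) (*-congˡ (≋-trans (*-assoc _ _ _)
             (*-congˡ (≋-trans (*-congˡ (*-comm U V)) (≋-sym (*-assoc _ _ _)))))) ⟩
      symmetrize w u (next v) · (U⁻¹ · ((V⁻¹ · V) · U))
        ≈⟨ *-congˡ (*-congˡ (≋-trans (*-congʳ (≋-trans (*-comm _ _) (inverseʳ (inj₂ v)))) (*-identityˡ U))) ⟩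
      symmetrize w u (next v) · (U⁻¹ · U)
        ≈⟨ *-congˡ (≋-trans (*-comm _ _) (inverseʳ (inj₂ u))) ⟩
      symmetrize w u (next v) · 1#
        ≈⟨ *-identityʳ _ ⟩
      symmetrize w u (next v) ∎
      where
      open Relation.Binary.Reasoning.Setoid setoid
      U = wt (inj₂ u)
      V = wt (inj₂ v)
      U⁻¹ = wt⁻¹ (inj₂ u)
      V⁻¹ = wt⁻¹ (inj₂ v)

-- Triangulations and normalized friezes

module Correspondence (m : ℕ) where

  open Frieze m
  open Combinatorics m
  open VertexArithmetic m
  open Weights m (laurent m)
  open FriezeWeights m (laurent m) using (IsFrieze)
  open FriezeReduction m (laurent m)
  open WeightedTriangulation using (isDiagonal)
  open NormalizedPositiveFrieze using (isDecoratedFrieze; isPositiveLaurent; isNormalized)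

  interior-diagonal : ∀ {i j} → Interior i j →
                      IsDiagonal (vertex i , vertex j) ⊎ IsDiagonal (vertex j , vertex i)
  interior-diagonal {i} {j} int with gap-offset {2} {1 ℕ.+ m} {i} {j} int
  ... | suc d , s≤s 1≤d , 1+d≤1+m , refl = sorted (ℕ.<-cmp (toℕ u) (toℕ v))
    where
    u = vertex i
    v = vertex (i + + suc d)
    u≢v : u ≢ v
    u≢v = offset-distinct i (s≤s z≤n) (s≤s (ℕ.≤-trans 1+d≤1+m (ℕ.n≤1+n _)))
    v≢next-u : v ≢ next u
    v≢next-u eq = offset-distinct (i + + 1) 1≤d (ℕ.<-trans 1+d≤1+m (s≤s (ℕ.n≤1+n _)))
      (trans (vertex-next i) (trans (sym eq) (cong vertex (sym (ℤ.+-assoc i (+ 1) (+ d))))))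
    u≢next-v : u ≢ next v
    u≢next-v eq = offset-distinct i {2 ℕ.+ d} (s≤s z≤n) (s≤s (s≤s 1+d≤1+m))
      (trans eq (trans (sym (vertex-next (i + + suc d))) (cong vertex (trans (ℤ.+-assoc i (+ suc d) (+ 1))
        (cong (λ k → i + + k) (ℕ.+-comm (suc d) 1))))))
    sorted : Tri (toℕ u ℕ.< toℕ v) (toℕ u ≡ toℕ v) (toℕ v ℕ.< toℕ u) → IsDiagonal (u , v) ⊎ IsDiagonal (v , u)
    sorted (tri< u<v _ _) = inj₁ (u<v , v≢next-u , u≢next-v)
    sorted (tri≈ _ u≡v _) = contradiction (Fin.toℕ-injective u≡v) u≢v
    sorted (tri> _ _ v<u) = inj₂ (v<u , u≢next-v , v≢next-u)

  diagonal-interior : ∀ {u v} → IsDiagonal (u , v) → Interior (+ toℕ u) (+ toℕ v)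
  diagonal-interior {u} {v} isD@(u<v , _) = subst (λ k → Interior (+ toℕ u) (+ k)) u+d≡v
    (offset-gap (+ toℕ u) (ℕ.+-cancelˡ-≤ (toℕ u) 2 d 2+u≤) (ℕ.≤-pred (ℕ.≤∧≢⇒< d≤2+m d≢2+m)))
    where
    d = toℕ v ∸ toℕ u
    u+d≡v : toℕ u ℕ.+ d ≡ toℕ v
    u+d≡v = ℕ.m+[n∸m]≡n (ℕ.<⇒≤ u<v)
    2+u≤ : toℕ u ℕ.+ 2 ℕ.≤ toℕ u ℕ.+ d
    2+u≤ = subst₂ ℕ._≤_ (ℕ.+-comm 2 (toℕ u)) (sym u+d≡v) (diagonal-gap isD)
    d≤2+m : d ℕ.≤ 2 ℕ.+ m
    d≤2+m = ℕ.≤-trans (ℕ.m∸n≤m (toℕ v) (toℕ u)) (ℕ.s≤s⁻¹ (Fin.toℕ<n v))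
    d≢2+m : d ≢ 2 ℕ.+ m
    d≢2+m eq = diagonal-proper isD u≡0 (trans (sym u+d≡v) (trans (cong (ℕ._+ d) u≡0) eq))
      where
      u≡0 : toℕ u ≡ 0
      u≡0 = ℕ.n≤0⇒n≡0 (ℕ.+-cancelʳ-≤ d (toℕ u) 0 (subst₂ ℕ._≤_ (sym u+d≡v) (sym eq) (ℕ.s≤s⁻¹ (Fin.toℕ<n v))))

  x-injective : ∀ {k l} → x k ≈ x l → k ≡ l
  x-injective eq = Fin.↑ˡ-injective n _ _ (var-injective eq)

  IsMonomial-≈x : ∀ {p} k → p ≈ x k → IsMonomial p
  IsMonomial-≈x k p≈x = (replicate _ 0ℤ [ k ↑ˡ n ]≔ 1ℤ) , p≈x

  chord : (ℕ → ℕ → R) → Chord → R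
  chord w c = w (toℕ (proj₁ c)) (toℕ (proj₂ c))

  crossing-not-monomial : ∀ {w} → Ptolemaic w → (∀ {i j} → i ℕ.< j → j ℕ.< n → Positive (w i j)) →
    ∀ c d → Crosses c d → IsMonomial (chord w c) → ¬ IsMonomial (chord w d)
  crossing-not-monomial {w} pt pos = cross
    where
    open Coefficients (laurent m) using (_·_; _⊞_)
    interlaced : ∀ {i j k l} → i ℕ.< j → j ℕ.< k → k ℕ.< l → l ℕ.< n → IsMonomial (w i k) → ¬ IsMonomial (w j l)
    interlaced {i} {j} {k} {l} i<j j<k k<l l<n (α , ik≈) (β , jl≈) = Positive-+-not-monomial
      (Positive-* (pos i<j (ℕ.<-trans j<k k<n)) (pos k<l l<n))
      (Positive-* (pos (ℕ.<-trans i<j (ℕ.<-trans j<k k<l)) l<n) (pos j<k k<n))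
      (≈-trans (≈-sym (ptolemy pt (ℕ.<⇒≤ i<j) (ℕ.<⇒≤ j<k) (ℕ.<⇒≤ k<l) l<n)) (*ᴸ-cong ik≈ jl≈))
      where k<n = ℕ.<-trans k<l l<n
    cross : ∀ c d → Crosses c d → IsMonomial (chord w c) → ¬ IsMonomial (chord w d)
    cross (a , b) (c , d) (inj₁ (a<c , c<b , b<d)) ab cd = interlaced a<c c<b b<d (Fin.toℕ<n d) ab cd
    cross (a , b) (c , d) (inj₂ (c<a , a<d , d<b)) ab cd = interlaced c<a a<d d<b (Fin.toℕ<n b) cd ab

  toIsFrieze : (F : NormalizedPositiveFrieze) → IsFrieze (W F)
  toIsFrieze F = record { D1ˡ = D1ˡ ; D1ʳ = D1ʳ ; D2ˡ = D2ˡ ; D2ʳ = D2ʳ ; D3 = D3 ; D4 = D4 }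
    where open IsDecoratedFrieze (isDecoratedFrieze F)

  module OfFrieze (F : NormalizedPositiveFrieze) where
    open FromFrieze (toIsFrieze F) public

    -- `IsPositiveLaurent` speaks of nonzero entries only, so non-vanishing has to be supplied
    -- first; it comes from the boundary values and `D3`.
    positive-chords : ∀ {i j} → i ℕ.< j → j ℕ.< n → Positive (w i j)
    positive-chords {i} {j} i<j j<n = subst (λ k → Positive (w i k)) (ℕ.m+[n∸m]≡n (ℕ.<⇒≤ i<j))
      (≉0⇒Positive (isPositiveLaurent F (+ i) (+ i + + d) (offset-gap (+ i) z≤n (ℕ.<⇒≤ d<n)) nonzero) nonzero)
      where
      d = j ∸ i
      d<n : d ℕ.< n
      d<n = ℕ.≤-<-trans (ℕ.m∸n≤m j i) j<n
      nonzero : ¬ W F (+ i) (+ i + + d) ≈ 0ᴸ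
      nonzero = entry≉0 (+ i) d (ℕ.m<n⇒0<n∸m i<j) d<n

    reduce-gap : ∀ {i j} → Gap 0 n i j → W F i j ≈ symmetrize w (vertex i) (vertex j)
    reduce-gap {i} {j} gap with gap-offset {0} {n} {i} {j} gap
    ... | d , _ , d≤n , refl = reduce i d≤n

  module OfTriangulation (Δ : WeightedTriangulation) where
    open Triangulation Δ public
    open Quiddity m (laurent m) Δ using (endsView; spans⇒joins; quiddity)

    w : ℕ → ℕ → R
    w = proj₁ weights

    pt : Ptolemaic w
    pt = proj₁ (proj₂ weights)

    real : Realizes w
    real = proj₂ (proj₂ weights)

    open FromWeights pt (chords-positive pt real) public

    monomial⇒diagonal : ∀ c → IsDiagonal c → IsMonomial (chord w c) →
                        ∃ λ k → diagonal Δ k ≡ c × chord w c ≈ x k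
    monomial⇒diagonal c isD mono = found (maximal c isD λ k crosses →
        crossing-not-monomial pt (chords-positive pt real) c (diagonal Δ k) crosses mono (IsMonomial-≈x k (real (inj₁ k))))
      where
      found : (∃ λ k → diagonal Δ k ≡ c) → ∃ λ k → diagonal Δ k ≡ c × chord w c ≈ x k
      found (k , eq) = k , eq , subst (λ c → chord w c ≈ x k) eq (real (inj₁ k))

    frieze : NormalizedPositiveFrieze
    frieze = record
      { W = entry
      ; isDecoratedFrieze = record
        { D1ˡ = D1ˡ ; D1ʳ = D1ʳ ; D2ˡ = D2ˡ ; D2ʳ = D2ʳ ; D3 = D3 ; D4 = D4 }
      ; isPositiveLaurent = λ i j _ ≉0 → nonNegative (s-pos λ eq →
          ≉0 (subst (λ v → s (vertex i) v ≈ 0ᴸ) eq (s-diag (vertex i))))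
      ; isNormalized = record
        { N1 = λ i j int mono → N1 {i} {j} mono (interior-diagonal {i} {j} int)
        ; N2 = λ k → + lo (inj₁ k) , + hi (inj₁ k) , diagonal-interior (isDiagonal Δ k) ,
            subst₂ (λ u v → s u v ≈ x k) (sym (vertex-+ _)) (sym (vertex-+ _))
              (≈-trans (≡⇒≋ (symmetrize-≤ w (ℕ.<⇒≤ (proj₁ (isDiagonal Δ k))))) (real (inj₁ k))) } }
      where
      open IsFrieze isFrieze
      N1 : ∀ {i j} → IsMonomial (entry i j) →
           IsDiagonal (vertex i , vertex j) ⊎ IsDiagonal (vertex j , vertex i) → ∃ λ k → entry i j ≈ x k
      N1 (α , ≈α) (inj₁ isD) =
        let eq = ≡⇒≋ (symmetrize-≤ w (ℕ.<⇒≤ (proj₁ isD)))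
            k , _ , ≈x = monomial⇒diagonal _ isD (α , ≈-trans (≈-sym eq) ≈α)
        in k , ≈-trans eq ≈x
      N1 (α , ≈α) (inj₂ isD) =
        let eq = ≡⇒≋ (symmetrize-≥ w (ℕ.<⇒≤ (proj₁ isD)))
            k , _ , ≈x = monomial⇒diagonal _ isD (α , ≈-trans (≈-sym eq) ≈α)
        in k , ≈-trans eq ≈x

    extends : Extends Δ frieze
    extends i j _ _ _ e joins = lemma joins
      where
      side : symmetrize w (proj₁ (endpoints Δ e)) (proj₂ (endpoints Δ e)) ≈ wt e
      side with endsView e
      ... | inj₁ (a , b) = ≈-trans (≡⇒≋
            (trans (symmetrize-≤ w (subst₂ ℕ._≤_ (sym a) (sym b) (ℕ.<⇒≤ (lo<hi e)))) (cong₂ w a b))) (real e)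
      ... | inj₂ (a , b) = ≈-trans (≡⇒≋
            (trans (symmetrize-≥ w (subst₂ ℕ._≤_ (sym b) (sym a) (ℕ.<⇒≤ (lo<hi e)))) (cong₂ w b a))) (real e)
      lemma : ∀ {u v} → Joins Δ e u v → s u v ≈ wt e
      lemma         (inj₁ refl) = side
      lemma {u} {v} (inj₂ refl) = ≈-trans (≡⇒≋ (symmetrize-sym w u v)) side

    -- `Extends` ranges over the subscripts 1, ..., n, whereas intervals use the vertices 0, ..., n
    -- - 1. An edge at vertex 0 is therefore prescribed in column n, and the glide carries its
    -- weight to row 0.
    extends⇒realizes : ∀ F → Extends Δ F → Realizes (OfFrieze.w F)
    extends⇒realizes F ext e = [ inside , at-0 ]′ (ℕ.m≤n⇒m<n∨m≡n z≤n)
      where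
      lo<n : lo e ℕ.< n
      lo<n = ℕ.<-trans (lo<hi e) (hi<n e)
      toℕ-vertex : ∀ {a} → a ℕ.< n → toℕ (vertex (+ a)) ≡ a
      toℕ-vertex {a} a<n = vertex-unique {+ a} 0ℤ a<n (sym (ℤ.+-identityʳ (+ a)))
      inside : 0 ℕ.< lo e → W F (+ lo e) (+ hi e) ≈ wt e
      inside 0<lo = ext (+ lo e) (+ hi e) (ℤ.+≤+ 0<lo) (ℤ.+<+ (lo<hi e)) (ℤ.+≤+ (ℕ.<⇒≤ (hi<n e))) e
        (spans⇒joins e (sym (toℕ-vertex lo<n) , sym (toℕ-vertex (hi<n e))))
      at-0 : 0 ≡ lo e → W F (+ lo e) (+ hi e) ≈ wt e
      at-0 0≡lo = subst (λ a → W F (+ a) (+ hi e) ≈ wt e) 0≡lo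
        (≈-trans (≈-sym (OfFrieze.glide F 0ℤ (ℕ.<⇒≤ (hi<n e))))
          (ext (+ hi e) (+ n) (ℤ.+≤+ (subst (ℕ._< hi e) (sym 0≡lo) (lo<hi e))) (ℤ.+<+ (hi<n e)) ℤ.≤-refl e
            ([ inj₂ , inj₁ ]′ (spans⇒joins e
              ( trans (sym 0≡lo) (sym (trans (cong toℕ (vertex-period 0ℤ)) (toℕ-vertex (s≤s z≤n))))
              , sym (toℕ-vertex (hi<n e)))))))

    realizes⇒≈ : ∀ F → Realizes (OfFrieze.w F) → frieze ≈F F
    realizes⇒≈ F realF i j gap = ≈-trans (same (ℕ.<-cmp (toℕ u) (toℕ v))) (≈-sym (OfFrieze.reduce-gap F {i} {j} gap))
      where
      u = vertex i
      v = vertex j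
      wF = OfFrieze.w F
      ptF = OfFrieze.ptolemaic F
      same : Tri (toℕ u ℕ.< toℕ v) (toℕ u ≡ toℕ v) (toℕ v ℕ.< toℕ u) → s u v ≈ symmetrize wF u v
      same (tri< u<v _ _) = ≈-trans (≡⇒≋ (symmetrize-≤ w (ℕ.<⇒≤ u<v)))
        (≈-trans (chords-unique pt real ptF realF u<v (Fin.toℕ<n v)) (≡⇒≋ (sym (symmetrize-≤ wF (ℕ.<⇒≤ u<v)))))
      same (tri> _ _ v<u) = ≈-trans (≡⇒≋ (symmetrize-≥ w (ℕ.<⇒≤ v<u)))
        (≈-trans (chords-unique pt real ptF realF v<u (Fin.toℕ<n u)) (≡⇒≋ (sym (symmetrize-≥ wF (ℕ.<⇒≤ v<u)))))
      same (tri≈ _ u≡v _) = subst (λ v → s u v ≈ symmetrize wF u v) (Fin.toℕ-injective u≡v)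
        (≈-trans (s-diag u) (≈-sym (≈-trans (≡⇒≋ (symmetrize-≤ wF {u} {u} ℕ.≤-refl)) (loop ptF (Fin.toℕ<n u)))))

    chord-weight : ∀ {u v} → toℕ u ℕ.< toℕ v → W frieze (+ toℕ u) (+ toℕ v) ≈ w (toℕ u) (toℕ v)
    chord-weight {u} {v} u<v = ≡⇒≋ (trans (cong₂ s (vertex-+ u) (vertex-+ v)) (symmetrize-≤ w (ℕ.<⇒≤ u<v)))

    quiddity-entry : ∀ i → W frieze i (i + + 2) ≈ Q Δ (vertex (i + + 1))
    quiddity-entry i = subst₂ (λ v v′ → s (vertex i) v′ ≈ Q Δ v) (sym (vertex-next i))
      (sym (trans (cong vertex (sym (ℤ.+-assoc i (+ 1) (+ 1)))) (trans (vertex-next (i + + 1)) (cong next (vertex-next i)))))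
      (≈-sym (quiddity (vertex i) pt real))

  open OfTriangulation using (frieze)

  -- Equal diagonals do not make the constructions coincide, since the trees are built from the
  -- witnesses of `maximal`. Instead, the frieze of `Δ′` has the edge weights that `Δ` prescribes,
  -- and uniqueness applies.
  frieze-cong : ∀ {Δ Δ′} → Δ ≈T Δ′ → frieze Δ ≈F frieze Δ′
  frieze-cong {Δ} {Δ′} Δ≈Δ′ = OfTriangulation.realizes⇒≈ Δ (frieze Δ′) λ
    { (inj₁ k) → subst (λ c → W (frieze Δ′) (+ toℕ (proj₁ c)) (+ toℕ (proj₂ c)) ≈ x k) (sym (Δ≈Δ′ k))
        (real′ (inj₁ k))
    ; (inj₂ v) → real′ (inj₂ v) }
    where
    real′ = OfTriangulation.extends⇒realizes Δ′ (frieze Δ′) (OfTriangulation.extends Δ′)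

  -- The chord labelled `k` in `Δ` has the monomial weight `x k` in both friezes, so it is a
  -- diagonal of `Δ′` as well; its label there is again `k`, because distinct variables are distinct
  -- elements of the ring.
  frieze-injective : ∀ {Δ Δ′} → frieze Δ ≈F frieze Δ′ → Δ ≈T Δ′
  frieze-injective {Δ} {Δ′} eq k = recover (T′.monomial⇒diagonal (diagonal Δ k) isD (IsMonomial-≈x k chord′≈x))
    where
    module T  = OfTriangulation Δ
    module T′ = OfTriangulation Δ′
    isD = isDiagonal Δ k
    u = proj₁ (diagonal Δ k)
    v = proj₂ (diagonal Δ k)
    gap : Gap 0 n (+ toℕ u) (+ toℕ v)
    gap = let 2≤ , ≤n = diagonal-interior isD in
          ℤ.≤-trans (ℤ.+≤+ z≤n) 2≤ , ℤ.≤-trans ≤n (ℤ.+≤+ (ℕ.≤-trans (ℕ.n≤1+n _) (ℕ.n≤1+n _)))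
    chord′≈x : T′.w (toℕ u) (toℕ v) ≈ x k
    chord′≈x = ≈-trans (≈-sym (T′.chord-weight (proj₁ isD)))
      (≈-trans (≈-sym (eq (+ toℕ u) (+ toℕ v) gap)) (≈-trans (T.chord-weight (proj₁ isD)) (T.real (inj₁ k))))
    recover : (∃ λ l → diagonal Δ′ l ≡ diagonal Δ k × T′.w (toℕ u) (toℕ v) ≈ x l) → diagonal Δ k ≡ diagonal Δ′ k
    recover (l , same , ≈x) = trans (sym same)
      (cong (diagonal Δ′) (x-injective {l} {k} (≈-trans (≈-sym ≈x) chord′≈x)))

  module Recover (F : NormalizedPositiveFrieze) where
    open OfFrieze F

    located : ∀ k → Σ[ c ∈ Chord ] (IsDiagonal c × chord w c ≈ x k)
    located k with IsNormalized.N2 (isNormalized F) k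
    ... | i , j , int , ≈x = place (interior-diagonal {i} {j} int)
      where
      entry≈x : symmetrize w (vertex i) (vertex j) ≈ x k
      entry≈x = ≈-trans (≈-sym (reduce-gap {i} {j}
        (ℤ.≤-trans (ℤ.+≤+ z≤n) (proj₁ int) , ℤ.≤-trans (proj₂ int) (ℤ.+≤+ (ℕ.≤-trans (ℕ.n≤1+n _) (ℕ.n≤1+n _)))))) ≈x
      place : IsDiagonal (vertex i , vertex j) ⊎ IsDiagonal (vertex j , vertex i) →
              Σ[ c ∈ Chord ] (IsDiagonal c × chord w c ≈ x k)
      place (inj₁ isD) = _ , isD , ≈-trans (≡⇒≋ (sym (symmetrize-≤ w (ℕ.<⇒≤ (proj₁ isD))))) entry≈x
      place (inj₂ isD) = _ , isD , ≈-trans (≡⇒≋ (sym (symmetrize-≥ w (ℕ.<⇒≤ (proj₁ isD))))) entry≈x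

    D : Fin m → Chord
    D k = proj₁ (located k)

    D-isDiagonal : ∀ k → IsDiagonal (D k)
    D-isDiagonal k = proj₁ (proj₂ (located k))

    D-weight : ∀ k → chord w (D k) ≈ x k
    D-weight k = proj₂ (proj₂ (located k))

    D-injective : ∀ {k l} → D k ≡ D l → k ≡ l
    D-injective {k} {l} eq = x-injective {k} {l} (≈-trans (≈-sym (D-weight k))
      (subst (λ c → chord w c ≈ x l) (sym eq) (D-weight l)))

    D-nonCrossing : ∀ k l → ¬ Crosses (D k) (D l)
    D-nonCrossing k l crosses =
      crossing-not-monomial ptolemaic positive-chords (D k) (D l) crosses
        (IsMonomial-≈x k (D-weight k)) (IsMonomial-≈x l (D-weight l))

    -- A further non-crossing diagonal `c` would enlarge the family to `suc m` distinct diagonals,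
    -- which `diagonals-bounded` excludes.
    D-maximal : ∀ c → IsDiagonal c → (∀ k → ¬ Crosses c (D k)) → ∃ λ k → D k ≡ c
    D-maximal c isD noCross with Fin.any? (λ k → Product.≡-dec Fin._≟_ Fin._≟_ (D k) c)
    ... | yes found = found
    ... | no  ¬found = contradiction (λ {k} {l} → D⁺-injective k l) (diagonals-bounded D⁺ D⁺-isDiagonal D⁺-nonCrossing)
      where
      D⁺ : Fin (suc m) → Chord
      D⁺ zero    = c
      D⁺ (suc k) = D k
      D⁺-isDiagonal : ∀ k → IsDiagonal (D⁺ k)
      D⁺-isDiagonal zero    = isD
      D⁺-isDiagonal (suc k) = D-isDiagonal k
      D⁺-nonCrossing : ∀ k l → ¬ Crosses (D⁺ k) (D⁺ l)
      D⁺-nonCrossing zero    zero    (inj₁ (a<a , _)) = ℕ.<-irrefl refl a<a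
      D⁺-nonCrossing zero    zero    (inj₂ (a<a , _)) = ℕ.<-irrefl refl a<a
      D⁺-nonCrossing zero    (suc l) crosses          = noCross l crosses
      D⁺-nonCrossing (suc k) zero    crosses          = noCross k ([ inj₂ , inj₁ ]′ crosses)
      D⁺-nonCrossing (suc k) (suc l) crosses          = D-nonCrossing k l crosses
      D⁺-injective : ∀ k l → D⁺ k ≡ D⁺ l → k ≡ l
      D⁺-injective zero    zero    _  = refl
      D⁺-injective zero    (suc l) eq = contradiction (l , sym eq) ¬found
      D⁺-injective (suc k) zero    eq = contradiction (k , eq) ¬found
      D⁺-injective (suc k) (suc l) eq = cong suc (D-injective eq)

    triangulation : WeightedTriangulation
    triangulation = record
      { diagonal = D ; isDiagonal = D-isDiagonal ; distinct = D-injective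
      ; nonCrossing = D-nonCrossing ; maximal = D-maximal }

    recovers : frieze triangulation ≈F F
    recovers = OfTriangulation.realizes⇒≈ triangulation F λ { (inj₁ k) → D-weight k ; (inj₂ v) → boundary ptolemaic v }

theorem1p2 :
    (m : ℕ) →
    let open Frieze m in
    Σ[ unique ∈ (∀ Δ → ∃! _≈F_ (Extends Δ)) ]
      (let
         frieze : WeightedTriangulation → NormalizedPositiveFrieze
         frieze Δ = proj₁ (unique Δ)
       in
       IsBijection _≈T_ _≈F_ frieze ×
       (∀ Δ (i : ℤ) → W (frieze Δ) i (i + + 2) ≈ Q Δ (vertex (i + + 1))))
theorem1p2 m = unique , bijection , λ Δ → OfTriangulation.quiddity-entry Δ
  where
  open Frieze m
  open Correspondence m
  unique : ∀ Δ → ∃! _≈F_ (Extends Δ)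
  unique Δ = OfTriangulation.frieze Δ , OfTriangulation.extends Δ ,
    λ {F} ext → OfTriangulation.realizes⇒≈ Δ F (OfTriangulation.extends⇒realizes Δ F ext)
  ≈F-trans : ∀ {F G H} → F ≈F G → G ≈F H → F ≈F H
  ≈F-trans p q i j gap = ≈-trans (p i j gap) (q i j gap)
  bijection : IsBijection _≈T_ _≈F_ (λ Δ → OfTriangulation.frieze Δ)
  bijection = record
    { isInjection = record
      { isCongruent = record
        { cong = λ {Δ} {Δ′} → frieze-cong {Δ} {Δ′}
        ; isEquivalence₁ = record { refl = λ _ → refl ; sym = λ p k → sym (p k) ; trans = λ p q k → trans (p k) (q k) }
        ; isEquivalence₂ = record
          { refl = λ _ _ _ → ≈-refl ; sym = λ p i j gap → ≈-sym (p i j gap)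
          ; trans = λ {F} {G} {H} → ≈F-trans {F} {G} {H} } }
      ; injective = λ {Δ} {Δ′} → frieze-injective {Δ} {Δ′} }
    ; surjective = λ F → Recover.triangulation F , λ {Δ} Δ≈ →
        ≈F-trans {OfTriangulation.frieze Δ} {OfTriangulation.frieze (Recover.triangulation F)} {F}
          (frieze-cong {Δ} {Recover.triangulation F} Δ≈) (Recover.recovers F) }
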